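{- For $q\geq 4$ even, planes in $\mathrm{PG}(5,q)$ with point-orbit distribution $[0,1,0,q^2+q]$ form a unique $K$-orbit, namely $\Sigma_{18},$ with hyperplane-orbit distribution $[1,0,0,q^2+q]$.
   Context: Points of $\mathrm{PG}(5,q)$ are identified with symmetric $3\times3$ matrices over $\mathbb{F}_q$ up to scalars; rank of a point is the rank of its matrix. $K\cong\mathrm{PGL}(3,q)$ acts by $M\mapsto AMA^T$. For $q$ even, the point-orbit distribution of a subspace $W$ is $[r_1,r_{2,n},r_{2,s},r_3]$, where $r_1,r_3$ count points of rank 1 and 3 in $W$, $r_{2,n}$ counts rank-2 points in $W\cap\pi_{\mathcal{N}}$ and $r_{2,s}$ rank-2 points of $W$ outside $\pi_{\mathcal{N}}$; here $\pi_{\mathcal{N}}=\mathcal{Z}(Y_0,Y_3,Y_5)$ is the nucleus plane (zero-diagonal matrices). Hyperplanes $\mathcal{Z}(\sum a_{ij}Y)$ correspond to conics $\mathcal{Z}(\sum_{i\le j}a_{ij}X_iX_j)$ of $\mathrm{PG}(2,q)$, giving four $K$-orbits $\mathcal{H}_1,\mathcal{H}_{2,r},\mathcal{H}_{2,i},\mathcal{H}_3$ (double lines, pairs of real lines, pairs of conjugate imaginary lines, non-singular conics); the hyperplane-orbit distribution of $W$ is $[h_1,h_{2,r},h_{2,i},h_3]$, counting hyperplanes of each orbit containing $W$. $\Sigma_{18}$ is the name given to the resulting orbit. -}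

module Defs where

open import Level using (0ℓ)
open import Data.Nat as ℕ using (ℕ; zero; suc)
open import Data.Fin using (Fin; zero; suc)
open import Data.Vec using (Vec; []; _∷_; lookup; zipWith; map)
open import Data.List using (List; []; _∷_; length)
open import Data.Bool.ListAction using (any)
open import Data.List.Membership.Propositional using (_∈_)
open import Data.List.Relation.Unary.Unique.Propositional using (Unique)
open import Data.Bool using (Bool; true; false; if_then_else_; not)
open import Data.Product using (Σ; ∃; _×_; _,_)
open import Data.Sum using (_⊎_)
open import Data.Empty using (⊥)
open import Relation.Nullary using (¬_; does)
open import Relation.Binary.PropositionalEquality using (_≡_; _≢_)
open import Relation.Binary.Definitions using (DecidableEquality)
open import Algebra.Structures using (IsCommutativeRing)
open import Function.Bundles using (_⇔_)

record FiniteField : Set₁ where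
  field
    F     : Set
    𝟘 𝟙   : F
    _⊕_   : F → F → F
    _⊗_   : F → F → F
    ⊖_    : F → F
    isCommutativeRing : IsCommutativeRing _≡_ _⊕_ _⊗_ ⊖_ 𝟘 𝟙
    𝟘≢𝟙   : 𝟘 ≢ 𝟙
    inverse : ∀ x → x ≢ 𝟘 → ∃ λ y → x ⊗ y ≡ 𝟙
    _≟_   : DecidableEquality F
    elements : List F
    complete : ∀ x → x ∈ elements
    distinct : Unique elements

  infixl 6 _⊕_
  infixl 7 _⊗_

order : FiniteField → ℕ
order 𝔽 = length (FiniteField.elements 𝔽)

module _ (𝔽 : FiniteField) where
  open FiniteField 𝔽

  _⊝_ : F → F → F
  x ⊝ y = x ⊕ (⊖ y)
  infixl 6 _⊝_

  Mat : Set
  Mat = Fin 3 → Fin 3 → F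

  i0 i1 i2 : Fin 3
  i0 = zero
  i1 = suc zero
  i2 = suc (suc zero)

  sum3 : (Fin 3 → F) → F
  sum3 f = f i0 ⊕ f i1 ⊕ f i2

  _·_ : Mat → Mat → Mat
  (A · B) i j = sum3 (λ k → A i k ⊗ B k j)

  transpose : Mat → Mat
  transpose A i j = A j i

  det : Mat → F
  det M = (M i0 i0 ⊗ (M i1 i1 ⊗ M i2 i2 ⊝ M i1 i2 ⊗ M i2 i1))
        ⊝ (M i0 i1 ⊗ (M i1 i0 ⊗ M i2 i2 ⊝ M i1 i2 ⊗ M i2 i0))
        ⊕ (M i0 i2 ⊗ (M i1 i0 ⊗ M i2 i1 ⊝ M i1 i1 ⊗ M i2 i0))

  pairs : List (Fin 3 × Fin 3)
  pairs = (i0 , i1) ∷ (i0 , i2) ∷ (i1 , i2) ∷ []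

  allIdx : List (Fin 3 × Fin 3)
  allIdx = (i0 , i0) ∷ (i0 , i1) ∷ (i0 , i2) ∷ (i1 , i0) ∷ (i1 , i1)
         ∷ (i1 , i2) ∷ (i2 , i0) ∷ (i2 , i1) ∷ (i2 , i2) ∷ []

  nonzero? : F → Bool
  nonzero? x = not (does (x ≟ 𝟘))

  someMinor2≠0 : Mat → Bool
  someMinor2≠0 M =
    any (λ { (r1 , r2) → any (λ { (c1 , c2) →
            nonzero? (M r1 c1 ⊗ M r2 c2 ⊝ M r1 c2 ⊗ M r2 c1) }) pairs }) pairs

  someEntry≠0 : Mat → Bool
  someEntry≠0 M = any (λ { (i , j) → nonzero? (M i j) }) allIdx

  rank : Mat → ℕ
  rank M = if nonzero? (det M) then 3
           else if someMinor2≠0 M then 2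
           else if someEntry≠0 M then 1
           else 0

  -- Coordinates of PG(5,q): (Y0,…,Y5) ↔ symmetric matrix
  --   [ Y0 Y1 Y2 ; Y1 Y3 Y4 ; Y2 Y4 Y5 ]

  V6 : Set
  V6 = Vec F 6

  toMat : V6 → Mat
  toMat (y0 ∷ y1 ∷ y2 ∷ y3 ∷ y4 ∷ y5 ∷ []) = λ
    { zero zero → y0 ; zero (suc zero) → y1 ; zero (suc (suc zero)) → y2
    ; (suc zero) zero → y1 ; (suc zero) (suc zero) → y3 ; (suc zero) (suc (suc zero)) → y4
    ; (suc (suc zero)) zero → y2 ; (suc (suc zero)) (suc zero) → y4
    ; (suc (suc zero)) (suc (suc zero)) → y5 }

  fromMat : Mat → V6
  fromMat M = M i0 i0 ∷ M i0 i1 ∷ M i0 i2 ∷ M i1 i1 ∷ M i1 i2 ∷ M i2 i2 ∷ []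

  act : Mat → V6 → V6
  act A y = fromMat ((A · toMat y) · transpose A)

  InNucleus : V6 → Set
  InNucleus y = lookup y zero ≡ 𝟘
              × lookup y (suc (suc (suc zero))) ≡ 𝟘
              × lookup y (suc (suc (suc (suc (suc zero))))) ≡ 𝟘

  -- Normalised representatives of projective points:
  -- non-zero vectors whose first non-zero coordinate is 1.

  Normalised : ∀ {n} → Vec F n → Set
  Normalised [] = ⊥
  Normalised (x ∷ xs) = (x ≡ 𝟙) ⊎ (x ≡ 𝟘 × Normalised xs)

  HasCount : ∀ {n} → (Vec F n → Set) → ℕ → Set
  HasCount {n} P k = Σ (List (Vec F n)) λ l →
    Unique l × (∀ v → (v ∈ l) ⇔ (Normalised v × P v)) × length l ≡ k

  _*ᵥ_ : ∀ {n} → F → Vec F n → Vec F n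
  a *ᵥ v = map (a ⊗_) v

  _+ᵥ_ : ∀ {n} → Vec F n → Vec F n → Vec F n
  _+ᵥ_ = zipWith _⊕_

  zeroᵥ : ∀ {n} → Vec F n
  zeroᵥ {zero} = []
  zeroᵥ {suc n} = 𝟘 ∷ zeroᵥ

  record Plane : Set where
    field
      b₀ b₁ b₂ : V6
      independent : ∀ a b c →
        (a *ᵥ b₀) +ᵥ ((b *ᵥ b₁) +ᵥ (c *ᵥ b₂)) ≡ zeroᵥ →
        a ≡ 𝟘 × b ≡ 𝟘 × c ≡ 𝟘

  pt : Plane → Vec F 3 → V6
  pt W (a ∷ b ∷ c ∷ []) = (a *ᵥ b₀) +ᵥ ((b *ᵥ b₁) +ᵥ (c *ᵥ b₂))
    where open Plane W

  _∈W_ : V6 → Plane → Set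
  y ∈W W = ∃ λ c → y ≡ pt W c

  -- point-orbit distribution [r1, r2n, r2s, r3]
  -- (points of W ↔ normalised coordinate triples)
  PointDist : Plane → ℕ → ℕ → ℕ → ℕ → Set
  PointDist W r1 r2n r2s r3 =
      HasCount (λ c → rank (toMat (pt W c)) ≡ 1) r1
    × HasCount (λ c → rank (toMat (pt W c)) ≡ 2 × InNucleus (pt W c)) r2n
    × HasCount (λ c → rank (toMat (pt W c)) ≡ 2 × ¬ InNucleus (pt W c)) r2s
    × HasCount (λ c → rank (toMat (pt W c)) ≡ 3) r3

  -- W and W' lie in the same K-orbit, K = PGL(3,q) acting by M ↦ A M Aᵀ
  KEquiv : Plane → Plane → Set
  KEquiv W W' = ∃ λ (A : Mat) → det A ≢ 𝟘
    × (∀ y → y ∈W W → act A y ∈W W')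
    × (∀ y' → y' ∈W W' → ∃ λ y → y ∈W W × act A y ≡ y')

  -- Hyperplanes Z(Σ a_ij Y_ij) and their conics Σ_{i≤j} a_ij X_i X_j

  dot : V6 → V6 → F
  dot (a0 ∷ a1 ∷ a2 ∷ a3 ∷ a4 ∷ a5 ∷ []) (y0 ∷ y1 ∷ y2 ∷ y3 ∷ y4 ∷ y5 ∷ []) =
    a0 ⊗ y0 ⊕ a1 ⊗ y1 ⊕ a2 ⊗ y2 ⊕ a3 ⊗ y3 ⊕ a4 ⊗ y4 ⊕ a5 ⊗ y5

  QForm : Set
  QForm = Vec F 3 → F

  conic : V6 → QForm
  conic (a0 ∷ a1 ∷ a2 ∷ a3 ∷ a4 ∷ a5 ∷ []) (x0 ∷ x1 ∷ x2 ∷ []) =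
    a0 ⊗ x0 ⊗ x0 ⊕ a1 ⊗ x0 ⊗ x1 ⊕ a2 ⊗ x0 ⊗ x2
    ⊕ a3 ⊗ x1 ⊗ x1 ⊕ a4 ⊗ x1 ⊗ x2 ⊕ a5 ⊗ x2 ⊗ x2

  matVec : Mat → Vec F 3 → Vec F 3
  matVec B x = map (λ i → sum3 (λ j → B i j ⊗ lookup x j)) (i0 ∷ i1 ∷ i2 ∷ [])

  InOrbitOf : QForm → QForm → Set
  InOrbitOf rep Q = ∃ λ (B : Mat) → det B ≢ 𝟘 × ∃ λ μ → μ ≢ 𝟘 ×
    (∀ x → Q x ≡ μ ⊗ rep (matVec B x))

  doubleLine realPair nonSingular : QForm
  doubleLine  (x0 ∷ x1 ∷ x2 ∷ []) = x0 ⊗ x0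
  realPair    (x0 ∷ x1 ∷ x2 ∷ []) = x0 ⊗ x1
  nonSingular (x0 ∷ x1 ∷ x2 ∷ []) = x0 ⊗ x2 ⊕ x1 ⊗ x1

  imagPair : F → QForm
  imagPair λ₀ (x0 ∷ x1 ∷ x2 ∷ []) = x0 ⊗ x0 ⊕ x0 ⊗ x1 ⊕ λ₀ ⊗ x1 ⊗ x1

  H₁ H₂r H₂i H₃ : V6 → Set
  H₁  a = InOrbitOf doubleLine (conic a)
  H₂r a = InOrbitOf realPair (conic a)
  H₂i a = ∃ λ λ₀ → (∀ t → t ⊗ t ⊕ t ⊕ λ₀ ≢ 𝟘) × InOrbitOf (imagPair λ₀) (conic a)
  H₃  a = InOrbitOf nonSingular (conic a)

  ContainsPlane : V6 → Plane → Set
  ContainsPlane a W = dot a b₀ ≡ 𝟘 × dot a b₁ ≡ 𝟘 × dot a b₂ ≡ 𝟘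
    where open Plane W

  HypDist : Plane → ℕ → ℕ → ℕ → ℕ → Set
  HypDist W h1 h2r h2i h3 =
      HasCount (λ a → ContainsPlane a W × H₁ a) h1
    × HasCount (λ a → ContainsPlane a W × H₂r a) h2r
    × HasCount (λ a → ContainsPlane a W × H₂i a) h2i
    × HasCount (λ a → ContainsPlane a W × H₃ a) h3

{-# OPTIONS --safe #-}
-- Let P be the singular point of W, moved by K to the matrix E₀₁ + E₁₀. In characteristic 2,
-- det (y + tP) = det y + t² y₅, and every element is a square, so y₅ vanishes on W. Then
-- det y = y₀ y₄² + y₃ y₂², and W is spanned by P and two matrices determined by a binary cubic form
-- without zeros in (s , t) = (y₂ , y₄). The stabiliser of P induces GL₂ and scalars on these forms, and
-- all of them are equivalent to f = s³ + st² + ct³, where c is not of the form x³ + x: with θ³ = θ + c,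
-- the elements sθ + tθ² of F(θ) satisfy x³ + ax + b = 0 for pairs (a , b) without roots in F, each pair
-- arises at most three times, and counting the roots in F of all cubics x³ + ax + b shows that there are
-- only (q² - 1)/3 pairs without roots, so all of them arise. The hyperplanes through the resulting plane
-- are (α , 0 , α + β , β , cα , γ): a double line if α = β = 0, and otherwise non-singular because f has
-- no zeros.
module Submission where

open import Defs
open import Data.Nat using (ℕ; zero; suc; _+_; _*_; _≤_; z≤n; s≤s)
open import Data.Nat.Properties using (≤-refl; ≤-trans; ≤-reflexive; ≤-antisym; +-mono-≤; +-monoˡ-≤; +-monoʳ-≤; 1+n≰n; n≤1+n; n≤0⇒n≡0; m≤m+n; m+1+n≰m; +-identityʳ; +-assoc; +-comm; +-suc; suc-injective; *-identityʳ; *-zeroʳ; *-distribˡ-+; *-distribʳ-+; module ≤-Reasoning) renaming (_≟_ to _≟ℕ_)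
open import Data.Nat.Divisibility using (_∣_; divides; ∣m+n∣m⇒∣n; ∣1⇒≡1)
open import Data.Nat.Solver using (module +-*-Solver)
open import Data.Bool using (Bool; true; false; if_then_else_)
open import Data.Bool.ListAction using (any)
open import Data.Bool.Properties using (xor-∧-commutativeRing; ∨-zeroʳ)
open import Data.Maybe using (Maybe; just; nothing)
open import Data.Fin using (Fin; combine; _↑ˡ_; _↑ʳ_)
open import Data.Fin.Patterns using (0F; 1F; 2F; 3F; 4F; 5F)
open import Data.Vec using (Vec; []; _∷_; lookup) renaming (_++_ to _++ᵛ_)
open import Data.Vec.Properties using (∷-injective) renaming (≡-dec to ≡-decᵛ)
open import Data.List as List using (List; []; _∷_; _++_; length; map; filter; cartesianProduct)
open import Data.List.Properties using (length-map; length-++)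
open import Data.List.Membership.Propositional using (_∈_; find; lose)
open import Data.List.Membership.Propositional.Properties using (∈-∃++; ∈-map⁺; ∈-map⁻; ∈-++⁺ˡ; ∈-++⁺ʳ; ∈-++⁻; ∈-filter⁺; ∈-filter⁻; ∈-length; ∈-cartesianProduct⁺)
open import Data.List.Relation.Unary.Any using (Any; here; there; any?)
open import Data.List.Relation.Unary.All as All using ([]; _∷_)
open import Data.List.Relation.Unary.AllPairs using ([]; _∷_)
open import Data.List.Relation.Unary.Unique.Propositional using (Unique)
open import Data.List.Relation.Unary.Unique.Propositional.Properties using (map⁺; ++⁺; filter⁺; cartesianProduct⁺; Unique[x∷xs]⇒x∉xs)
open import Data.List.Relation.Binary.Subset.Propositional using (_⊆_)
open import Data.List.Relation.Binary.Permutation.Propositional using (_↭_; ↭-sym; ↭⇒↭ₛ)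
open import Data.List.Relation.Binary.Permutation.Propositional.Properties using (∈-resp-↭; ↭-length; shift)
import Data.List.Relation.Binary.Permutation.Setoid.Properties as Permutationₛ
open import Data.Product using (∃; _×_; _,_; proj₁; proj₂)
open import Data.Product.Properties using (≡-dec)
open import Data.Sum using (_⊎_; inj₁; inj₂)
open import Function using (_∘_)
open import Function.Bundles using (_⇔_; mk⇔; module Equivalence)
open import Relation.Nullary using (¬_; Dec; does; yes; no; contradiction; ¬?; _×-dec_)
open import Relation.Nullary.Decidable using (decidable-stable)
open import Relation.Binary.Definitions using (DecidableEquality)
open import Relation.Binary.PropositionalEquality using (_≡_; _≢_; refl; sym; trans; cong; cong₂; subst; setoid; module ≡-Reasoning)
open import Algebra.Bundles using (CommutativeRing)
open import Algebra.Solver.Ring.AlmostCommutativeRing using (AlmostCommutativeRing; fromCommutativeRing; _-Raw-AlmostCommutative⟶_)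
import Algebra.Solver.Ring
open Equivalence using (to; from)

-- Uniqueness of the cubic extension of a finite field would settle the equivalence of the forms at
-- once, but no extension is constructed here: F(θ) occurs only through coordinates on 1, θ, θ², and
-- every use of it is a polynomial identity over F. In characteristic 2 the trace of θ² is the
-- square of the trace of θ, which is 0; so θ and θ² span the elements of trace 0, and this is why
-- their cubics lack the x² term. A general form reaches that shape by a shift. The choice x³ + x +
-- c is uniform in q, whereas a root-free x³ + c exists only if 3 divides q - 1. The bound on
-- root-free pairs comes from two moments. If n is the number of roots in F, then over all q² pairs
-- n sums to q² and n² sums to 2q² - q, so (n - 1)(n - 3) = n² - 4n + 3 sums to q² - q. This
-- polynomial is 3 at n = 0 and negative only at n = 2, where it is -1; two roots occur only for b =
-- 0 and a ≠ 0, that is, for at most q - 1 pairs. Hence three times the number of root-free pairs is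
-- at most q² - 1.

private
  variable
    𝒜 ℬ : Set
    n : ℕ

-- Finite lists and sums

Unique-resp-↭ : {xs ys : List 𝒜} → xs ↭ ys → Unique xs → Unique ys
Unique-resp-↭ {𝒜} p = Permutationₛ.Unique-resp-↭ (setoid 𝒜) (↭⇒↭ₛ p)

∈⇒↭∷ : ∀ {x : 𝒜} {xs} → x ∈ xs → ∃ λ ys → xs ↭ x ∷ ys
∈⇒↭∷ {x = x} x∈xs with ys , zs , refl ← ∈-∃++ x∈xs = ys ++ zs , shift x ys zs

∈-tail : ∀ {x y : 𝒜} {xs} → y ∈ x ∷ xs → y ≢ x → y ∈ xs
∈-tail (here y≡x) y≢x = contradiction y≡x y≢x
∈-tail (there y∈) _ = y∈

length-mono-⊆ : {xs ys : List 𝒜} → Unique xs → xs ⊆ ys → length xs ≤ length ys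
length-mono-⊆ {xs = []} _ _ = z≤n
length-mono-⊆ {xs = x ∷ xs} {ys} u@(_ ∷ uxs) sub with zs , p ← ∈⇒↭∷ (sub (here refl)) =
  ≤-trans (s≤s (length-mono-⊆ uxs xs⊆zs)) (≤-reflexive (sym (↭-length p)))
  where
  xs⊆zs : xs ⊆ zs
  xs⊆zs y∈xs = ∈-tail (∈-resp-↭ p (sub (there y∈xs)))
    λ y≡x → Unique[x∷xs]⇒x∉xs u (subst (_∈ xs) y≡x y∈xs)

module _ {xs : List 𝒜} (complete : ∀ x → x ∈ xs) (unique : Unique xs) (_≟_ : DecidableEquality 𝒜) where
  open import Data.List.Membership.DecPropositional _≟_ using (_∈?_)

  -- A missed `y` would extend `map f xs` to a duplicate-free list longer than the complete list
  -- `xs`.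
  injective⇒surjective : {f : 𝒜 → 𝒜} → (∀ {x y} → f x ≡ f y → x ≡ y) → ∀ y → ∃ λ x → f x ≡ y
  injective⇒surjective {f} inj y with y ∈? map f xs
  ... | yes y∈ with x , _ , y≡fx ← ∈-map⁻ f y∈ = x , sym y≡fx
  ... | no y∉ = contradiction
    (≤-trans (≤-reflexive (cong suc (sym (length-map f xs))))
      (length-mono-⊆ {xs = y ∷ map f xs} (All.tabulate (λ z∈ y≡z → y∉ (subst (_∈ _) (sym y≡z) z∈)) ∷ map⁺ inj unique)
        (λ {z} _ → complete z)))
    1+n≰n

  -- Without `a` the remaining elements `ys` still produce every value, because `f a` is also `f b`;
  -- but `ys` is one element too short for its images to cover the whole type.
  collision⇒missed : (f : 𝒜 → 𝒜) → ∀ {a b} → a ≢ b → f a ≡ f b → ∃ λ y → ∀ x → f x ≢ y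
  collision⇒missed f {a} {b} a≢b fa≡fb with ys , p ← ∈⇒↭∷ (complete a)
                                     with any? (λ y → ¬? (y ∈? map f ys)) xs
  ... | no none = contradiction
    (≤-trans (≤-reflexive (sym (↭-length p)))
      (≤-trans (length-mono-⊆ unique xs⊆) (≤-reflexive (length-map f ys))))
    1+n≰n
    where
    xs⊆ : xs ⊆ map f ys
    xs⊆ {y} y∈xs with y ∈? map f ys
    ... | yes y∈ = y∈
    ... | no y∉ = contradiction (lose y∈xs y∉) none
  ... | yes some with y , _ , y∉ ← find some = y , λ x fx≡y → y∉ (subst (_∈ map f ys) fx≡y (hit x))
    where
    hit : ∀ x → f x ∈ map f ys
    hit x with x ≟ a
    ... | no x≢a = ∈-map⁺ f (∈-tail (∈-resp-↭ p (complete x)) x≢a)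
    ... | yes refl = subst (_∈ map f ys) (sym fa≡fb) (∈-map⁺ f (∈-tail (∈-resp-↭ p (complete b)) (a≢b ∘ sym)))

-- Each round strikes out the pair `x`, `f x`. The remaining list is obtained through a permutation
-- and is not a structural part of the input, so the recursion runs on the length bound `n`.
fixpointFree-involution⇒even : (f : 𝒜 → 𝒜) → (∀ x → f (f x) ≡ x) → ∀ n (xs : List 𝒜) → length xs ≤ n → Unique xs →
  (∀ {x} → x ∈ xs → f x ∈ xs × f x ≢ x) → 2 ∣ length xs
fixpointFree-involution⇒even f inv n [] _ _ _ = divides 0 refl
fixpointFree-involution⇒even f inv (suc n) (x ∷ xs) (s≤s le) u@(_ ∷ uxs) closed
  with ys , p ← ∈⇒↭∷ (∈-tail (proj₁ (closed (here refl))) (proj₂ (closed (here refl)))) =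
  subst (λ k → 2 ∣ suc k) (sym (↭-length p)) (2+ (fixpointFree-involution⇒even f inv n ys
    (≤-trans (n≤1+n _) (≤-trans (≤-reflexive (sym (↭-length p))) le)) uys closed′))
  where
  2+ : ∀ {k} → 2 ∣ k → 2 ∣ suc (suc k)
  2+ (divides j eq) = divides (suc j) (cong (suc ∘ suc) eq)
  u′ : Unique (f x ∷ ys)
  u′ = Unique-resp-↭ p uxs
  uys : Unique ys
  uys with _ ∷ v ← u′ = v
  closed′ : ∀ {z} → z ∈ ys → f z ∈ ys × f z ≢ z
  closed′ {z} z∈ys = ∈-tail (∈-resp-↭ p (∈-tail (proj₁ (closed (there z∈xs))) fz≢x)) fz≢fx , proj₂ (closed (there z∈xs))
    where
    z∈xs : z ∈ xs
    z∈xs = ∈-resp-↭ (↭-sym p) (there z∈ys)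
    fz≢x : f z ≢ x
    fz≢x fz≡x = Unique[x∷xs]⇒x∉xs u′ (subst (_∈ ys) (trans (sym (inv z)) (cong f fz≡x)) z∈ys)
    fz≢fx : f z ≢ f x
    fz≢fx fz≡fx = Unique[x∷xs]⇒x∉xs u (subst (_∈ xs) (trans (sym (inv z)) (trans (cong f fz≡fx) (inv x))) z∈xs)

∑ : List 𝒜 → (𝒜 → ℕ) → ℕ
∑ [] g = 0
∑ (x ∷ xs) g = g x + ∑ xs g

∑-mono : ∀ (xs : List 𝒜) {g h : 𝒜 → ℕ} → (∀ x → g x ≤ h x) → ∑ xs g ≤ ∑ xs h
∑-mono [] le = z≤n
∑-mono (x ∷ xs) le = +-mono-≤ (le x) (∑-mono xs le)

∑-cong : ∀ (xs : List 𝒜) {g h : 𝒜 → ℕ} → (∀ x → g x ≡ h x) → ∑ xs g ≡ ∑ xs h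
∑-cong [] eq = refl
∑-cong (x ∷ xs) eq = cong₂ _+_ (eq x) (∑-cong xs eq)

∑-+ : ∀ (xs : List 𝒜) (g h : 𝒜 → ℕ) → ∑ xs (λ x → g x + h x) ≡ ∑ xs g + ∑ xs h
∑-+ [] g h = refl
∑-+ (x ∷ xs) g h rewrite ∑-+ xs g h =
  solve 4 (λ a b c d → (a :+ b) :+ (c :+ d) := (a :+ c) :+ (b :+ d)) refl (g x) (h x) (∑ xs g) (∑ xs h)
  where open +-*-Solver

∑-*ˡ : ∀ (xs : List 𝒜) k (g : 𝒜 → ℕ) → ∑ xs (λ x → k * g x) ≡ k * ∑ xs g
∑-*ˡ [] k g = sym (*-zeroʳ k)
∑-*ˡ (x ∷ xs) k g rewrite ∑-*ˡ xs k g = sym (*-distribˡ-+ k (g x) (∑ xs g))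

∑-*ʳ : ∀ (xs : List 𝒜) k (g : 𝒜 → ℕ) → ∑ xs (λ x → g x * k) ≡ ∑ xs g * k
∑-*ʳ [] k g = refl
∑-*ʳ (x ∷ xs) k g rewrite ∑-*ʳ xs k g = sym (*-distribʳ-+ k (g x) (∑ xs g))

∑-const : ∀ (xs : List 𝒜) k → ∑ xs (λ _ → k) ≡ length xs * k
∑-const [] k = refl
∑-const (x ∷ xs) k = cong (k +_) (∑-const xs k)

∑-swap : ∀ (xs : List 𝒜) (ys : List ℬ) (g : 𝒜 → ℬ → ℕ) →
  ∑ xs (λ x → ∑ ys (g x)) ≡ ∑ ys (λ y → ∑ xs (λ x → g x y))
∑-swap [] ys g = sym (trans (∑-const ys 0) (*-zeroʳ (length ys)))
∑-swap (x ∷ xs) ys g rewrite ∑-swap xs ys g = sym (∑-+ ys (g x) _)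

∑-product : ∀ (xs : List 𝒜) (ys : List ℬ) (g : 𝒜 → ℕ) (h : ℬ → ℕ) →
  ∑ xs g * ∑ ys h ≡ ∑ xs (λ x → ∑ ys (λ y → g x * h y))
∑-product xs ys g h = trans (sym (∑-*ʳ xs (∑ ys h) g)) (∑-cong xs (λ x → sym (∑-*ˡ ys (g x) h)))

ι : {P : Set} → Dec P → ℕ
ι d = if does d then 1 else 0

ι-yes : {P : Set} (d : Dec P) → P → ι d ≡ 1
ι-yes (yes _) _ = refl
ι-yes (no ¬p) p = contradiction p ¬p

ι-no : {P : Set} (d : Dec P) → ¬ P → ι d ≡ 0
ι-no (yes p) ¬p = contradiction p ¬p
ι-no (no _) _ = refl

∑-ι : ∀ (xs : List 𝒜) {P : 𝒜 → Set} (P? : ∀ x → Dec (P x)) → ∑ xs (λ x → ι (P? x)) ≡ length (filter P? xs)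
∑-ι [] P? = refl
∑-ι (x ∷ xs) P? with P? x
... | yes _ = cong suc (∑-ι xs P?)
... | no _ = ∑-ι xs P?

∑-ι-one : ∀ {xs : List 𝒜} {P : 𝒜 → Set} (P? : ∀ x → Dec (P x)) → Unique xs →
  ∀ {x₀} → x₀ ∈ xs → P x₀ → (∀ {x} → P x → x ≡ x₀) → ∑ xs (λ x → ι (P? x)) ≡ 1
∑-ι-one {xs = xs} P? u {x₀} x₀∈ p uniq = trans (∑-ι xs P?) (≤-antisym
  (length-mono-⊆ {ys = x₀ ∷ []} (filter⁺ P? u) (λ z∈ → here (uniq (proj₂ (∈-filter⁻ P? {xs = xs} z∈)))))
  (∈-length (∈-filter⁺ P? x₀∈ p)))


∑-++ : ∀ (xs ys : List 𝒜) (g : 𝒜 → ℕ) → ∑ (xs ++ ys) g ≡ ∑ xs g + ∑ ys g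
∑-++ [] ys g = refl
∑-++ (x ∷ xs) ys g rewrite ∑-++ xs ys g = sym (+-assoc (g x) _ _)

∑-map : ∀ (h : 𝒜 → ℬ) (xs : List 𝒜) (g : ℬ → ℕ) → ∑ (map h xs) g ≡ ∑ xs (λ x → g (h x))
∑-map h [] g = refl
∑-map h (x ∷ xs) g = cong (g (h x) +_) (∑-map h xs g)

∑-cartesianProduct : ∀ (xs : List 𝒜) (ys : List ℬ) (g : 𝒜 × ℬ → ℕ) →
  ∑ (cartesianProduct xs ys) g ≡ ∑ xs (λ x → ∑ ys (λ y → g (x , y)))
∑-cartesianProduct [] ys g = refl
∑-cartesianProduct (x ∷ xs) ys g = trans (∑-++ (map (x ,_) ys) _ g)
  (cong₂ _+_ (∑-map (x ,_) ys g) (∑-cartesianProduct xs ys g))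

length-cartesianProduct : ∀ (xs : List 𝒜) (ys : List ℬ) → length (cartesianProduct xs ys) ≡ length xs * length ys
length-cartesianProduct [] ys = refl
length-cartesianProduct (x ∷ xs) ys = trans (length-++ (map (x ,_) ys))
  (cong₂ _+_ (length-map (x ,_) ys) (length-cartesianProduct xs ys))

ι-mono : {P Q : Set} (p : Dec P) (q : Dec Q) → (P → Q) → ι p ≤ ι q
ι-mono (no _) _ _ = z≤n
ι-mono (yes p) q imp = ≤-reflexive (sym (ι-yes q (imp p)))

ι-× : {P Q : Set} (p : Dec P) (q : Dec Q) → ι p * ι q ≡ ι (p ×-dec q)
ι-× (yes _) (yes _) = refl
ι-× (yes _) (no _) = refl
ι-× (no _) _ = refl

∑-ι≤length : ∀ {xs ys : List 𝒜} {P : 𝒜 → Set} (P? : ∀ x → Dec (P x)) → Unique xs →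
  (∀ {x} → P x → x ∈ ys) → ∑ xs (λ x → ι (P? x)) ≤ length ys
∑-ι≤length {xs = xs} P? u P⊆ = ≤-trans (≤-reflexive (∑-ι xs P?))
  (length-mono-⊆ (filter⁺ P? u) (λ z∈ → P⊆ (proj₂ (∈-filter⁻ P? {xs = xs} z∈))))


module _ where
  open +-*-Solver

  -- This is (n - 1)(n - 3) ≥ 0 for n = 4 + k without subtraction; the difference of the two sides
  -- is 3 + k(4 + k).
  4n≤3+n² : ∀ k → 4 * (4 + k) ≤ 3 + (4 + k) * (4 + k)
  4n≤3+n² k = ≤-trans (m≤m+n (4 * (4 + k)) (3 + k * (4 + k))) (≤-reflexive
    (solve 1 (λ k → con 4 :* (con 4 :+ k) :+ (con 3 :+ k :* (con 4 :+ k)) := con 3 :+ (con 4 :+ k) :* (con 4 :+ k)) refl k))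

  5n+3≡n+3+4n : ∀ n → 5 * n + 3 ≡ n + 3 * 1 + 4 * n
  5n+3≡n+3+4n = solve 1 (λ n → con 5 :* n :+ con 3 := n :+ con 3 :* con 1 :+ con 4 :* n) refl

  3n+2n≡5n : ∀ n → n * 3 + (n + n) ≡ 5 * n
  3n+2n≡5n = solve 1 (λ n → n :* con 3 :+ (n :+ n) := con 5 :* n) refl

-- Fields of characteristic two

module _ (𝔽 : FiniteField) where
  open FiniteField 𝔽

  commutativeRing : CommutativeRing _ _
  commutativeRing = record { isCommutativeRing = isCommutativeRing }

  private
    module R = CommutativeRing commutativeRing
  open import Algebra.Properties.Ring R.ring using (-‿involutive; -0#≈0#)

  -- If 1 + 1 ≠ 0, then negation pairs off the nonzero elements, so the order is odd.
  even-order⇒1+1≡0 : 2 ∣ order 𝔽 → 𝟙 ⊕ 𝟙 ≡ 𝟘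
  even-order⇒1+1≡0 even = decidable-stable ((𝟙 ⊕ 𝟙) ≟ 𝟘) λ 1+1≢0 → odd 1+1≢0 (∈⇒↭∷ (complete 𝟘))
    where
    2≢1 : ¬ (2 ≡ 1)
    2≢1 ()
    odd : 𝟙 ⊕ 𝟙 ≢ 𝟘 → ¬ (∃ λ ys → elements ↭ 𝟘 ∷ ys)
    odd 1+1≢0 (ys , p) = 2≢1 (∣1⇒≡1 (∣m+n∣m⇒∣n (subst (2 ∣_) (trans (↭-length p) (+-comm 1 (length ys))) even)
        (fixpointFree-involution⇒even ⊖_ -‿involutive (length ys) ys ≤-refl (tail u) λ x∈ → closed x∈ , moved x∈)))
      where
      u : Unique (𝟘 ∷ ys)
      u = Unique-resp-↭ p distinct
      tail : Unique (𝟘 ∷ ys) → Unique ys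
      tail (_ ∷ v) = v
      ≢0 : ∀ {x} → x ∈ ys → x ≢ 𝟘
      ≢0 x∈ refl = Unique[x∷xs]⇒x∉xs u x∈
      closed : ∀ {x} → x ∈ ys → ⊖ x ∈ ys
      closed {x} x∈ = ∈-tail (∈-resp-↭ p (complete (⊖ x))) λ -x≡0 → ≢0 x∈ (trans (sym (-‿involutive x)) (trans (cong ⊖_ -x≡0) -0#≈0#))
      moved : ∀ {x} → x ∈ ys → ⊖ x ≢ x
      moved {x} x∈ -x≡x = let i , xi≡1 = inverse x (≢0 x∈) in 1+1≢0 (begin
        𝟙 ⊕ 𝟙             ≡⟨ cong₂ _⊕_ xi≡1 xi≡1 ⟨
        x ⊗ i ⊕ x ⊗ i     ≡⟨ R.distribʳ i x x ⟨
        (x ⊕ x) ⊗ i       ≡⟨ cong (λ y → (x ⊕ y) ⊗ i) -x≡x ⟨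
        (x ⊕ (⊖ x)) ⊗ i   ≡⟨ cong (_⊗ i) (R.-‿inverseʳ x) ⟩
        𝟘 ⊗ i             ≡⟨ R.zeroˡ i ⟩
        𝟘                 ∎)
        where open ≡-Reasoning

module CharacteristicTwo (𝔽 : FiniteField)
  (1+1≡0 : FiniteField._⊕_ 𝔽 (FiniteField.𝟙 𝔽) (FiniteField.𝟙 𝔽) ≡ FiniteField.𝟘 𝔽) where
  open FiniteField 𝔽

  module R = CommutativeRing (commutativeRing 𝔽)
  open import Algebra.Properties.Ring R.ring using (-0#≈0#)

  acr : AlmostCommutativeRing _ _
  acr = fromCommutativeRing (commutativeRing 𝔽)

  bit : Bool → F
  bit true = 𝟙
  bit false = 𝟘

  -1≡1 : ⊖ 𝟙 ≡ 𝟙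
  -1≡1 = trans (sym (R.+-identityˡ _)) (trans (cong (_⊕ (⊖ 𝟙)) (sym 1+1≡0))
    (trans (R.+-assoc _ _ _) (trans (cong (𝟙 ⊕_) (R.-‿inverseʳ 𝟙)) (R.+-identityʳ 𝟙))))

  bitHom : CommutativeRing.rawRing xor-∧-commutativeRing -Raw-AlmostCommutative⟶ acr
  bitHom = record
    { ⟦_⟧ = bit
    ; +-homo = λ { true true → sym 1+1≡0 ; true false → sym (R.+-identityʳ _) ; false _ → sym (R.+-identityˡ _) }
    ; *-homo = λ { true _ → sym (R.*-identityˡ _) ; false _ → sym (R.zeroˡ _) }
    ; -‿homo = λ { true → sym -1≡1 ; false → sym -0#≈0# }
    ; 0-homo = refl
    ; 1-homo = refl }

  bit≟ : ∀ x y → Maybe (bit x ≡ bit y)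
  bit≟ true true = just refl
  bit≟ false false = just refl
  bit≟ _ _ = nothing

  -- With coefficients in the two-element field, the solver decides identities modulo 2.
  open Algebra.Solver.Ring (CommutativeRing.rawRing xor-∧-commutativeRing) acr bitHom bit≟ public
    using (solve; prove; _:=_; _:+_; _:*_; :-_; con; var; Polynomial)

  -- A name starting with a colon is the solver's syntax for the operation of that name.
  :0 :1 : ∀ {n} → Polynomial n
  :0 = con false
  :1 = con true

  x⊕x≡0 : ∀ x → x ⊕ x ≡ 𝟘
  x⊕x≡0 = solve 1 (λ x → x :+ x := :0) refl

  x⊕y≡0⇒x≡y : ∀ {x y} → x ⊕ y ≡ 𝟘 → x ≡ y
  x⊕y≡0⇒x≡y {x} {y} e = trans (solve 2 (λ x y → x := (x :+ y) :+ y) refl x y) (trans (cong (_⊕ y) e) (R.+-identityˡ y))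

  x≡y⇒x⊕y≡0 : ∀ {x y} → x ≡ y → x ⊕ y ≡ 𝟘
  x≡y⇒x⊕y≡0 {x} refl = x⊕x≡0 x

  x⊗0 : ∀ {x y} → y ≡ 𝟘 → x ⊗ y ≡ 𝟘
  x⊗0 {x} refl = R.zeroʳ x

  0⊗x : ∀ {x y} → y ≡ 𝟘 → y ⊗ x ≡ 𝟘
  0⊗x {x} refl = R.zeroˡ x

  0⊕0 : ∀ {x y} → x ≡ 𝟘 → y ≡ 𝟘 → x ⊕ y ≡ 𝟘
  0⊕0 refl refl = R.+-identityˡ 𝟘

  _⁻¹[_] : ∀ x → x ≢ 𝟘 → F
  x ⁻¹[ x≢0 ] = proj₁ (inverse x x≢0)

  inverseʳ : ∀ {x} (x≢0 : x ≢ 𝟘) → x ⊗ x ⁻¹[ x≢0 ] ≡ 𝟙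
  inverseʳ x≢0 = proj₂ (inverse _ x≢0)

  cancelˡ : ∀ {x y} → x ≢ 𝟘 → x ⊗ y ≡ 𝟘 → y ≡ 𝟘
  cancelˡ {x} {y} x≢0 xy≡0 with i , xi≡1 ← inverse x x≢0 = begin
    y             ≡⟨ R.*-identityˡ y ⟨
    𝟙 ⊗ y         ≡⟨ cong (_⊗ y) xi≡1 ⟨
    x ⊗ i ⊗ y     ≡⟨ solve 3 (λ x i y → x :* i :* y := i :* (x :* y)) refl x i y ⟩
    i ⊗ (x ⊗ y)   ≡⟨ x⊗0 xy≡0 ⟩
    𝟘             ∎
    where open ≡-Reasoning

  cancelʳ : ∀ {x y} → y ≢ 𝟘 → x ⊗ y ≡ 𝟘 → x ≡ 𝟘
  cancelʳ {x} {y} y≢0 e = cancelˡ y≢0 (trans (R.*-comm y x) e)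

  ⊗-nonzero : ∀ {x y} → x ≢ 𝟘 → y ≢ 𝟘 → x ⊗ y ≢ 𝟘
  ⊗-nonzero x≢0 y≢0 e = y≢0 (cancelˡ x≢0 e)

  x⊗x≡0⇒x≡0 : ∀ {x} → x ⊗ x ≡ 𝟘 → x ≡ 𝟘
  x⊗x≡0⇒x≡0 {x} e with x ≟ 𝟘
  ... | yes x≡0 = x≡0
  ... | no x≢0 = cancelˡ x≢0 e

  ⁻¹-nonzero : ∀ {x} (x≢0 : x ≢ 𝟘) → x ⁻¹[ x≢0 ] ≢ 𝟘
  ⁻¹-nonzero x≢0 e = 𝟘≢𝟙 (trans (sym (x⊗0 e)) (inverseʳ x≢0))

  square-injective : ∀ {x y} → x ⊗ x ≡ y ⊗ y → x ≡ y
  square-injective {x} {y} e = x⊕y≡0⇒x≡y (x⊗x≡0⇒x≡0 (trans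
    (solve 2 (λ x y → (x :+ y) :* (x :+ y) := x :* x :+ y :* y) refl x y) (x≡y⇒x⊕y≡0 e)))

  -- Squaring is additive in characteristic 2, hence injective, and an injective map of a finite set
  -- to itself is onto.
  √ : ∀ x → ∃ λ r → r ⊗ r ≡ x
  √ = injective⇒surjective complete distinct _≟_ square-injective

  -- x³ + x takes the value 0 at both 0 and 1, so some c is missed and x³ + x + c has no root.
  rootfree-parameter : ∃ λ c → ∀ x → x ⊗ x ⊗ x ⊕ x ≢ c
  rootfree-parameter = collision⇒missed complete distinct _≟_ (λ x → x ⊗ x ⊗ x ⊕ x) 𝟘≢𝟙
    (solve 0 (:0 :* :0 :* :0 :+ :0 := :1 :* :1 :* :1 :+ :1) refl)

  -- Matrices

  vec6≡ : ∀ {a b c d e f a′ b′ c′ d′ e′ f′ : F} → a ≡ a′ → b ≡ b′ → c ≡ c′ → d ≡ d′ → e ≡ e′ → f ≡ f′ →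
    _≡_ {A = V6 𝔽} (a ∷ b ∷ c ∷ d ∷ e ∷ f ∷ []) (a′ ∷ b′ ∷ c′ ∷ d′ ∷ e′ ∷ f′ ∷ [])
  vec6≡ refl refl refl refl refl refl = refl

  vec3≡ : ∀ {a b c a′ b′ c′ : F} → a ≡ a′ → b ≡ b′ → c ≡ c′ →
    _≡_ {A = Vec F 3} (a ∷ b ∷ c ∷ []) (a′ ∷ b′ ∷ c′ ∷ [])
  vec3≡ refl refl refl = refl

  entries : Mat 𝔽 → Vec F 9
  entries A = A 0F 0F ∷ A 0F 1F ∷ A 0F 2F ∷ A 1F 0F ∷ A 1F 1F ∷ A 1F 2F ∷ A 2F 0F ∷ A 2F 1F ∷ A 2F 2F ∷ []

  PMat : ℕ → Set
  PMat n = Fin 3 → Fin 3 → Polynomial n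

  -- A matrix occupies nine consecutive solver variables starting at index `k`, in the row order of
  -- `entries`. Concatenating `entries` and vectors with `++ᵛ` therefore yields the matching
  -- environment.
  :mat : ∀ k {n} → PMat (k + (9 + n))
  :mat k {n} i j = var (k ↑ʳ (combine i j ↑ˡ n))

  :vec : ∀ k m {n} → Fin m → Polynomial (k + (m + n))
  :vec k m {n} i = var (k ↑ʳ (i ↑ˡ n))

  _:·_ : ∀ {n} → PMat n → PMat n → PMat n
  (A :· B) i j = A i 0F :* B 0F j :+ A i 1F :* B 1F j :+ A i 2F :* B 2F j

  :transpose : ∀ {n} → PMat n → PMat n
  :transpose A i j = A j i

  _:-_ : ∀ {n} → Polynomial n → Polynomial n → Polynomial n
  p :- r = p :+ (:- r)

  :det : ∀ {n} → PMat n → Polynomial n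
  :det M = (M 0F 0F :* ((M 1F 1F :* M 2F 2F) :- (M 1F 2F :* M 2F 1F)))
        :- (M 0F 1F :* ((M 1F 0F :* M 2F 2F) :- (M 1F 2F :* M 2F 0F)))
        :+ (M 0F 2F :* ((M 1F 0F :* M 2F 1F) :- (M 1F 1F :* M 2F 0F)))

  :toMat : ∀ {n} → (Fin 6 → Polynomial n) → PMat n
  :toMat y = λ
    { 0F 0F → y 0F ; 0F 1F → y 1F ; 0F 2F → y 2F
    ; 1F 0F → y 1F ; 1F 1F → y 3F
    ; 1F 2F → y 4F
    ; 2F 0F → y 2F ; 2F 1F → y 4F
    ; 2F 2F → y 5F }

  :fromMat : ∀ {n} → PMat n → Fin 6 → Polynomial n
  :fromMat M = lookup (M 0F 0F ∷ M 0F 1F ∷ M 0F 2F ∷ M 1F 1F ∷ M 1F 2F ∷ M 2F 2F ∷ [])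

  :act : ∀ {n} → PMat n → (Fin 6 → Polynomial n) → Fin 6 → Polynomial n
  :act A y = :fromMat ((A :· :toMat y) :· :transpose A)

  :dot : ∀ {n} → (Fin 6 → Polynomial n) → (Fin 6 → Polynomial n) → Polynomial n
  :dot a y = a 0F :* y 0F :+ a 1F :* y 1F :+ a 2F :* y 2F
    :+ a 3F :* y 3F
    :+ a 4F :* y 4F
    :+ a 5F :* y 5F

  det-· : ∀ A B → det 𝔽 (_·_ 𝔽 A B) ≡ det 𝔽 A ⊗ det 𝔽 B
  det-· A B = prove (entries A ++ᵛ entries B) (:det (:mat 0 :· :mat 9)) (:det (:mat 0) :* :det (:mat 9)) refl

  act-· : ∀ A B y → act 𝔽 A (act 𝔽 B y) ≡ act 𝔽 (_·_ 𝔽 A B) y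
  act-· A B y@(_ ∷ _ ∷ _ ∷ _ ∷ _ ∷ _ ∷ []) = vec6≡ (p 0F refl) (p 1F refl) (p 2F refl) (p 3F refl)
      (p 4F refl) (p 5F refl)
    where
    p = λ k → prove (entries A ++ᵛ entries B ++ᵛ y) (:act (:mat 0) (:act (:mat 9) (:vec 18 6)) k) (:act (:mat 0 :· :mat 9) (:vec 18 6) k)

  -- Matrices are functions, and an identity such as A⁻¹A = `δ` is available only entrywise; this
  -- transfers it to the action.
  act-cong : ∀ {A B : Mat 𝔽} → (∀ i j → A i j ≡ B i j) → ∀ y → act 𝔽 A y ≡ act 𝔽 B y
  act-cong {A} {B} eq y = vec6≡ (h 0F 0F) (h 0F 1F) (h 0F 2F) (h 1F 1F) (h 1F 2F) (h 2F 2F)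
    where
    sum3-cong : {g h : Fin 3 → F} → (∀ i → g i ≡ h i) → sum3 𝔽 g ≡ sum3 𝔽 h
    sum3-cong gh = cong₂ _⊕_ (cong₂ _⊕_ (gh 0F) (gh 1F)) (gh 2F)
    h : ∀ i j → _·_ 𝔽 (_·_ 𝔽 A (toMat 𝔽 y)) (transpose 𝔽 A) i j ≡ _·_ 𝔽 (_·_ 𝔽 B (toMat 𝔽 y)) (transpose 𝔽 B) i j
    h i j = sum3-cong λ k → cong₂ _⊗_ (sum3-cong λ l → cong (_⊗ toMat 𝔽 y l k) (eq i l)) (eq j k)

  δ : Mat 𝔽
  δ 0F 0F = 𝟙
  δ 1F 1F = 𝟙
  δ 2F 2F = 𝟙
  δ _ _ = 𝟘

  :δ : ∀ {n} → PMat n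
  :δ 0F 0F = :1
  :δ 1F 1F = :1
  :δ 2F 2F = :1
  :δ _ _ = :0

  act-δ : ∀ y → act 𝔽 δ y ≡ y
  act-δ y@(_ ∷ _ ∷ _ ∷ _ ∷ _ ∷ _ ∷ []) = vec6≡ (p 0F refl) (p 1F refl) (p 2F refl) (p 3F refl)
      (p 4F refl) (p 5F refl)
    where
    p = λ k → prove y (:act :δ (:vec 0 6) k) (:vec 0 6 k)

  -- Cyclic successor of an index: deleting row j and column i leaves the indices that follow them
  -- cyclically, so one formula gives all cofactors in `adj`.
  next : Fin 3 → Fin 3
  next 0F = 1F
  next 1F = 2F
  next 2F = 0F

  adj : Mat 𝔽 → Mat 𝔽
  adj A i j = A (next j) (next i) ⊗ A (next (next j)) (next (next i)) ⊕ A (next j) (next (next i)) ⊗ A (next (next j)) (next i)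

  :adj : ∀ {n} → PMat n → PMat n
  :adj A i j = A (next j) (next i) :* A (next (next j)) (next (next i)) :+ A (next j) (next (next i)) :* A (next (next j)) (next i)

  module _ (A : Mat 𝔽) (d : det 𝔽 A ≢ 𝟘) where
    private
      w = det 𝔽 A ⁻¹[ d ]

    inv : Mat 𝔽
    inv i j = w ⊗ adj A i j

    private
      -- `pˡ` and `pʳ` are polynomial identities in which `w` is a free variable, with right-hand
      -- side w (det A) `δ`. Only here does w (det A) = 1 enter.
      scale : ∀ {x i j} → x ≡ w ⊗ det 𝔽 A ⊗ δ i j → x ≡ δ i j
      scale {i = i} {j} eq = trans eq (trans (cong (_⊗ δ i j) (trans (R.*-comm w (det 𝔽 A)) (inverseʳ d))) (R.*-identityˡ _))

      :inv : ∀ {n} → PMat (10 + n)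
      :inv i j = var 0F :* :adj (:mat 1) i j

      pˡ = λ i j → prove (w ∷ entries A) ((:inv :· :mat 1) i j) (var 0F :* :det (:mat 1) :* :δ i j)
      pʳ = λ i j → prove (w ∷ entries A) ((:mat 1 :· :inv) i j) (var 0F :* :det (:mat 1) :* :δ i j)

    inv-inverseˡ : ∀ i j → _·_ 𝔽 inv A i j ≡ δ i j
    inv-inverseˡ 0F 0F = scale {_} {0F} {0F} (pˡ 0F 0F refl)
    inv-inverseˡ 0F 1F = scale {_} {0F} {1F} (pˡ 0F 1F refl)
    inv-inverseˡ 0F 2F = scale {_} {0F} {2F} (pˡ 0F 2F refl)
    inv-inverseˡ 1F 0F = scale {_} {1F} {0F} (pˡ 1F 0F refl)
    inv-inverseˡ 1F 1F = scale {_} {1F} {1F} (pˡ 1F 1F refl)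
    inv-inverseˡ 1F 2F = scale {_} {1F} {2F} (pˡ 1F 2F refl)
    inv-inverseˡ 2F 0F = scale {_} {2F} {0F} (pˡ 2F 0F refl)
    inv-inverseˡ 2F 1F = scale {_} {2F} {1F} (pˡ 2F 1F refl)
    inv-inverseˡ 2F 2F = scale {_} {2F} {2F} (pˡ 2F 2F refl)

    inv-inverseʳ : ∀ i j → _·_ 𝔽 A inv i j ≡ δ i j
    inv-inverseʳ 0F 0F = scale {_} {0F} {0F} (pʳ 0F 0F refl)
    inv-inverseʳ 0F 1F = scale {_} {0F} {1F} (pʳ 0F 1F refl)
    inv-inverseʳ 0F 2F = scale {_} {0F} {2F} (pʳ 0F 2F refl)
    inv-inverseʳ 1F 0F = scale {_} {1F} {0F} (pʳ 1F 0F refl)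
    inv-inverseʳ 1F 1F = scale {_} {1F} {1F} (pʳ 1F 1F refl)
    inv-inverseʳ 1F 2F = scale {_} {1F} {2F} (pʳ 1F 2F refl)
    inv-inverseʳ 2F 0F = scale {_} {2F} {0F} (pʳ 2F 0F refl)
    inv-inverseʳ 2F 1F = scale {_} {2F} {1F} (pʳ 2F 1F refl)
    inv-inverseʳ 2F 2F = scale {_} {2F} {2F} (pʳ 2F 2F refl)

    act-invˡ : ∀ y → act 𝔽 inv (act 𝔽 A y) ≡ y
    act-invˡ y = trans (act-· inv A y) (trans (act-cong {_·_ 𝔽 inv A} {δ} inv-inverseˡ y) (act-δ y))

    act-invʳ : ∀ y → act 𝔽 A (act 𝔽 inv y) ≡ y
    act-invʳ y = trans (act-· A inv y) (trans (act-cong {_·_ 𝔽 A inv} {δ} inv-inverseʳ y) (act-δ y))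

    act-injective : ∀ {y z} → act 𝔽 A y ≡ act 𝔽 A z → y ≡ z
    act-injective {y} {z} eq = trans (sym (act-invˡ y)) (trans (cong (act 𝔽 inv) eq) (act-invˡ z))

  det-cong : ∀ {A B : Mat 𝔽} → (∀ i j → A i j ≡ B i j) → det 𝔽 A ≡ det 𝔽 B
  det-cong {A} {B} eq = cong₂ _⊕_ (cong₂ (_⊝_ 𝔽) (term 0F 1F 2F) (term 1F 0F 2F)) (term 2F 0F 1F)
    where
    term : ∀ j k l → A 0F j ⊗ (_⊝_ 𝔽 (A 1F k ⊗ A 2F l) (A 1F l ⊗ A 2F k)) ≡ B 0F j ⊗ (_⊝_ 𝔽 (B 1F k ⊗ B 2F l) (B 1F l ⊗ B 2F k))
    term j k l = cong₂ _⊗_ (eq 0F j) (cong₂ (_⊝_ 𝔽) (cong₂ _⊗_ (eq 1F k) (eq 2F l)) (cong₂ _⊗_ (eq 1F l) (eq 2F k)))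

  det-inv : ∀ A d → det 𝔽 (inv A d) ≢ 𝟘
  det-inv A d e = 𝟘≢𝟙 (begin
    𝟘                             ≡⟨ 0⊗x e ⟨
    det 𝔽 (inv A d) ⊗ det 𝔽 A     ≡⟨ det-· (inv A d) A ⟨
    det 𝔽 (_·_ 𝔽 (inv A d) A)     ≡⟨ det-cong {_·_ 𝔽 (inv A d) A} {δ} (inv-inverseˡ A d) ⟩
    det 𝔽 δ                       ≡⟨ prove [] (:det :δ) :1 refl ⟩
    𝟙                             ∎)
    where open ≡-Reasoning

  det-·-nonzero : ∀ {A B} → det 𝔽 A ≢ 𝟘 → det 𝔽 B ≢ 𝟘 → det 𝔽 (_·_ 𝔽 A B) ≢ 𝟘
  det-·-nonzero {A} {B} dA dB e = ⊗-nonzero dA dB (trans (sym (det-· A B)) e)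

  :matVec : ∀ {n} → PMat n → (Fin 3 → Polynomial n) → Fin 3 → Polynomial n
  :matVec A x i = A i 0F :* x 0F :+ A i 1F :* x 1F :+ A i 2F :* x 2F

  matVec-· : ∀ A B x → matVec 𝔽 (_·_ 𝔽 A B) x ≡ matVec 𝔽 A (matVec 𝔽 B x)
  matVec-· A B x@(_ ∷ _ ∷ _ ∷ []) = vec3≡ (p 0F refl) (p 1F refl) (p 2F refl)
    where
    p = λ i → prove (entries A ++ᵛ entries B ++ᵛ x) (:matVec (:mat 0 :· :mat 9) (:vec 18 3) i) (:matVec (:mat 0) (:matVec (:mat 9) (:vec 18 3)) i)

  matVec-cong : ∀ {A B : Mat 𝔽} → (∀ i j → A i j ≡ B i j) → ∀ x → matVec 𝔽 A x ≡ matVec 𝔽 B x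
  matVec-cong {A} {B} eq x@(x₀ ∷ x₁ ∷ x₂ ∷ []) = vec3≡ (row 0F) (row 1F) (row 2F)
    where
    row : ∀ i → A i 0F ⊗ x₀ ⊕ A i 1F ⊗ x₁ ⊕ A i 2F ⊗ x₂ ≡ B i 0F ⊗ x₀ ⊕ B i 1F ⊗ x₁ ⊕ B i 2F ⊗ x₂
    row i = cong₂ _⊕_ (cong₂ _⊕_ (cong (_⊗ x₀) (eq i 0F)) (cong (_⊗ x₁) (eq i 1F))) (cong (_⊗ x₂) (eq i 2F))

  matVec-δ : ∀ x → matVec 𝔽 δ x ≡ x
  matVec-δ x@(_ ∷ _ ∷ _ ∷ []) = vec3≡ (p 0F refl) (p 1F refl) (p 2F refl)
    where
    p = λ i → prove x (:matVec :δ (:vec 0 3) i) (:vec 0 3 i)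

  matVec-invʳ : ∀ A d x → matVec 𝔽 A (matVec 𝔽 (inv A d) x) ≡ x
  matVec-invʳ A d x = trans (sym (matVec-· A (inv A d) x))
    (trans (matVec-cong {_·_ 𝔽 A (inv A d)} {δ} (inv-inverseʳ A d) x) (matVec-δ x))

  matVec-0 : ∀ A → matVec 𝔽 A (𝟘 ∷ 𝟘 ∷ 𝟘 ∷ []) ≡ 𝟘 ∷ 𝟘 ∷ 𝟘 ∷ []
  matVec-0 A = vec3≡ (p 0F refl) (p 1F refl) (p 2F refl)
    where
    p = λ i → prove (entries A) (:matVec (:mat 0) (λ _ → :0) i) :0

  matVec-⊕ : ∀ A x y → matVec 𝔽 A (_+ᵥ_ 𝔽 x y) ≡ _+ᵥ_ 𝔽 (matVec 𝔽 A x) (matVec 𝔽 A y)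
  matVec-⊕ A x@(_ ∷ _ ∷ _ ∷ []) y@(_ ∷ _ ∷ _ ∷ []) = vec3≡ (p 0F refl) (p 1F refl) (p 2F refl)
    where
    p = λ i → prove (entries A ++ᵛ x ++ᵛ y) (:matVec (:mat 0) (λ k → :vec 9 3 k :+ :vec 12 3 k) i)
          (:matVec (:mat 0) (:vec 9 3) i :+ :matVec (:mat 0) (:vec 12 3) i)

  act-*ᵥ : ∀ A k y → act 𝔽 A (_*ᵥ_ 𝔽 k y) ≡ _*ᵥ_ 𝔽 k (act 𝔽 A y)
  act-*ᵥ A k y@(_ ∷ _ ∷ _ ∷ _ ∷ _ ∷ _ ∷ []) = vec6≡ (p 0F refl) (p 1F refl) (p 2F refl) (p 3F refl)
      (p 4F refl) (p 5F refl)
    where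
    p = λ i → prove (entries A ++ᵛ k ∷ y) (:act (:mat 0) (λ j → var (9 ↑ʳ 0F) :* :vec 10 6 j) i) (var (9 ↑ʳ 0F) :* :act (:mat 0) (:vec 10 6) i)

  act-+ᵥ : ∀ A y z → act 𝔽 A (_+ᵥ_ 𝔽 y z) ≡ _+ᵥ_ 𝔽 (act 𝔽 A y) (act 𝔽 A z)
  act-+ᵥ A y@(_ ∷ _ ∷ _ ∷ _ ∷ _ ∷ _ ∷ []) z@(_ ∷ _ ∷ _ ∷ _ ∷ _ ∷ _ ∷ []) =
    vec6≡ (p 0F refl) (p 1F refl) (p 2F refl) (p 3F refl)
      (p 4F refl) (p 5F refl)
    where
    p = λ i → prove (entries A ++ᵛ y ++ᵛ z) (:act (:mat 0) (λ j → :vec 9 6 j :+ :vec 15 6 j) i)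
          (:act (:mat 0) (:vec 9 6) i :+ :act (:mat 0) (:vec 15 6) i)

  det-transpose : ∀ A → det 𝔽 (transpose 𝔽 A) ≡ det 𝔽 A
  det-transpose A = prove (entries A) (:det (:transpose (:mat 0))) (:det (:mat 0)) refl

  toMat-act : ∀ A y i j → toMat 𝔽 (act 𝔽 A y) i j ≡ _·_ 𝔽 (_·_ 𝔽 A (toMat 𝔽 y)) (transpose 𝔽 A) i j
  toMat-act A y@(_ ∷ _ ∷ _ ∷ _ ∷ _ ∷ _ ∷ []) = λ
      { 0F 0F → refl ; 0F 1F → refl ; 0F 2F → refl
      ; 1F 0F → p 1F 0F refl ; 1F 1F → refl ; 1F 2F → refl
      ; 2F 0F → p 2F 0F refl ; 2F 1F → p 2F 1F refl ; 2F 2F → refl }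
    where
    M : PMat 15
    M = (:mat 0 :· :toMat (:vec 9 6)) :· :transpose (:mat 0)
    p = λ i j → prove (entries A ++ᵛ y) (M j i) (M i j)

  det-act : ∀ A y → det 𝔽 (toMat 𝔽 (act 𝔽 A y)) ≡ det 𝔽 A ⊗ det 𝔽 A ⊗ det 𝔽 (toMat 𝔽 y)
  det-act A y = begin
    det 𝔽 (toMat 𝔽 (act 𝔽 A y))                 ≡⟨ det-cong {toMat 𝔽 (act 𝔽 A y)} {_·_ 𝔽 (_·_ 𝔽 A M) (transpose 𝔽 A)} (toMat-act A y) ⟩
    det 𝔽 (_·_ 𝔽 (_·_ 𝔽 A M) (transpose 𝔽 A))   ≡⟨ det-· (_·_ 𝔽 A M) (transpose 𝔽 A) ⟩
    det 𝔽 (_·_ 𝔽 A M) ⊗ det 𝔽 (transpose 𝔽 A)   ≡⟨ cong₂ _⊗_ (det-· A M) (det-transpose A) ⟩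
    det 𝔽 A ⊗ det 𝔽 M ⊗ det 𝔽 A                 ≡⟨ solve 2 (λ a m → a :* m :* a := a :* a :* m) refl (det 𝔽 A) (det 𝔽 M) ⟩
    det 𝔽 A ⊗ det 𝔽 A ⊗ det 𝔽 M                 ∎
    where
    open ≡-Reasoning
    M = toMat 𝔽 y

  -- In characteristic 2 the symmetric matrices with zero diagonal are the alternating ones, and
  -- congruence preserves these.
  InNucleus-act : ∀ A {y} → InNucleus 𝔽 y → InNucleus 𝔽 (act 𝔽 A y)
  InNucleus-act A {_ ∷ y₁ ∷ y₂ ∷ _ ∷ y₄ ∷ _ ∷ []} (refl , refl , refl) = p 0F refl , p 3F refl , p 5F refl
    where
    p = λ i → prove (entries A ++ᵛ y₁ ∷ y₂ ∷ y₄ ∷ []) (:act (:mat 0) (lookup (:0 ∷ :vec 9 3 0F ∷ :vec 9 3 1F ∷ :0 ∷ :vec 9 3 2F ∷ :0 ∷ [])) i) :0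

  -- The dual action on hyperplanes and conics

  unit : Fin 6 → V6 𝔽
  unit 0F = 𝟙 ∷ 𝟘 ∷ 𝟘 ∷ 𝟘 ∷ 𝟘 ∷ 𝟘 ∷ []
  unit 1F = 𝟘 ∷ 𝟙 ∷ 𝟘 ∷ 𝟘 ∷ 𝟘 ∷ 𝟘 ∷ []
  unit 2F = 𝟘 ∷ 𝟘 ∷ 𝟙 ∷ 𝟘 ∷ 𝟘 ∷ 𝟘 ∷ []
  unit 3F = 𝟘 ∷ 𝟘 ∷ 𝟘 ∷ 𝟙 ∷ 𝟘 ∷ 𝟘 ∷ []
  unit 4F = 𝟘 ∷ 𝟘 ∷ 𝟘 ∷ 𝟘 ∷ 𝟙 ∷ 𝟘 ∷ []
  unit 5F = 𝟘 ∷ 𝟘 ∷ 𝟘 ∷ 𝟘 ∷ 𝟘 ∷ 𝟙 ∷ []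

  :unit : ∀ {n} → Fin 6 → Fin 6 → Polynomial n
  :unit 0F = lookup (:1 ∷ :0 ∷ :0 ∷ :0 ∷ :0 ∷ :0 ∷ [])
  :unit 1F = lookup (:0 ∷ :1 ∷ :0 ∷ :0 ∷ :0 ∷ :0 ∷ [])
  :unit 2F = lookup (:0 ∷ :0 ∷ :1 ∷ :0 ∷ :0 ∷ :0 ∷ [])
  :unit 3F = lookup (:0 ∷ :0 ∷ :0 ∷ :1 ∷ :0 ∷ :0 ∷ [])
  :unit 4F = lookup (:0 ∷ :0 ∷ :0 ∷ :0 ∷ :1 ∷ :0 ∷ [])
  :unit 5F = lookup (:0 ∷ :0 ∷ :0 ∷ :0 ∷ :0 ∷ :1 ∷ [])

  -- The transpose of the linear map `act A`, read off on the standard basis: it pulls a hyperplane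
  -- back along the action.
  dual : Mat 𝔽 → V6 𝔽 → V6 𝔽
  dual A a = g 0F ∷ g 1F ∷ g 2F ∷ g 3F ∷ g 4F ∷ g 5F ∷ []
    where
    g : Fin 6 → F
    g k = dot 𝔽 a (act 𝔽 A (unit k))

  :dual : ∀ {n} → PMat n → (Fin 6 → Polynomial n) → Fin 6 → Polynomial n
  :dual A a k = :dot a (:act A (:unit k))

  dot-dual : ∀ A a y → dot 𝔽 (dual A a) y ≡ dot 𝔽 a (act 𝔽 A y)
  dot-dual A a@(_ ∷ _ ∷ _ ∷ _ ∷ _ ∷ _ ∷ []) y@(_ ∷ _ ∷ _ ∷ _ ∷ _ ∷ _ ∷ []) =
    prove (entries A ++ᵛ a ++ᵛ y) (:dot (:dual (:mat 0) (:vec 9 6)) (:vec 15 6)) (:dot (:vec 9 6) (:act (:mat 0) (:vec 15 6))) refl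

  dual-cancel : ∀ A B → (∀ y → act 𝔽 A (act 𝔽 B y) ≡ y) → ∀ a → dual B (dual A a) ≡ a
  dual-cancel A B AB≡id a@(_ ∷ _ ∷ _ ∷ _ ∷ _ ∷ _ ∷ []) = vec6≡ (g 0F (p 0F refl)) (g 1F (p 1F refl)) (g 2F (p 2F refl))
      (g 3F (p 3F refl)) (g 4F (p 4F refl))
      (g 5F (p 5F refl))
    where
    p = λ k → prove a (:dot (:vec 0 6) (:unit k)) (:vec 0 6 k)
    g : ∀ k {x} → dot 𝔽 a (unit k) ≡ x → dot 𝔽 (dual A a) (act 𝔽 B (unit k)) ≡ x
    g k eq = trans (dot-dual A a _) (trans (cong (dot 𝔽 a) (AB≡id (unit k))) eq)

  dot-+ᵥ : ∀ a y z → dot 𝔽 a (_+ᵥ_ 𝔽 y z) ≡ dot 𝔽 a y ⊕ dot 𝔽 a z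
  dot-+ᵥ a@(_ ∷ _ ∷ _ ∷ _ ∷ _ ∷ _ ∷ []) y@(_ ∷ _ ∷ _ ∷ _ ∷ _ ∷ _ ∷ []) z@(_ ∷ _ ∷ _ ∷ _ ∷ _ ∷ _ ∷ []) =
    prove (a ++ᵛ y ++ᵛ z) (:dot (:vec 0 6) (λ i → :vec 6 6 i :+ :vec 12 6 i)) (:dot (:vec 0 6) (:vec 6 6) :+ :dot (:vec 0 6) (:vec 12 6)) refl

  dot-*ᵥ : ∀ a k y → dot 𝔽 a (_*ᵥ_ 𝔽 k y) ≡ k ⊗ dot 𝔽 a y
  dot-*ᵥ a@(_ ∷ _ ∷ _ ∷ _ ∷ _ ∷ _ ∷ []) k y@(_ ∷ _ ∷ _ ∷ _ ∷ _ ∷ _ ∷ []) =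
    prove (k ∷ a ++ᵛ y) (:dot (:vec 1 6) (λ i → var 0F :* :vec 7 6 i)) (var 0F :* :dot (:vec 1 6) (:vec 7 6)) refl

  *ᵥ-dot : ∀ k a y → dot 𝔽 (_*ᵥ_ 𝔽 k a) y ≡ k ⊗ dot 𝔽 a y
  *ᵥ-dot k a@(_ ∷ _ ∷ _ ∷ _ ∷ _ ∷ _ ∷ []) y@(_ ∷ _ ∷ _ ∷ _ ∷ _ ∷ _ ∷ []) =
    prove (k ∷ a ++ᵛ y) (:dot (λ i → var 0F :* :vec 1 6 i) (:vec 7 6)) (var 0F :* :dot (:vec 1 6) (:vec 7 6)) refl

  dual-*ᵥ : ∀ A k a → dual A (_*ᵥ_ 𝔽 k a) ≡ _*ᵥ_ 𝔽 k (dual A a)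
  dual-*ᵥ A k a@(_ ∷ _ ∷ _ ∷ _ ∷ _ ∷ _ ∷ []) =  vec6≡ (p 0F refl) (p 1F refl) (p 2F refl) (p 3F refl)
      (p 4F refl) (p 5F refl)
    where
    p = λ i → prove (entries A ++ᵛ k ∷ a) (:dual (:mat 0) (λ j → var (9 ↑ʳ 0F) :* :vec 10 6 j) i) (var (9 ↑ʳ 0F) :* :dual (:mat 0) (:vec 10 6) i)

  :conic : ∀ {n} → (Fin 6 → Polynomial n) → (Fin 3 → Polynomial n) → Polynomial n
  :conic a x = a 0F :* x 0F :* x 0F :+ a 1F :* x 0F :* x 1F :+ a 2F :* x 0F :* x 2F
    :+ a 3F :* x 1F :* x 1F :+ a 4F :* x 1F :* x 2F
    :+ a 5F :* x 2F :* x 2F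

  -- The value of the conic at x is `dot a` of the rank-one matrix xxᵀ, and the action sends xxᵀ to
  -- (Ax)(Ax)ᵀ.
  conic-dual : ∀ A a x → conic 𝔽 (dual A a) x ≡ conic 𝔽 a (matVec 𝔽 A x)
  conic-dual A a@(_ ∷ _ ∷ _ ∷ _ ∷ _ ∷ _ ∷ []) x@(_ ∷ _ ∷ _ ∷ []) =
    prove (entries A ++ᵛ a ++ᵛ x) (:conic (:dual (:mat 0) (:vec 9 6)) (:vec 15 3)) (:conic (:vec 9 6) (:matVec (:mat 0) (:vec 15 3))) refl

  conic-*ᵥ : ∀ k a x → conic 𝔽 (_*ᵥ_ 𝔽 k a) x ≡ k ⊗ conic 𝔽 a x
  conic-*ᵥ k a@(_ ∷ _ ∷ _ ∷ _ ∷ _ ∷ _ ∷ []) x@(_ ∷ _ ∷ _ ∷ []) =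
    prove (k ∷ a ++ᵛ x) (:conic (λ j → var 0F :* :vec 1 6 j) (:vec 7 3)) (var 0F :* :conic (:vec 1 6) (:vec 7 3)) refl

  det-*ᵥ : ∀ k y → det 𝔽 (toMat 𝔽 (_*ᵥ_ 𝔽 k y)) ≡ k ⊗ k ⊗ k ⊗ det 𝔽 (toMat 𝔽 y)
  det-*ᵥ k y@(_ ∷ _ ∷ _ ∷ _ ∷ _ ∷ _ ∷ []) =
    prove (k ∷ y) (:det (:toMat (λ j → var 0F :* :vec 1 6 j))) (var 0F :* var 0F :* var 0F :* :det (:toMat (:vec 1 6))) refl

  -- Counting normalised vectors

  infixr 7 _∙_
  _∙_ : F → Vec F n → Vec F n
  _∙_ = _*ᵥ_ 𝔽

  0ᵥ : Vec F n
  0ᵥ = zeroᵥ 𝔽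

  N : Vec F n → Set
  N = Normalised 𝔽

  ∙-assoc : ∀ j k (v : Vec F n) → j ∙ k ∙ v ≡ (j ⊗ k) ∙ v
  ∙-assoc j k [] = refl
  ∙-assoc j k (x ∷ v) = cong₂ _∷_ (sym (R.*-assoc j k x)) (∙-assoc j k v)

  𝟙∙ : ∀ (v : Vec F n) → 𝟙 ∙ v ≡ v
  𝟙∙ [] = refl
  𝟙∙ (x ∷ v) = cong₂ _∷_ (R.*-identityˡ x) (𝟙∙ v)

  ∙0ᵥ : ∀ k → k ∙ 0ᵥ {n} ≡ 0ᵥ
  ∙0ᵥ {zero} k = refl
  ∙0ᵥ {suc n} k = cong₂ _∷_ (R.zeroʳ k) (∙0ᵥ k)

  𝟘∙ : ∀ (v : Vec F n) → 𝟘 ∙ v ≡ 0ᵥ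
  𝟘∙ [] = refl
  𝟘∙ (x ∷ v) = cong₂ _∷_ (R.zeroˡ x) (𝟘∙ v)

  ⁻¹∙ : ∀ {k} (k≢0 : k ≢ 𝟘) (v : Vec F n) → k ⁻¹[ k≢0 ] ∙ k ∙ v ≡ v
  ⁻¹∙ {k = k} k≢0 v = trans (∙-assoc _ k v) (trans (cong (_∙ v) (trans (R.*-comm _ k) (inverseʳ k≢0))) (𝟙∙ v))

  normalise : (v : Vec F n) → v ≡ 0ᵥ ⊎ ∃ λ k → k ≢ 𝟘 × N (k ∙ v)
  normalise [] = inj₁ refl
  normalise (x ∷ v) with x ≟ 𝟘
  ... | no x≢0 = inj₂ (x ⁻¹[ x≢0 ] , ⁻¹-nonzero x≢0 , inj₁ (trans (R.*-comm _ x) (inverseʳ x≢0)))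
  ... | yes refl with normalise v
  ...   | inj₁ v≡0 = inj₁ (cong (𝟘 ∷_) v≡0)
  ...   | inj₂ (k , k≢0 , nv) = inj₂ (k , k≢0 , inj₂ (R.zeroʳ k , nv))

  N⇒≢0 : ∀ {v : Vec F n} → N v → v ≢ 0ᵥ
  N⇒≢0 {v = _ ∷ _} (inj₁ refl) eq = 𝟘≢𝟙 (sym (proj₁ (∷-injective eq)))
  N⇒≢0 {v = _ ∷ _} (inj₂ (_ , nv)) eq = N⇒≢0 nv (proj₂ (∷-injective eq))

  N-scalar : ∀ {k} {v : Vec F n} → N v → N (k ∙ v) → k ≡ 𝟙
  N-scalar {k = k} {_ ∷ _} (inj₁ refl) (inj₁ e) = trans (sym (R.*-identityʳ k)) e
  N-scalar {k = k} {_ ∷ _} (inj₁ refl) (inj₂ (e , nkv)) = contradiction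
    (trans (cong (_∙ _) (trans (sym (R.*-identityʳ k)) e)) (𝟘∙ _)) (N⇒≢0 nkv)
  N-scalar {k = k} {_ ∷ _} (inj₂ (refl , _)) (inj₁ e) = contradiction (trans (sym (R.zeroʳ k)) e) 𝟘≢𝟙
  N-scalar {v = _ ∷ _} (inj₂ (_ , nv)) (inj₂ (_ , nkv)) = N-scalar nv nkv

  N-multiple : ∀ {k} {v w : Vec F n} → N v → N w → w ≡ k ∙ v → w ≡ v
  N-multiple {v = v} nv nw refl = trans (cong (_∙ v) (N-scalar nv nw)) (𝟙∙ v)

  -- The number of points of PG(2,q) other than a given one.
  order² : ℕ
  order² = order 𝔽 * order 𝔽 + order 𝔽

  affine infinite points : List (Vec F 3)
  affine = List.map (λ (x , y) → 𝟙 ∷ x ∷ y ∷ []) (cartesianProduct elements elements)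
  infinite = List.map (λ y → 𝟘 ∷ 𝟙 ∷ y ∷ []) elements
  points = affine ++ infinite ++ (𝟘 ∷ 𝟘 ∷ 𝟙 ∷ []) ∷ []

  points-length : length points ≡ suc order²
  points-length = trans (length-++ affine)
    (trans (cong₂ _+_ (trans (length-map _ (cartesianProduct elements elements)) (length-cartesianProduct elements elements))
      (trans (length-++ infinite) (trans (cong (_+ 1) (length-map _ elements)) (+-comm _ 1))))
    (+-suc _ _))

  points-unique : Unique points
  points-unique = ++⁺ (map⁺ (λ { refl → refl }) (cartesianProduct⁺ distinct distinct))
      (++⁺ (map⁺ (λ { refl → refl }) distinct) ([] ∷ []) λ { (v∈ , here refl) → last∉infinite v∈ }) λ (v∈ , w∈) → disjoint v∈ w∈
    where
    last∉infinite : ¬ ((𝟘 ∷ 𝟘 ∷ 𝟙 ∷ []) ∈ infinite)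
    last∉infinite v∈ with _ , _ , eq ← ∈-map⁻ _ v∈ = 𝟘≢𝟙 (proj₁ (∷-injective (proj₂ (∷-injective eq))))
    disjoint : ∀ {v} → v ∈ affine → ¬ (v ∈ infinite ++ (𝟘 ∷ 𝟘 ∷ 𝟙 ∷ []) ∷ [])
    disjoint v∈ w∈ with _ , _ , refl ← ∈-map⁻ _ v∈ | ∈-++⁻ infinite w∈
    ... | inj₁ w∈ with _ , _ , eq ← ∈-map⁻ _ w∈ = 𝟘≢𝟙 (sym (proj₁ (∷-injective eq)))
    ... | inj₂ (here eq) = 𝟘≢𝟙 (sym (proj₁ (∷-injective eq)))

  ∈-points : ∀ v → v ∈ points ⇔ N v
  ∈-points v = mk⇔ (λ v∈ → sound (∈-++⁻ affine v∈)) (compl v)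
    where
    sound : v ∈ affine ⊎ v ∈ infinite ++ (𝟘 ∷ 𝟘 ∷ 𝟙 ∷ []) ∷ [] → N v
    sound (inj₁ v∈) with _ , _ , refl ← ∈-map⁻ _ v∈ = inj₁ refl
    sound (inj₂ v∈) with ∈-++⁻ infinite v∈
    ... | inj₁ v∈ with _ , _ , refl ← ∈-map⁻ _ v∈ = inj₂ (refl , inj₁ refl)
    ... | inj₂ (here refl) = inj₂ (refl , inj₂ (refl , inj₁ refl))
    compl : ∀ v → N v → v ∈ points
    compl (_ ∷ x ∷ y ∷ []) (inj₁ refl) = ∈-++⁺ˡ (∈-map⁺ _ (∈-cartesianProduct⁺ (complete x) (complete y)))
    compl (_ ∷ _ ∷ y ∷ []) (inj₂ (refl , inj₁ refl)) = ∈-++⁺ʳ affine (∈-++⁺ˡ (∈-map⁺ _ (complete y)))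
    compl (_ ∷ _ ∷ _ ∷ []) (inj₂ (refl , inj₂ (refl , inj₁ refl))) = ∈-++⁺ʳ affine (∈-++⁺ʳ infinite (here refl))

  HasCount-none : ∀ {P : Vec F n → Set} → (∀ v → N v → ¬ P v) → HasCount 𝔽 P 0
  HasCount-none none = [] , [] , (λ v → mk⇔ (λ ()) (λ (nv , p) → contradiction p (none v nv))) , refl

  HasCount-one : ∀ {P : Vec F n → Set} {v₀} → N v₀ → P v₀ → (∀ v → N v → P v → v ≡ v₀) → HasCount 𝔽 P 1
  HasCount-one nv₀ p uniq = _ ∷ [] , [] ∷ [] ,
    (λ v → mk⇔ (λ { (here refl) → nv₀ , p }) (λ (nv , p) → here (uniq v nv p))) , refl

  HasCount-cong : ∀ {P Q : Vec F n → Set} {k} → (∀ v → N v → P v ⇔ Q v) → HasCount 𝔽 P k → HasCount 𝔽 Q k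
  HasCount-cong P⇔Q (l , u , mem , len) = l , u , (λ v → mk⇔
    (λ v∈ → let nv , p = to (mem v) v∈ in nv , to (P⇔Q v nv) p)
    (λ (nv , q) → from (mem v) (nv , from (P⇔Q v nv) q))) , len

  HasCount-others : ∀ {v₀} → N v₀ → HasCount 𝔽 {3} (_≢ v₀) order²
  HasCount-others {v₀} nv₀ with l , p ← ∈⇒↭∷ (from (∈-points v₀) nv₀) = l , unique-tail u , mem ,
      suc-injective (trans (sym (↭-length p)) points-length)
    where
    u : Unique (v₀ ∷ l)
    u = Unique-resp-↭ p points-unique
    unique-tail : Unique (v₀ ∷ l) → Unique l
    unique-tail (_ ∷ ul) = ul
    mem : ∀ v → v ∈ l ⇔ (N v × v ≢ v₀)
    mem v = mk⇔ (λ v∈ → to (∈-points v) (∈-resp-↭ (↭-sym p) (there v∈)) , λ { refl → Unique[x∷xs]⇒x∉xs u v∈ })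
                (λ (nv , v≢) → ∈-tail (∈-resp-↭ p (from (∈-points v) nv)) v≢)

  HasCount-0 : ∀ {P : Vec F n → Set} → HasCount 𝔽 P 0 → ∀ {v} → N v → ¬ P v
  HasCount-0 ([] , _ , mem , _) {v} nv p with () ← from (mem v) (nv , p)

  HasCount-1 : ∀ {P : Vec F n → Set} → HasCount 𝔽 P 1 → ∃ λ v₀ → N v₀ × P v₀ × (∀ {v} → N v → P v → v ≡ v₀)
  HasCount-1 {P = P} (v₀ ∷ [] , _ , mem , _) = v₀ , proj₁ h , proj₂ h , λ {v} nv p → only (from (mem v) (nv , p))
    where
    h : N v₀ × P v₀
    h = to (mem v₀) (here refl)
    only : ∀ {v} → v ∈ v₀ ∷ [] → v ≡ v₀
    only (here eq) = eq

  module _ {m n} {L : Vec F m → Vec F n} (homogeneous : ∀ k v → L (k ∙ v) ≡ k ∙ L v)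
    (injective : ∀ {v w} → L v ≡ L w → v ≡ w) {P : Vec F m → Set} {Q : Vec F n → Set}
    (P-∙ : ∀ {k v} → k ≢ 𝟘 → P v → P (k ∙ v)) (Q-∙ : ∀ {k v} → k ≢ 𝟘 → Q v → Q (k ∙ v))
    (P⇒Q : ∀ v → P v → Q (L v)) (Q⇒P : ∀ w → N w → Q w → ∃ λ v → w ≡ L v × P v) where
    private
      L-nonzero : ∀ {v} → v ≢ 0ᵥ → L v ≢ 0ᵥ
      L-nonzero {v} v≢0 e = v≢0 (injective (trans e (trans (sym (𝟘∙ (L 0ᵥ))) (trans (sym (homogeneous 𝟘 0ᵥ)) (cong L (𝟘∙ 0ᵥ))))))

      scalar : Vec F m → F
      scalar v with normalise (L v)
      -- A default value: by `L-nonzero` this case does not arise for normalised `v`.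
      ... | inj₁ _ = 𝟙
      ... | inj₂ (k , _) = k

      scalar-N : ∀ v → N v → scalar v ≢ 𝟘 × N (scalar v ∙ L v)
      scalar-N v nv with normalise (L v)
      ... | inj₁ Lv≡0 = contradiction Lv≡0 (L-nonzero (N⇒≢0 nv))
      ... | inj₂ (_ , k≢0 , nk) = k≢0 , nk

      g : Vec F m → Vec F n
      g v = scalar v ∙ L v

      g-injective : ∀ {v w} → N v → N w → g v ≡ g w → v ≡ w
      g-injective {v} {w} nv nw eq = N-multiple nw nv (trans (sym (⁻¹∙ k≢0 v)) (trans (cong (scalar v ⁻¹[ k≢0 ] ∙_) kv≡) (∙-assoc _ _ w)))
        where
        k≢0 = proj₁ (scalar-N v nv)
        kv≡ : scalar v ∙ v ≡ scalar w ∙ w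
        kv≡ = injective (trans (homogeneous _ v) (trans eq (sym (homogeneous _ w))))

      unique-map : ∀ l → Unique l → (∀ {v} → v ∈ l → N v) → Unique (List.map g l)
      unique-map [] _ _ = []
      unique-map (v ∷ l) u@(_ ∷ ul) all = All.tabulate (λ {w} w∈ gv≡w →
          let w′ , w′∈ , w≡ = ∈-map⁻ g w∈ in
          Unique[x∷xs]⇒x∉xs u (subst (_∈ l) (sym (g-injective (all (here refl)) (all (there w′∈)) (trans gv≡w w≡))) w′∈))
        ∷ unique-map l ul (λ v∈ → all (there v∈))

    -- `L` need not preserve normalisation, so `g` rescales each image. Equal rescaled images come
    -- from proportional vectors, and proportional normalised vectors coincide, so `g` loses no
    -- points.
    HasCount-map : ∀ {k} → HasCount 𝔽 P k → HasCount 𝔽 Q k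
    HasCount-map (l , u , mem , len) = List.map g l , unique-map l u (λ v∈ → proj₁ (to (mem _) v∈)) ,
        (λ w → mk⇔ (sound w) (compl w)) , trans (length-map g l) len
      where
      sound : ∀ w → w ∈ List.map g l → N w × Q w
      sound w w∈ with v , v∈ , refl ← ∈-map⁻ g w∈ =
        let nv , p = to (mem v) v∈ ; k≢0 , nk = scalar-N v nv in nk , Q-∙ k≢0 (P⇒Q v p)
      compl : ∀ w → N w × Q w → w ∈ List.map g l
      compl w (nw , qw) with v , refl , pv ← Q⇒P w nw qw with normalise v
      ... | inj₁ refl = contradiction (trans (trans (cong L (sym (𝟘∙ 0ᵥ))) (homogeneous 𝟘 0ᵥ)) (𝟘∙ _)) (N⇒≢0 nw)
      ... | inj₂ (k , k≢0 , nkv) = subst (_∈ List.map g l) (N-multiple nw (proj₂ (scalar-N (k ∙ v) nkv))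
              (trans (cong (scalar (k ∙ v) ∙_) (homogeneous k v)) (∙-assoc _ k (L v))))
            (∈-map⁺ g (from (mem (k ∙ v)) (nkv , P-∙ k≢0 pv)))

  -- Planes and their singular points

  infix 4 _∈ᵂ_
  infixl 6 _+ᵛ_
  _+ᵛ_ : ∀ {n} → Vec F n → Vec F n → Vec F n
  _+ᵛ_ = _+ᵥ_ 𝔽

  _∈ᵂ_ : V6 𝔽 → Plane 𝔽 → Set
  _∈ᵂ_ = _∈W_ 𝔽

  detᵥ : V6 𝔽 → F
  detᵥ y = det 𝔽 (toMat 𝔽 y)

  +ᵛ-self : ∀ {n} (v : Vec F n) → v +ᵛ v ≡ 0ᵥ
  +ᵛ-self [] = refl
  +ᵛ-self (x ∷ v) = cong₂ _∷_ (x⊕x≡0 x) (+ᵛ-self v)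

  +ᵛ≡0⇒≡ : ∀ {n} (x y : Vec F n) → x +ᵛ y ≡ 0ᵥ → x ≡ y
  +ᵛ≡0⇒≡ [] [] _ = refl
  +ᵛ≡0⇒≡ (x ∷ xs) (y ∷ ys) e = cong₂ _∷_ (x⊕y≡0⇒x≡y (proj₁ (∷-injective e))) (+ᵛ≡0⇒≡ xs ys (proj₂ (∷-injective e)))

  combination-∙ : ∀ {n} k a b c (u v w : Vec F n) →
    (k ⊗ a) ∙ u +ᵛ ((k ⊗ b) ∙ v +ᵛ (k ⊗ c) ∙ w) ≡ k ∙ (a ∙ u +ᵛ (b ∙ v +ᵛ c ∙ w))
  combination-∙ k a b c [] [] [] = refl
  combination-∙ k a b c (x ∷ u) (y ∷ v) (z ∷ w) = cong₂ _∷_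
    (solve 7 (λ k a b c x y z → k :* a :* x :+ (k :* b :* y :+ k :* c :* z) := k :* (a :* x :+ (b :* y :+ c :* z))) refl k a b c x y z)
    (combination-∙ k a b c u v w)

  combination-+ : ∀ {n} a b c a′ b′ c′ (u v w : Vec F n) →
    (a ⊕ a′) ∙ u +ᵛ ((b ⊕ b′) ∙ v +ᵛ (c ⊕ c′) ∙ w) ≡ (a ∙ u +ᵛ (b ∙ v +ᵛ c ∙ w)) +ᵛ (a′ ∙ u +ᵛ (b′ ∙ v +ᵛ c′ ∙ w))
  combination-+ a b c a′ b′ c′ [] [] [] = refl
  combination-+ a b c a′ b′ c′ (x ∷ u) (y ∷ v) (z ∷ w) = cong₂ _∷_
    (solve 9 (λ a b c a′ b′ c′ x y z → (a :+ a′) :* x :+ ((b :+ b′) :* y :+ (c :+ c′) :* z) :=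
      (a :* x :+ (b :* y :+ c :* z)) :+ (a′ :* x :+ (b′ :* y :+ c′ :* z))) refl a b c a′ b′ c′ x y z)
    (combination-+ a b c a′ b′ c′ u v w)

  module _ (W : Plane 𝔽) where
    open Plane W

    pt-∙ : ∀ k x → pt 𝔽 W (k ∙ x) ≡ k ∙ pt 𝔽 W x
    pt-∙ k (a ∷ b ∷ c ∷ []) = combination-∙ k a b c b₀ b₁ b₂

    pt-+ : ∀ x y → pt 𝔽 W (x +ᵛ y) ≡ pt 𝔽 W x +ᵛ pt 𝔽 W y
    pt-+ (a ∷ b ∷ c ∷ []) (a′ ∷ b′ ∷ c′ ∷ []) = combination-+ a b c a′ b′ c′ b₀ b₁ b₂

    pt≡0⇒≡0 : ∀ x → pt 𝔽 W x ≡ 0ᵥ → x ≡ 0ᵥ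
    pt≡0⇒≡0 (a ∷ b ∷ c ∷ []) e = let a≡0 , b≡0 , c≡0 = independent a b c e in vec3≡ a≡0 b≡0 c≡0

    pt-injective : ∀ {x y} → pt 𝔽 W x ≡ pt 𝔽 W y → x ≡ y
    pt-injective {x} {y} e = +ᵛ≡0⇒≡ x y (pt≡0⇒≡0 (x +ᵛ y) (trans (pt-+ x y) (trans (cong (_+ᵛ pt 𝔽 W y) e) (+ᵛ-self _))))

    ∈W-∙ : ∀ k {y} → y ∈ᵂ W → k ∙ y ∈ᵂ W
    ∈W-∙ k (x , refl) = k ∙ x , sym (pt-∙ k x)

    ∈W-+ : ∀ {y z} → y ∈ᵂ W → z ∈ᵂ W → y +ᵛ z ∈ᵂ W
    ∈W-+ (x , refl) (x′ , refl) = x +ᵛ x′ , sym (pt-+ x x′)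

  nonzero?-true : ∀ {x} → x ≢ 𝟘 → nonzero? 𝔽 x ≡ true
  nonzero?-true {x} x≢0 with x ≟ 𝟘
  ... | yes x≡0 = contradiction x≡0 x≢0
  ... | no _ = refl

  any-true : ∀ {A : Set} (p : A → Bool) {x xs} → x ∈ xs → p x ≡ true → any p xs ≡ true
  any-true p (here refl) e rewrite e = refl
  any-true p {xs = y ∷ _} (there x∈) e rewrite any-true p x∈ e = ∨-zeroʳ (p y)

  principalMinor≢0 : ∀ M i j → (i , j) ∈ pairs 𝔽 → (_⊝_ 𝔽 (M i i ⊗ M j j) (M i j ⊗ M j i)) ≢ 𝟘 → someMinor2≠0 𝔽 M ≡ true
  principalMinor≢0 M i j ij∈ e = any-true (λ r → any (minor r) (pairs 𝔽)) ij∈ (any-true (minor (i , j)) ij∈ (nonzero?-true e))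
    where
    minor : Fin 3 × Fin 3 → Fin 3 × Fin 3 → Bool
    minor (r₁ , r₂) (c₁ , c₂) = nonzero? 𝔽 (_⊝_ 𝔽 (M r₁ c₁ ⊗ M r₂ c₂) (M r₁ c₂ ⊗ M r₂ c₁))

  nonzero?-false : ∀ {x} → x ≡ 𝟘 → nonzero? 𝔽 x ≡ false
  nonzero?-false {x} x≡0 with x ≟ 𝟘
  ... | yes _ = refl
  ... | no x≢0 = contradiction x≡0 x≢0

  det≢0⇒rank≡3 : ∀ M → det 𝔽 M ≢ 𝟘 → rank 𝔽 M ≡ 3
  det≢0⇒rank≡3 M d rewrite nonzero?-true d = refl

  rank≢3 : ∀ M → det 𝔽 M ≡ 𝟘 → rank 𝔽 M ≢ 3
  rank≢3 M d e rewrite nonzero?-false d with someMinor2≠0 𝔽 M | someEntry≠0 𝔽 M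
  rank≢3 M d () | true | _
  rank≢3 M d () | false | true
  rank≢3 M d () | false | false

  det≡0⇒rank≡2 : ∀ M → det 𝔽 M ≡ 𝟘 → someMinor2≠0 𝔽 M ≡ true → rank 𝔽 M ≡ 2
  det≡0⇒rank≡2 M d e rewrite nonzero?-false d | e = refl

  rank<3⇒det≡0 : ∀ M → rank 𝔽 M ≢ 3 → det 𝔽 M ≡ 𝟘
  rank<3⇒det≡0 M r = decidable-stable (det 𝔽 M ≟ 𝟘) λ d → r (det≢0⇒rank≡3 M d)

  det≡0⇒rank : ∀ M → det 𝔽 M ≡ 𝟘 → someEntry≠0 𝔽 M ≡ true → rank 𝔽 M ≡ 1 ⊎ rank 𝔽 M ≡ 2
  det≡0⇒rank M d e rewrite nonzero?-false d | e with someMinor2≠0 𝔽 M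
  ... | true = inj₂ refl
  ... | false = inj₁ refl

  someEntry : ∀ y → y ≢ 0ᵥ → someEntry≠0 𝔽 (toMat 𝔽 y) ≡ true
  someEntry y@(y₀ ∷ y₁ ∷ y₂ ∷ y₃ ∷ y₄ ∷ y₅ ∷ []) y≢0 with y₀ ≟ 𝟘 | y₁ ≟ 𝟘 | y₂ ≟ 𝟘 | y₃ ≟ 𝟘 | y₄ ≟ 𝟘 | y₅ ≟ 𝟘
  ... | no _ | _ | _ | _ | _ | _ = refl
  ... | yes _ | no _ | _ | _ | _ | _ = refl
  ... | yes _ | yes _ | no _ | _ | _ | _ = refl
  ... | yes _ | yes _ | yes _ | no _ | _ | _ = refl
  ... | yes _ | yes _ | yes _ | yes _ | no _ | _ = refl
  ... | yes _ | yes _ | yes _ | yes _ | yes _ | no _ = refl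
  ... | yes refl | yes refl | yes refl | yes refl | yes refl | yes refl = contradiction refl y≢0

  -- With a zero diagonal, a principal 2×2 minor is, up to sign, the square of the off-diagonal
  -- entry in it.
  nucleus-minor : ∀ y → InNucleus 𝔽 y → y ≢ 0ᵥ → someMinor2≠0 𝔽 (toMat 𝔽 y) ≡ true
  nucleus-minor y@(_ ∷ y₁ ∷ y₂ ∷ _ ∷ y₄ ∷ _ ∷ []) (refl , refl , refl) y≢0 = go (y₁ ≟ 𝟘) (y₂ ≟ 𝟘) (y₄ ≟ 𝟘)
    where
    minor : ∀ {x} → x ≢ 𝟘 → _⊝_ 𝔽 (𝟘 ⊗ 𝟘) (x ⊗ x) ≢ 𝟘
    minor {x} x≢0 e = x≢0 (x⊗x≡0⇒x≡0 (trans (solve 1 (λ x → x :* x := :0 :* :0 :+ (:- (x :* x))) refl x) e))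
    go : Dec (y₁ ≡ 𝟘) → Dec (y₂ ≡ 𝟘) → Dec (y₄ ≡ 𝟘) → someMinor2≠0 𝔽 (toMat 𝔽 y) ≡ true
    go (no y₁≢0) _ _ = principalMinor≢0 (toMat 𝔽 y) 0F 1F (here refl) (minor y₁≢0)
    go _ (no y₂≢0) _ = principalMinor≢0 (toMat 𝔽 y) 0F 2F (there (here refl)) (minor y₂≢0)
    go _ _ (no y₄≢0) = principalMinor≢0 (toMat 𝔽 y) 1F 2F (there (there (here refl))) (minor y₄≢0)
    go (yes refl) (yes refl) (yes refl) = contradiction refl y≢0

  -- Only the two terms y₁y₂y₄ of the determinant survive, and they cancel modulo 2.
  nucleus-det : ∀ y → InNucleus 𝔽 y → detᵥ y ≡ 𝟘
  nucleus-det (_ ∷ y₁ ∷ y₂ ∷ _ ∷ y₄ ∷ _ ∷ []) (refl , refl , refl) =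
    solve 3 (λ y₁ y₂ y₄ → :det (:toMat (lookup (:0 ∷ y₁ ∷ y₂ ∷ :0 ∷ y₄ ∷ :0 ∷ []))) := :0) refl y₁ y₂ y₄

  InNucleus? : ∀ y → Dec (InNucleus 𝔽 y)
  InNucleus? y = (_ ≟ 𝟘) ×-dec ((_ ≟ 𝟘) ×-dec (_ ≟ 𝟘))

  InNucleus-∙ : ∀ k {y} → InNucleus 𝔽 y → InNucleus 𝔽 (k ∙ y)
  InNucleus-∙ k {_ ∷ _ ∷ _ ∷ _ ∷ _ ∷ _ ∷ []} (refl , refl , refl) = R.zeroʳ k , R.zeroʳ k , R.zeroʳ k

  -- The point-orbit distribution [0, 1, 0, q² + q], rephrased without normalised representatives
  -- so that its invariance under K is apparent.
  Good : Plane 𝔽 → Set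
  Good W = ∃ λ y₀ → y₀ ∈ᵂ W × y₀ ≢ 0ᵥ × InNucleus 𝔽 y₀ × (∀ y → y ∈ᵂ W → detᵥ y ≡ 𝟘 → ∃ λ k → y ≡ k ∙ y₀)

  PointDist₁₈ : Plane 𝔽 → Set
  PointDist₁₈ W = PointDist 𝔽 W 0 1 0 order²

  -- A nonzero singular matrix has rank 1 or 2, and the counts leave only the single nucleus point
  -- for it. Rescaling extends this from normalised representatives to all vectors of the plane.
  PointDist⇒Good : ∀ W → PointDist₁₈ W → Good W
  PointDist⇒Good W (r₁ , r₂ₙ , r₂ₛ , _) with c₀ , nc₀ , (_ , nuc) , uniq ← HasCount-1 r₂ₙ =
    pt 𝔽 W c₀ , (c₀ , refl) , (λ e → N⇒≢0 nc₀ (pt≡0⇒≡0 W c₀ e)) , nuc , λ { y (c , refl) d → multiple c d (normalise c) }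
    where
    singular : ∀ c → N c → detᵥ (pt 𝔽 W c) ≡ 𝟘 → c ≡ c₀
    singular c nc d with det≡0⇒rank (toMat 𝔽 (pt 𝔽 W c)) d (someEntry _ λ e → N⇒≢0 nc (pt≡0⇒≡0 W c e))
    ... | inj₁ r≡1 = contradiction r≡1 (HasCount-0 r₁ nc)
    ... | inj₂ r≡2 with InNucleus? (pt 𝔽 W c)
    ...   | yes nuc = uniq nc (r≡2 , nuc)
    ...   | no ¬nuc = contradiction (r≡2 , ¬nuc) (HasCount-0 r₂ₛ nc)
    multiple : ∀ c → detᵥ (pt 𝔽 W c) ≡ 𝟘 → c ≡ 0ᵥ ⊎ (∃ λ k → k ≢ 𝟘 × N (k ∙ c)) → ∃ λ k → pt 𝔽 W c ≡ k ∙ pt 𝔽 W c₀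
    multiple c d (inj₁ refl) = 𝟘 , trans (cong (pt 𝔽 W) (sym (∙0ᵥ 𝟘))) (trans (pt-∙ W 𝟘 0ᵥ) (trans (𝟘∙ _) (sym (𝟘∙ _))))
    multiple c d (inj₂ (k , k≢0 , nkc)) = k ⁻¹[ k≢0 ] , trans (cong (pt 𝔽 W) (trans (sym (⁻¹∙ k≢0 c)) (cong (k ⁻¹[ k≢0 ] ∙_) kc≡c₀))) (pt-∙ W _ c₀)
      where
      kc≡c₀ : k ∙ c ≡ c₀
      kc≡c₀ = singular (k ∙ c) nkc (trans (cong detᵥ (pt-∙ W k c)) (trans (det-*ᵥ k (pt 𝔽 W c)) (x⊗0 d)))

  Good⇒PointDist : ∀ W → Good W → PointDist₁₈ W
  Good⇒PointDist W (_ , (c , refl) , y₀≢0 , nuc , uniq) = go (normalise c)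
    where
    go : c ≡ 0ᵥ ⊎ (∃ λ k → k ≢ 𝟘 × N (k ∙ c)) → PointDist₁₈ W
    go (inj₁ refl) = contradiction (trans (cong (pt 𝔽 W) (sym (∙0ᵥ 𝟘))) (trans (pt-∙ W 𝟘 0ᵥ) (𝟘∙ _))) y₀≢0
    go (inj₂ (k , k≢0 , nc₀)) =
        HasCount-none (λ v nv r≡1 → contradiction
          (trans (sym r≡1) (trans (cong (λ v → rank 𝔽 (M v))
            (singular v nv (rank<3⇒det≡0 (M v) λ r≡3 → 1≢3 (trans (sym r≡1) r≡3)))) rank₀)) λ ())
      , HasCount-one nc₀ (rank₀ , nuc₀) (λ v nv (r≡2 , _) → rank2⇒ v nv r≡2)
      , HasCount-none (λ v nv (r≡2 , ¬nuc) → ¬nuc (subst (λ v → InNucleus 𝔽 (pt 𝔽 W v)) (sym (rank2⇒ v nv r≡2)) nuc₀))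
      -- The points of rank 3 are all the points of the plane except `c₀`.
      , HasCount-cong (λ v nv → mk⇔ (λ v≢c₀ → det≢0⇒rank≡3 (M v) λ d → v≢c₀ (singular v nv d))
                                    (λ { r≡3 refl → rank≢3 (M c₀) (nucleus-det (pt 𝔽 W c₀) nuc₀) r≡3 })) (HasCount-others nc₀)
      where
      M : Vec F 3 → Mat 𝔽
      M v = toMat 𝔽 (pt 𝔽 W v)
      1≢3 : ¬ (1 ≡ 3)
      1≢3 ()
      2≢3 : ¬ (2 ≡ 3)
      2≢3 ()
      c₀ = k ∙ c
      nuc₀ : InNucleus 𝔽 (pt 𝔽 W c₀)
      nuc₀ = subst (InNucleus 𝔽) (sym (pt-∙ W k c)) (InNucleus-∙ k {pt 𝔽 W c} nuc)
      rank₀ : rank 𝔽 (M c₀) ≡ 2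
      rank₀ = det≡0⇒rank≡2 (M c₀) (nucleus-det (pt 𝔽 W c₀) nuc₀) (nucleus-minor (pt 𝔽 W c₀) nuc₀ λ e → N⇒≢0 nc₀ (pt≡0⇒≡0 W c₀ e))
      singular : ∀ v → N v → detᵥ (pt 𝔽 W v) ≡ 𝟘 → v ≡ c₀
      singular v nv d with j , v≡ ← uniq (pt 𝔽 W v) (v , refl) d = N-multiple nc₀ nv
        (trans (pt-injective W (trans v≡ (sym (pt-∙ W j c)))) (trans (cong (j ∙_) (sym (⁻¹∙ k≢0 c))) (∙-assoc j _ c₀)))
      rank2⇒ : ∀ v → N v → rank 𝔽 (M v) ≡ 2 → v ≡ c₀
      rank2⇒ v nv r≡2 = singular v nv (rank<3⇒det≡0 (M v) λ r≡3 → 2≢3 (trans (sym r≡2) r≡3))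

  -- Equivalence of planes under the group

  triples : List (Vec F 3)
  triples = List.map (λ (x , y , z) → x ∷ y ∷ z ∷ []) (cartesianProduct elements (cartesianProduct elements elements))

  triples-complete : ∀ v → v ∈ triples
  triples-complete (x ∷ y ∷ z ∷ []) = ∈-map⁺ _ (∈-cartesianProduct⁺ (complete x) (∈-cartesianProduct⁺ (complete y) (complete z)))

  triples-unique : Unique triples
  triples-unique = map⁺ (λ { refl → refl }) (cartesianProduct⁺ distinct (cartesianProduct⁺ distinct distinct))

  injective⇒surjective₃ : {f : Vec F 3 → Vec F 3} → (∀ {x y} → f x ≡ f y → x ≡ y) → ∀ y → ∃ λ x → f x ≡ y
  injective⇒surjective₃ = injective⇒surjective triples-complete triples-unique (≡-decᵛ _≟_)

  -- The action of an invertible matrix is injective, and both planes are parametrised by F³. An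
  -- inclusion of the image therefore induces an injective map F³ → F³, which is onto by finiteness.
  KEquiv-into : ∀ W W′ A → det 𝔽 A ≢ 𝟘 → (∀ y → y ∈ᵂ W → act 𝔽 A y ∈ᵂ W′) → KEquiv 𝔽 W W′
  KEquiv-into W W′ A d into = A , d , into , λ { y′ (x′ , refl) → onto x′ }
    where
    g : Vec F 3 → Vec F 3
    g x = proj₁ (into (pt 𝔽 W x) (x , refl))
    act≡g : ∀ x → act 𝔽 A (pt 𝔽 W x) ≡ pt 𝔽 W′ (g x)
    act≡g x = proj₂ (into (pt 𝔽 W x) (x , refl))
    g-injective : ∀ {x y} → g x ≡ g y → x ≡ y
    g-injective {x} {y} e = pt-injective W (act-injective A d (trans (act≡g x) (trans (cong (pt 𝔽 W′) e) (sym (act≡g y)))))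
    onto : ∀ x′ → ∃ λ y → y ∈ᵂ W × act 𝔽 A y ≡ pt 𝔽 W′ x′
    onto x′ = let x , gx≡x′ = injective⇒surjective₃ g-injective x′ in
      pt 𝔽 W x , (x , refl) , trans (act≡g x) (cong (pt 𝔽 W′) gx≡x′)

  KEquiv-sym : ∀ {W W′} → KEquiv 𝔽 W W′ → KEquiv 𝔽 W′ W
  KEquiv-sym {W} {W′} (A , d , into , onto) = KEquiv-into W′ W (inv A d) (det-inv A d) λ y′ y′∈ →
    let y , y∈ , Ay≡y′ = onto y′ y′∈ in subst (_∈ᵂ W) (trans (sym (act-invˡ A d y)) (cong (act 𝔽 (inv A d)) Ay≡y′)) y∈

  KEquiv-trans : ∀ {W W′ W″} → KEquiv 𝔽 W W′ → KEquiv 𝔽 W′ W″ → KEquiv 𝔽 W W″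
  KEquiv-trans {W} {W′} {W″} (A , d , into , _) (A′ , d′ , into′ , _) =
    KEquiv-into W W″ (_·_ 𝔽 A′ A) (det-·-nonzero {A′} {A} d′ d) λ y y∈ → subst (_∈ᵂ W″) (act-· A′ A y) (into′ _ (into y y∈))

  -- By `det-act` singular vectors correspond to singular vectors, and the nucleus plane is
  -- invariant.
  Good-KEquiv : ∀ {W W′} → KEquiv 𝔽 W W′ → Good W → Good W′
  Good-KEquiv {W} {W′} (A , d , into , onto) (y₀ , y₀∈ , y₀≢0 , nuc , uniq) =
    act 𝔽 A y₀ , into y₀ y₀∈ , (λ e → y₀≢0 (act-injective A d (trans e (sym act-0)))) , InNucleus-act A {y₀} nuc , λ y′ y′∈ d′ →
      let y , y∈ , Ay≡y′ = onto y′ y′∈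
          k , y≡ = uniq y y∈ (cancelˡ (⊗-nonzero d d) (trans (sym (det-act A y)) (trans (cong detᵥ Ay≡y′) d′)))
      in k , trans (sym Ay≡y′) (trans (cong (act 𝔽 A) y≡) (act-*ᵥ A k y₀))
    where
    act-0 : act 𝔽 A 0ᵥ ≡ 0ᵥ
    act-0 = trans (cong (act 𝔽 A) (sym (∙0ᵥ 𝟘))) (trans (act-*ᵥ A 𝟘 0ᵥ) (𝟘∙ _))

  matrix : (a b c d e f g h i : F) → Mat 𝔽
  matrix a b c d e f g h i = λ
    { 0F 0F → a ; 0F 1F → b ; 0F 2F → c
    ; 1F 0F → d ; 1F 1F → e ; 1F 2F → f
    ; 2F 0F → g ; 2F 1F → h ; 2F 2F → i }

  :matrix : ∀ {n} (a b c d e f g h i : Polynomial n) → PMat n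
  :matrix a b c d e f g h i = λ
    { 0F 0F → a ; 0F 1F → b ; 0F 2F → c
    ; 1F 0F → d ; 1F 1F → e ; 1F 2F → f
    ; 2F 0F → g ; 2F 1F → h ; 2F 2F → i }

  P : V6 𝔽
  P = 𝟘 ∷ 𝟙 ∷ 𝟘 ∷ 𝟘 ∷ 𝟘 ∷ 𝟘 ∷ []

  :P : ∀ {n} → Fin 6 → Polynomial n
  :P = lookup (:0 ∷ :1 ∷ :0 ∷ :0 ∷ :0 ∷ :0 ∷ [])

  ∷⁶-injective : ∀ {a b c d e f a′ b′ c′ d′ e′ f′ : F} →
    _≡_ {A = V6 𝔽} (a ∷ b ∷ c ∷ d ∷ e ∷ f ∷ []) (a′ ∷ b′ ∷ c′ ∷ d′ ∷ e′ ∷ f′ ∷ []) →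
    a ≡ a′ × b ≡ b′ × c ≡ c′ × d ≡ d′ × e ≡ e′ × f ≡ f′
  ∷⁶-injective refl = refl , refl , refl , refl , refl , refl

  P-multiple : ∀ u → (𝟘 ∷ u ∷ 𝟘 ∷ 𝟘 ∷ 𝟘 ∷ 𝟘 ∷ []) ≡ u ∙ P
  P-multiple u = vec6≡ z (sym (R.*-identityʳ u)) z z z z
    where
    z : 𝟘 ≡ u ⊗ 𝟘
    z = sym (R.zeroʳ u)

  -- If a and b are the first two columns of A, then APAᵀ = abᵀ + baᵀ, so y₁, y₂, y₄ are the 2×2
  -- minors of these columns. Each case picks two columns with the prescribed minors and a unit
  -- vector that completes them to a basis.
  nucleus-transitive : ∀ y → InNucleus 𝔽 y → y ≢ 0ᵥ → ∃ λ A → det 𝔽 A ≢ 𝟘 × act 𝔽 A P ≡ y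
  nucleus-transitive (_ ∷ y₁ ∷ y₂ ∷ _ ∷ y₄ ∷ _ ∷ []) (refl , refl , refl) y≢0 = go (y₁ ≟ 𝟘) (y₂ ≟ 𝟘) (y₄ ≟ 𝟘)
    where
    y₄-quotient : ∀ {x} (x≢0 : x ≢ 𝟘) → y₄ ⊗ x ⁻¹[ x≢0 ] ⊗ x ≡ y₄
    y₄-quotient {x} x≢0 = trans (solve 3 (λ y x i → y :* i :* x := y :* (x :* i)) refl y₄ x (x ⁻¹[ x≢0 ]))
      (trans (cong (y₄ ⊗_) (inverseʳ x≢0)) (R.*-identityʳ y₄))
    go : Dec (y₁ ≡ 𝟘) → Dec (y₂ ≡ 𝟘) → Dec (y₄ ≡ 𝟘) → ∃ λ A → det 𝔽 A ≢ 𝟘 × act 𝔽 A P ≡ (𝟘 ∷ y₁ ∷ y₂ ∷ 𝟘 ∷ y₄ ∷ 𝟘 ∷ [])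
    go (no y₁≢0) _ _ = A , (λ e → y₁≢0 (trans (sym det-A) e)) ,
        vec6≡ (p 0F :0 refl) (p 1F (var 0F) refl) (p 2F (var 1F) refl) (p 3F :0 refl)
          (trans (p 4F (var 2F :* var 0F) refl) (y₄-quotient y₁≢0)) (p 5F :0 refl)
      where
      α = y₄ ⊗ y₁ ⁻¹[ y₁≢0 ]
      A = matrix 𝟙 𝟘 𝟘 𝟘 y₁ 𝟘 α y₂ 𝟙
      :A : PMat 3
      :A = :matrix :1 :0 :0 :0 (var 0F) :0 (var 2F) (var 1F) :1
      det-A : det 𝔽 A ≡ y₁
      det-A = prove (y₁ ∷ y₂ ∷ α ∷ []) (:det :A) (var 0F) refl
      p = λ k z → prove (y₁ ∷ y₂ ∷ α ∷ []) (:act :A :P k) z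
    go (yes refl) (no y₂≢0) _ = A , (λ e → y₂≢0 (trans (sym det-A) e)) ,
        vec6≡ (p 0F :0 refl) (p 1F :0 refl) (p 2F (var 0F) refl) (p 3F :0 refl)
          (trans (p 4F (var 1F :* var 0F) refl) (y₄-quotient y₂≢0)) (p 5F :0 refl)
      where
      α = y₄ ⊗ y₂ ⁻¹[ y₂≢0 ]
      A = matrix 𝟙 𝟘 𝟘 α 𝟘 𝟙 𝟘 y₂ 𝟘
      :A : PMat 2
      :A = :matrix :1 :0 :0 (var 1F) :0 :1 :0 (var 0F) :0
      det-A : det 𝔽 A ≡ y₂
      det-A = prove (y₂ ∷ α ∷ []) (:det :A) (var 0F) refl
      p = λ k z → prove (y₂ ∷ α ∷ []) (:act :A :P k) z
    go (yes refl) (yes refl) (no y₄≢0) = A , (λ e → y₄≢0 (trans (sym det-A) e)) ,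
        vec6≡ (p 0F :0 refl) (p 1F :0 refl) (p 2F :0 refl) (p 3F :0 refl) (p 4F (var 0F) refl) (p 5F :0 refl)
      where
      A = matrix 𝟘 𝟘 𝟙 𝟙 𝟘 𝟘 𝟘 y₄ 𝟘
      :A : PMat 1
      :A = :matrix :0 :0 :1 :1 :0 :0 :0 (var 0F) :0
      det-A : det 𝔽 A ≡ y₄
      det-A = prove (y₄ ∷ []) (:det :A) (var 0F) refl
      p = λ k z → prove (y₄ ∷ []) (:act :A :P k) z
    go (yes refl) (yes refl) (yes refl) = contradiction refl y≢0

  module _ (A : Mat 𝔽) (d : det 𝔽 A ≢ 𝟘) (W : Plane 𝔽) where
    open Plane W
    private
      act-combination : ∀ a b c → a ∙ act 𝔽 A b₀ +ᵛ (b ∙ act 𝔽 A b₁ +ᵛ c ∙ act 𝔽 A b₂) ≡ act 𝔽 A (a ∙ b₀ +ᵛ (b ∙ b₁ +ᵛ c ∙ b₂))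
      act-combination a b c = sym (trans (act-+ᵥ A (a ∙ b₀) _) (cong₂ _+ᵛ_ (act-*ᵥ A a b₀)
        (trans (act-+ᵥ A (b ∙ b₁) (c ∙ b₂)) (cong₂ _+ᵛ_ (act-*ᵥ A b b₁) (act-*ᵥ A c b₂)))))
      act-0 : act 𝔽 A 0ᵥ ≡ 0ᵥ
      act-0 = trans (cong (act 𝔽 A) (sym (∙0ᵥ 𝟘))) (trans (act-*ᵥ A 𝟘 0ᵥ) (𝟘∙ (act 𝔽 A 0ᵥ)))

    image : Plane 𝔽
    image = record
      { b₀ = act 𝔽 A b₀ ; b₁ = act 𝔽 A b₁ ; b₂ = act 𝔽 A b₂
      ; independent = λ a b c e → independent a b c (act-injective A d (trans (sym (act-combination a b c)) (trans e (sym act-0)))) }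

    KEquiv-image : KEquiv 𝔽 W image
    KEquiv-image = KEquiv-into W image A d λ { y (a ∷ b ∷ c ∷ [] , y≡) → a ∷ b ∷ c ∷ [] , trans (cong (act 𝔽 A) y≡) (sym (act-combination a b c)) }

  -- Orbits of quadratic forms

  ∷³-injective : ∀ {a b c a′ b′ c′ : F} → _≡_ {A = Vec F 3} (a ∷ b ∷ c ∷ []) (a′ ∷ b′ ∷ c′ ∷ []) → a ≡ a′ × b ≡ b′ × c ≡ c′
  ∷³-injective refl = refl , refl , refl

  e¹ e² e³ : Vec F 3
  e¹ = 𝟙 ∷ 𝟘 ∷ 𝟘 ∷ []
  e² = 𝟘 ∷ 𝟙 ∷ 𝟘 ∷ []
  e³ = 𝟘 ∷ 𝟘 ∷ 𝟙 ∷ []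

  -- Two invariants that separate the orbits. `Singular` says that the conic is a cone with vertex
  -- x, which distinguishes the three degenerate orbits from `H₃`. `Additive` says that the polar
  -- form vanishes, which in characteristic 2 distinguishes the double lines among them.
  Singular Additive : QForm 𝔽 → Set
  Singular Q = ∃ λ x → x ≢ 0ᵥ × Q x ≡ 𝟘 × (∀ y → Q (x +ᵛ y) ≡ Q y)
  Additive Q = ∀ x y → Q (x +ᵛ y) ≡ Q x ⊕ Q y

  module _ {rep Q : QForm 𝔽} where
    Singular-orbit : InOrbitOf 𝔽 rep Q → Singular rep → Singular Q
    Singular-orbit (B , d , μ , _ , Q≡) (x , x≢0 , x0 , inv-x) = B⁻¹x
        , (λ e → x≢0 (trans (sym BB⁻¹x) (trans (cong (matVec 𝔽 B) e) (matVec-0 B))))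
        , trans (Q≡ B⁻¹x) (x⊗0 (trans (cong rep BB⁻¹x) x0))
        , λ y → trans (Q≡ _) (trans (cong (μ ⊗_) (trans (cong rep (trans (matVec-⊕ B B⁻¹x y) (cong (_+ᵛ matVec 𝔽 B y) BB⁻¹x))) (inv-x (matVec 𝔽 B y)))) (sym (Q≡ y)))
      where
      B⁻¹x = matVec 𝔽 (inv B d) x
      BB⁻¹x : matVec 𝔽 B B⁻¹x ≡ x
      BB⁻¹x = matVec-invʳ B d x

    Additive-orbit : InOrbitOf 𝔽 rep Q → Additive rep → Additive Q
    Additive-orbit (B , d , μ , _ , Q≡) add x y = trans (Q≡ _) (trans (cong (μ ⊗_) (trans (cong rep (matVec-⊕ B x y)) (add _ _)))
      (trans (R.distribˡ μ _ _) (sym (cong₂ _⊕_ (Q≡ x) (Q≡ y)))))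

    InOrbitOf-sym : InOrbitOf 𝔽 rep Q → InOrbitOf 𝔽 Q rep
    InOrbitOf-sym (B , d , μ , μ≢0 , Q≡) = inv B d , det-inv B d , μ ⁻¹[ μ≢0 ] , ⁻¹-nonzero μ≢0 , λ x →
      sym (trans (cong (μ ⁻¹[ μ≢0 ] ⊗_) (trans (Q≡ _) (cong (λ x → μ ⊗ rep x) (matVec-invʳ B d x))))
        (trans (solve 3 (λ i μ r → i :* (μ :* r) := μ :* i :* r) refl (μ ⁻¹[ μ≢0 ]) μ (rep x))
          (trans (cong (_⊗ rep x) (inverseʳ μ≢0)) (R.*-identityˡ _))))

  -- The radical of the polar form is spanned by `e²`, the nucleus of the conic, where the form
  -- takes the value 1. Testing a vertex against `e¹` and `e³` forces x₂ = x₀ = 0, and the vanishing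
  -- of the form at the vertex then gives x₁ = 0.
  nonSingular-¬Singular : ¬ Singular (nonSingular 𝔽)
  nonSingular-¬Singular (x₀ ∷ x₁ ∷ x₂ ∷ [] , x≢0 , x0 , radical) = x≢0 (vec3≡ x₀≡0 x₁≡0 x₂≡0)
    where
    x₂≡0 : x₂ ≡ 𝟘
    x₂≡0 = trans (solve 3 (λ x₀ x₁ x₂ → x₂ := ((x₀ :+ :1) :* (x₂ :+ :0) :+ (x₁ :+ :0) :* (x₁ :+ :0)) :+ (x₀ :* x₂ :+ x₁ :* x₁)) refl x₀ x₁ x₂)
      (0⊕0 (trans (radical e¹) (solve 0 (:1 :* :0 :+ :0 :* :0 := :0) refl)) x0)
    x₀≡0 : x₀ ≡ 𝟘
    x₀≡0 = trans (solve 3 (λ x₀ x₁ x₂ → x₀ := ((x₀ :+ :0) :* (x₂ :+ :1) :+ (x₁ :+ :0) :* (x₁ :+ :0)) :+ (x₀ :* x₂ :+ x₁ :* x₁)) refl x₀ x₁ x₂)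
      (0⊕0 (trans (radical e³) (solve 0 (:0 :* :1 :+ :0 :* :0 := :0) refl)) x0)
    x₁≡0 : x₁ ≡ 𝟘
    x₁≡0 = x⊗x≡0⇒x≡0 (trans (solve 3 (λ x₀ x₁ x₂ → x₁ :* x₁ := (x₀ :* x₂ :+ x₁ :* x₁) :+ x₀ :* x₂) refl x₀ x₁ x₂) (0⊕0 x0 (0⊗x x₀≡0)))

  e³≢0 : e³ ≢ 0ᵥ
  e³≢0 e = 𝟘≢𝟙 (sym (proj₂ (proj₂ (∷³-injective e))))

  doubleLine-Singular : Singular (doubleLine 𝔽)
  doubleLine-Singular = e³ , e³≢0 , R.zeroˡ 𝟘 , λ { (y₀ ∷ y₁ ∷ y₂ ∷ []) → cong₂ _⊗_ (R.+-identityˡ y₀) (R.+-identityˡ y₀) }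

  realPair-Singular : Singular (realPair 𝔽)
  realPair-Singular = e³ , e³≢0 , R.zeroˡ 𝟘 , λ { (y₀ ∷ y₁ ∷ y₂ ∷ []) → cong₂ _⊗_ (R.+-identityˡ y₀) (R.+-identityˡ y₁) }

  imagPair-Singular : ∀ l → Singular (imagPair 𝔽 l)
  imagPair-Singular l = e³ , e³≢0 , solve 1 (λ l → :0 :* :0 :+ :0 :* :0 :+ l :* :0 :* :0 := :0) refl l ,
    λ { (y₀ ∷ y₁ ∷ y₂ ∷ []) → cong₂ (λ x y → x ⊗ x ⊕ x ⊗ y ⊕ l ⊗ y ⊗ y) (R.+-identityˡ y₀) (R.+-identityˡ y₁) }

  doubleLine-Additive : Additive (doubleLine 𝔽)
  doubleLine-Additive (x ∷ _ ∷ _ ∷ []) (y ∷ _ ∷ _ ∷ []) = solve 2 (λ x y → (x :+ y) :* (x :+ y) := x :* x :+ y :* y) refl x y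

  realPair-¬Additive : ¬ Additive (realPair 𝔽)
  realPair-¬Additive add = 𝟘≢𝟙 (trans (solve 0 (:0 := :1 :* :0 :+ :0 :* :1) refl)
    (trans (sym (add e¹ e²)) (solve 0 ((:1 :+ :0) :* (:0 :+ :1) := :1) refl)))

  imagPair-¬Additive : ∀ l → ¬ Additive (imagPair 𝔽 l)
  imagPair-¬Additive l add = 𝟘≢𝟙 (sym (trans
    (solve 1 (λ l → let Q = λ x y → x :* x :+ x :* y :+ l :* y :* y in :1 := Q (:1 :+ :0) (:0 :+ :1) :+ (Q :1 :0 :+ Q :0 :1)) refl l)
    (x≡y⇒x⊕y≡0 (add e¹ e²))))

  ¬H₃ : ∀ {rep a} → Singular rep → InOrbitOf 𝔽 rep (conic 𝔽 a) → ¬ H₃ 𝔽 a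
  ¬H₃ {rep} {a} sing o h₃ = nonSingular-¬Singular (Singular-orbit {conic 𝔽 a} {nonSingular 𝔽} (InOrbitOf-sym {nonSingular 𝔽} {conic 𝔽 a} h₃)
    (Singular-orbit {rep} {conic 𝔽 a} o sing))

  ¬H₁ : ∀ {rep a} → ¬ Additive rep → InOrbitOf 𝔽 rep (conic 𝔽 a) → ¬ H₁ 𝔽 a
  ¬H₁ {rep} {a} ¬add o h₁ = ¬add (Additive-orbit {conic 𝔽 a} {rep} (InOrbitOf-sym {rep} {conic 𝔽 a} o)
    (Additive-orbit {doubleLine 𝔽} {conic 𝔽 a} h₁ doubleLine-Additive))

  InOrbitOf-∙ : ∀ {rep k a} → k ≢ 𝟘 → InOrbitOf 𝔽 rep (conic 𝔽 a) → InOrbitOf 𝔽 rep (conic 𝔽 (k ∙ a))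
  InOrbitOf-∙ {rep} {k} {a} k≢0 (B , d , μ , μ≢0 , Q≡) = B , d , k ⊗ μ , ⊗-nonzero k≢0 μ≢0 , λ x →
    trans (conic-*ᵥ k a x) (trans (cong (k ⊗_) (Q≡ x)) (sym (R.*-assoc k μ _)))

  InOrbitOf-dual : ∀ {rep a} B → det 𝔽 B ≢ 𝟘 → InOrbitOf 𝔽 rep (conic 𝔽 a) → InOrbitOf 𝔽 rep (conic 𝔽 (dual B a))
  InOrbitOf-dual {rep} {a} B d (B′ , d′ , μ , μ≢0 , Q≡) = _·_ 𝔽 B′ B , det-·-nonzero {B′} {B} d′ d , μ , μ≢0 , λ x →
    trans (conic-dual B a x) (trans (Q≡ _) (cong (λ x → μ ⊗ rep x) (sym (matVec-· B′ B x))))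

  module _ (W : Plane 𝔽) where
    open Plane W

    ContainsPlane⇒ : ∀ {a} → ContainsPlane 𝔽 a W → ∀ y → y ∈ᵂ W → dot 𝔽 a y ≡ 𝟘
    ContainsPlane⇒ {a} (d₀ , d₁ , d₂) y (k₀ ∷ k₁ ∷ k₂ ∷ [] , y≡) = trans (cong (dot 𝔽 a) y≡)
      (trans (dot-+ᵥ a (k₀ ∙ b₀) _) (0⊕0 (z k₀ b₀ d₀) (trans (dot-+ᵥ a (k₁ ∙ b₁) (k₂ ∙ b₂)) (0⊕0 (z k₁ b₁ d₁) (z k₂ b₂ d₂)))))
      where
      z : ∀ k b → dot 𝔽 a b ≡ 𝟘 → dot 𝔽 a (k ∙ b) ≡ 𝟘
      z k b e = trans (dot-*ᵥ a k b) (x⊗0 e)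

    b₀∈ : b₀ ∈ᵂ W
    b₀∈ = e¹ , unit₀ b₀ b₁ b₂
      where
      unit₀ : ∀ {n} (u v w : Vec F n) → u ≡ 𝟙 ∙ u +ᵛ (𝟘 ∙ v +ᵛ 𝟘 ∙ w)
      unit₀ [] [] [] = refl
      unit₀ (x ∷ u) (y ∷ v) (z ∷ w) = cong₂ _∷_ (solve 3 (λ x y z → x := :1 :* x :+ (:0 :* y :+ :0 :* z)) refl x y z) (unit₀ u v w)

    b₁∈ : b₁ ∈ᵂ W
    b₁∈ = e² , unit₁ b₀ b₁ b₂
      where
      unit₁ : ∀ {n} (u v w : Vec F n) → v ≡ 𝟘 ∙ u +ᵛ (𝟙 ∙ v +ᵛ 𝟘 ∙ w)
      unit₁ [] [] [] = refl
      unit₁ (x ∷ u) (y ∷ v) (z ∷ w) = cong₂ _∷_ (solve 3 (λ x y z → y := :0 :* x :+ (:1 :* y :+ :0 :* z)) refl x y z) (unit₁ u v w)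

    b₂∈ : b₂ ∈ᵂ W
    b₂∈ = e³ , unit₂ b₀ b₁ b₂
      where
      unit₂ : ∀ {n} (u v w : Vec F n) → w ≡ 𝟘 ∙ u +ᵛ (𝟘 ∙ v +ᵛ 𝟙 ∙ w)
      unit₂ [] [] [] = refl
      unit₂ (x ∷ u) (y ∷ v) (z ∷ w) = cong₂ _∷_ (solve 3 (λ x y z → z := :0 :* x :+ (:0 :* y :+ :1 :* z)) refl x y z) (unit₂ u v w)

    ⇒ContainsPlane : ∀ {a} → (∀ y → y ∈ᵂ W → dot 𝔽 a y ≡ 𝟘) → ContainsPlane 𝔽 a W
    ⇒ContainsPlane h = h b₀ b₀∈ , h b₁ b₁∈ , h b₂ b₂∈

    ContainsPlane-∙ : ∀ {k a} → ContainsPlane 𝔽 a W → ContainsPlane 𝔽 (k ∙ a) W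
    ContainsPlane-∙ {k} {a} (d₀ , d₁ , d₂) = z b₀ d₀ , z b₁ d₁ , z b₂ d₂
      where
      z : ∀ b → dot 𝔽 a b ≡ 𝟘 → dot 𝔽 (k ∙ a) b ≡ 𝟘
      z b e = trans (*ᵥ-dot k a b) (x⊗0 e)

  -- The cubic form without zeros, and arithmetic in F(θ)

  module Canonical (c : F) (missed : ∀ x → x ⊗ x ⊗ x ⊕ x ≢ c) where

    -- The norm of s + tθ, where θ³ = θ + c.
    f : F → F → F
    f s t = s ⊗ s ⊗ s ⊕ s ⊗ t ⊗ t ⊕ c ⊗ t ⊗ t ⊗ t

    :f : ∀ {n} (c s t : Polynomial n) → Polynomial n
    :f c s t = s :* s :* s :+ s :* t :* t :+ c :* t :* t :* t

    c≢0 : c ≢ 𝟘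
    c≢0 refl = missed 𝟘 (solve 0 (:0 :* :0 :* :0 :+ :0 := :0) refl)

    f-t≡0 : ∀ {s t} → f s t ≡ 𝟘 → t ≡ 𝟘
    f-t≡0 {s} {t} e with t ≟ 𝟘
    ... | yes t≡0 = t≡0
    ... | no t≢0 with i , ti≡1 ← inverse t t≢0 = contradiction (x⊕y≡0⇒x≡y root) (missed (s ⊗ i))
      where
      open ≡-Reasoning
      x = s ⊗ i
      root : x ⊗ x ⊗ x ⊕ x ⊕ c ≡ 𝟘
      root = begin
        x ⊗ x ⊗ x ⊕ x ⊕ c
          ≡⟨ solve 2 (λ x c → x :* x :* x :+ x :+ c := x :* x :* x :+ x :* (:1 :* :1) :+ c :* (:1 :* :1 :* :1)) refl x c ⟩
        x ⊗ x ⊗ x ⊕ x ⊗ (𝟙 ⊗ 𝟙) ⊕ c ⊗ (𝟙 ⊗ 𝟙 ⊗ 𝟙)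
          ≡⟨ cong (λ w → x ⊗ x ⊗ x ⊕ x ⊗ (w ⊗ w) ⊕ c ⊗ (w ⊗ w ⊗ w)) ti≡1 ⟨
        x ⊗ x ⊗ x ⊕ x ⊗ (t ⊗ i ⊗ (t ⊗ i)) ⊕ c ⊗ (t ⊗ i ⊗ (t ⊗ i) ⊗ (t ⊗ i))
          ≡⟨ solve 4 (λ s t i c → let x = s :* i ; w = t :* i in
               x :* x :* x :+ x :* (w :* w) :+ c :* (w :* w :* w) := i :* i :* i :* :f c s t) refl s t i c ⟩
        i ⊗ i ⊗ i ⊗ f s t
          ≡⟨ x⊗0 e ⟩
        𝟘 ∎

    f-anisotropic : ∀ {s t} → f s t ≡ 𝟘 → s ≡ 𝟘 × t ≡ 𝟘
    f-anisotropic {s} {t} e with refl ← f-t≡0 e = cube (trans (solve 2 (λ s c → s :* (s :* s) := :f c s :0) refl s c) e) , refl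
      where
      cube : s ⊗ (s ⊗ s) ≡ 𝟘 → s ≡ 𝟘
      cube e with s ≟ 𝟘
      ... | yes s≡0 = s≡0
      ... | no s≢0 = x⊗x≡0⇒x≡0 (cancelˡ s≢0 e)

    -- For θ³ = θ + c, the element sθ + tθ² is a root of x³ + (e₂ s t) x + e₃ s t.
    e₂ e₃ : F → F → F
    e₂ s t = s ⊗ s ⊕ c ⊗ s ⊗ t ⊕ t ⊗ t
    e₃ s t = c ⊗ f s t

    :e₂ :e₃ : ∀ {n} (c s t : Polynomial n) → Polynomial n
    :e₂ c s t = s :* s :+ c :* s :* t :+ t :* t
    :e₃ c s t = c :* :f c s t

    -- sθ + tθ² = ((s² + t²)θ + ct²) / (tθ + s)
    möbius : ∀ s t x z → let X = (s ⊗ s ⊕ t ⊗ t) ⊗ x ⊕ c ⊗ t ⊗ t ⊗ z ; Z = t ⊗ x ⊕ s ⊗ z in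
      X ⊗ X ⊗ X ⊕ e₂ s t ⊗ X ⊗ Z ⊗ Z ⊕ e₃ s t ⊗ Z ⊗ Z ⊗ Z ≡ f s t ⊗ f s t ⊗ f x z
    möbius s t x z = solve 5 (λ c s t x z → let X = (s :* s :+ t :* t) :* x :+ c :* t :* t :* z ; Z = t :* x :+ s :* z in
      X :* X :* X :+ :e₂ c s t :* X :* Z :* Z :+ :e₃ c s t :* Z :* Z :* Z := :f c s t :* :f c s t :* :f c x z) refl c s t x z

    -- The Möbius map of `möbius` has coefficients in F and determinant `f s t`, so a root in F of
    -- the new cubic would pull back to a nontrivial zero of `f`.
    e-rootfree : ∀ {s t} → f s t ≢ 𝟘 → ∀ r → r ⊗ r ⊗ r ⊕ e₂ s t ⊗ r ⊕ e₃ s t ≢ 𝟘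
    e-rootfree {s} {t} f≢0 r root = f≢0 (trans (sym Z≡φ)
        (0⊕0 (x⊗0 (proj₁ xz≡0)) (x⊗0 (proj₂ xz≡0))))
      where
      open ≡-Reasoning
      -- (x , z) is the adjugate of the matrix of the Möbius map applied to (r , 1); hence applying
      -- the map again gives (φr , φ).
      x = s ⊗ r ⊕ c ⊗ t ⊗ t
      z = t ⊗ r ⊕ s ⊗ s ⊕ t ⊗ t
      φ = f s t
      X = (s ⊗ s ⊕ t ⊗ t) ⊗ x ⊕ c ⊗ t ⊗ t ⊗ z
      Z = t ⊗ x ⊕ s ⊗ z
      G : F → F → F
      G X Z = X ⊗ X ⊗ X ⊕ e₂ s t ⊗ X ⊗ Z ⊗ Z ⊕ e₃ s t ⊗ Z ⊗ Z ⊗ Z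
      X≡φr : X ≡ φ ⊗ r
      X≡φr = solve 4 (λ c s t r → (s :* s :+ t :* t) :* (s :* r :+ c :* t :* t) :+ c :* t :* t :* (t :* r :+ s :* s :+ t :* t)
        := :f c s t :* r) refl c s t r
      Z≡φ : Z ≡ φ
      Z≡φ = solve 4 (λ c s t r → t :* (s :* r :+ c :* t :* t) :+ s :* (t :* r :+ s :* s :+ t :* t) := :f c s t) refl c s t r
      xz≡0 : x ≡ 𝟘 × z ≡ 𝟘
      xz≡0 = f-anisotropic (cancelˡ (⊗-nonzero f≢0 f≢0) (begin
        φ ⊗ φ ⊗ f x z ≡⟨ möbius s t x z ⟨
        G X Z ≡⟨ cong₂ G X≡φr Z≡φ ⟩
        G (φ ⊗ r) φ
          ≡⟨ solve 4 (λ a b φ r → φ :* r :* (φ :* r) :* (φ :* r) :+ a :* (φ :* r) :* φ :* φ :+ b :* φ :* φ :* φ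
               := φ :* φ :* φ :* (r :* r :* r :+ a :* r :+ b)) refl (e₂ s t) (e₃ s t) φ r ⟩
        φ ⊗ φ ⊗ φ ⊗ (r ⊗ r ⊗ r ⊕ e₂ s t ⊗ r ⊕ e₃ s t) ≡⟨ x⊗0 root ⟩
        𝟘 ∎))

    -- The coordinates of (sθ + tθ²)(u + vθ + wθ²).
    m₀ m₁ m₂ : (s t u v w : F) → F
    m₀ s t u v w = c ⊗ (v ⊗ t ⊕ w ⊗ s)
    m₁ s t u v w = u ⊗ s ⊕ (v ⊗ t ⊕ w ⊗ s) ⊕ c ⊗ w ⊗ t
    m₂ s t u v w = u ⊗ t ⊕ v ⊗ s ⊕ w ⊗ t

    -- The three equations are linear in u, v, w with determinant the norm of sθ + tθ², which is c
    -- `f s t`. Eliminating u and v leaves w times `f s t`, and `f-anisotropic` makes that factor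
    -- nonzero.
    no-zero-divisors : ∀ {s t u v w} → ¬ (s ≡ 𝟘 × t ≡ 𝟘) →
      m₀ s t u v w ≡ 𝟘 → m₁ s t u v w ≡ 𝟘 → m₂ s t u v w ≡ 𝟘 → u ≡ 𝟘 × v ≡ 𝟘 × w ≡ 𝟘
    no-zero-divisors {s} {t} {u} {v} {w} st≢0 E₀ E₁ E₂ = finish w≡0
      where
      e≡0 : v ⊗ t ⊕ w ⊗ s ≡ 𝟘
      e≡0 = cancelˡ c≢0 E₀
      w≡0 : w ≡ 𝟘
      w≡0 = cancelʳ (λ f≡0 → st≢0 (f-anisotropic f≡0)) (trans
        (solve 6 (λ c s t u v w → let e = v :* t :+ w :* s in
           w :* :f c s t := e :* (s :* s :+ t :* t) :+ t :* s :* (u :* t :+ v :* s :+ w :* t) :+ t :* t :* (u :* s :+ e :+ c :* w :* t))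
           refl c s t u v w)
        (0⊕0 (0⊕0 (0⊗x e≡0) (x⊗0 E₂)) (x⊗0 E₁)))
      finish : w ≡ 𝟘 → u ≡ 𝟘 × v ≡ 𝟘 × w ≡ 𝟘
      finish refl = u≡0 , v≡0 , refl
        where
        vt≡0 : v ⊗ t ≡ 𝟘
        vt≡0 = trans (solve 3 (λ v t s → v :* t := v :* t :+ :0 :* s) refl v t s) e≡0
        us≡0 : u ⊗ s ≡ 𝟘
        us≡0 = trans (solve 5 (λ c s t u v → u :* s := (u :* s :+ (v :* t :+ :0 :* s) :+ c :* :0 :* t) :+ v :* t) refl c s t u v) (0⊕0 E₁ vt≡0)
        ut+vs≡0 : u ⊗ t ⊕ v ⊗ s ≡ 𝟘
        ut+vs≡0 = trans (solve 4 (λ s t u v → u :* t :+ v :* s := u :* t :+ v :* s :+ :0 :* t) refl s t u v) E₂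
        v≡0 : v ≡ 𝟘
        v≡0 with t ≟ 𝟘
        ... | no t≢0 = cancelʳ t≢0 vt≡0
        ... | yes refl = cancelʳ (λ s≡0 → st≢0 (s≡0 , refl)) (trans (solve 3 (λ s u v → v :* s := u :* :0 :+ v :* s) refl s u v) ut+vs≡0)
        u≡0 : u ≡ 𝟘
        u≡0 with s ≟ 𝟘
        ... | no s≢0 = cancelʳ s≢0 us≡0
        ... | yes refl = cancelʳ (λ t≡0 → st≢0 (refl , t≡0)) (trans (solve 3 (λ t u v → u :* t := u :* t :+ v :* :0) refl t u v) ut+vs≡0)

    -- With φᵢ = sᵢθ + tᵢθ², the coordinates of φ₁² + φ₁φ₂ + φ₂² + a.
    q₀ q₁ q₂ : (a s₁ t₁ s₂ t₂ : F) → F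
    q₀ a s₁ t₁ s₂ t₂ = c ⊗ (s₁ ⊗ t₂ ⊕ t₁ ⊗ s₂) ⊕ a
    q₁ a s₁ t₁ s₂ t₂ = c ⊗ (t₁ ⊗ t₁ ⊕ t₁ ⊗ t₂ ⊕ t₂ ⊗ t₂) ⊕ (s₁ ⊗ t₂ ⊕ t₁ ⊗ s₂)
    q₂ a s₁ t₁ s₂ t₂ = s₁ ⊗ s₁ ⊕ s₁ ⊗ s₂ ⊕ s₂ ⊗ s₂ ⊕ (t₁ ⊗ t₁ ⊕ t₁ ⊗ t₂ ⊕ t₂ ⊗ t₂)

    private
      :q₀ :q₁ :q₂ : ∀ {n} (c a s₁ t₁ s₂ t₂ : Polynomial n) → Polynomial n
      :q₀ c a s₁ t₁ s₂ t₂ = c :* (s₁ :* t₂ :+ t₁ :* s₂) :+ a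
      :q₁ c a s₁ t₁ s₂ t₂ = c :* (t₁ :* t₁ :+ t₁ :* t₂ :+ t₂ :* t₂) :+ (s₁ :* t₂ :+ t₁ :* s₂)
      :q₂ c a s₁ t₁ s₂ t₂ = s₁ :* s₁ :+ s₁ :* s₂ :+ s₂ :* s₂ :+ (t₁ :* t₁ :+ t₁ :* t₂ :+ t₂ :* t₂)
      :m₀ :m₁ :m₂ : ∀ {n} (c s t u v w : Polynomial n) → Polynomial n
      :m₀ c s t u v w = c :* (v :* t :+ w :* s)
      :m₁ c s t u v w = u :* s :+ (v :* t :+ w :* s) :+ c :* w :* t
      :m₂ c s t u v w = u :* t :+ v :* s :+ w :* t

    -- Subtracting φ₁³ + aφ₁ + b = 0 and φ₂³ + aφ₂ + b = 0 gives (φ₁ + φ₂)(φ₁² + φ₁φ₂ + φ₂² + a) =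
    -- 0, and the first factor is nonzero. The solver identities are the three coordinates of this
    -- product.
    quotient≡0 : ∀ {a s₁ t₁ s₂ t₂} → ¬ (s₁ ≡ s₂ × t₁ ≡ t₂) → e₂ s₁ t₁ ≡ a → e₂ s₂ t₂ ≡ a → e₃ s₁ t₁ ≡ e₃ s₂ t₂ →
      q₀ a s₁ t₁ s₂ t₂ ≡ 𝟘 × q₁ a s₁ t₁ s₂ t₂ ≡ 𝟘 × q₂ a s₁ t₁ s₂ t₂ ≡ 𝟘
    quotient≡0 {_} {s₁} {t₁} {s₂} {t₂} φ₁≢φ₂ refl e₂≡ e₃≡ = no-zero-divisors
        (λ (s≡0 , t≡0) → φ₁≢φ₂ (x⊕y≡0⇒x≡y s≡0 , x⊕y≡0⇒x≡y t≡0))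
        (trans (solve 5 (λ c s₁ t₁ s₂ t₂ → let a = :e₂ c s₁ t₁ in
            :m₀ c (s₁ :+ s₂) (t₁ :+ t₂) (:q₀ c a s₁ t₁ s₂ t₂) (:q₁ c a s₁ t₁ s₂ t₂) (:q₂ c a s₁ t₁ s₂ t₂)
              := :e₃ c s₁ t₁ :+ :e₃ c s₂ t₂) refl c s₁ t₁ s₂ t₂) (x≡y⇒x⊕y≡0 e₃≡))
        (trans (solve 5 (λ c s₁ t₁ s₂ t₂ → let a = :e₂ c s₁ t₁ in
            :m₁ c (s₁ :+ s₂) (t₁ :+ t₂) (:q₀ c a s₁ t₁ s₂ t₂) (:q₁ c a s₁ t₁ s₂ t₂) (:q₂ c a s₁ t₁ s₂ t₂)
              := s₂ :* (:e₂ c s₂ t₂ :+ :e₂ c s₁ t₁)) refl c s₁ t₁ s₂ t₂) (x⊗0 (x≡y⇒x⊕y≡0 e₂≡)))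
        (trans (solve 5 (λ c s₁ t₁ s₂ t₂ → let a = :e₂ c s₁ t₁ in
            :m₂ c (s₁ :+ s₂) (t₁ :+ t₂) (:q₀ c a s₁ t₁ s₂ t₂) (:q₁ c a s₁ t₁ s₂ t₂) (:q₂ c a s₁ t₁ s₂ t₂)
              := t₂ :* (:e₂ c s₂ t₂ :+ :e₂ c s₁ t₁)) refl c s₁ t₁ s₂ t₂) (x⊗0 (x≡y⇒x⊕y≡0 e₂≡)))

    -- The quotients for the pairs 1, 2 and 1, 3 add up to (φ₂ + φ₃)(φ₁ + φ₂ + φ₃) = 0, whose first
    -- factor is nonzero.
    third-root : ∀ {a b s₁ t₁ s₂ t₂ s₃ t₃} → ¬ (s₁ ≡ s₂ × t₁ ≡ t₂) → ¬ (s₁ ≡ s₃ × t₁ ≡ t₃) → ¬ (s₂ ≡ s₃ × t₂ ≡ t₃) →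
      e₂ s₁ t₁ ≡ a → e₃ s₁ t₁ ≡ b → e₂ s₂ t₂ ≡ a → e₃ s₂ t₂ ≡ b → e₂ s₃ t₃ ≡ a → e₃ s₃ t₃ ≡ b →
      s₃ ≡ s₁ ⊕ s₂ × t₃ ≡ t₁ ⊕ t₂
    third-root {a} {b} {s₁} {t₁} {s₂} {t₂} {s₃} {t₃} ≢₁₂ ≢₁₃ ≢₂₃ a₁ b₁ a₂ b₂ a₃ b₃ =
      sym (x⊕y≡0⇒x≡y (proj₁ (proj₂ sum≡0))) , sym (x⊕y≡0⇒x≡y (proj₂ (proj₂ sum≡0)))
      where
      E : q₀ a s₁ t₁ s₂ t₂ ≡ 𝟘 × q₁ a s₁ t₁ s₂ t₂ ≡ 𝟘 × q₂ a s₁ t₁ s₂ t₂ ≡ 𝟘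
      E = quotient≡0 ≢₁₂ a₁ a₂ (trans b₁ (sym b₂))
      D : q₀ a s₁ t₁ s₃ t₃ ≡ 𝟘 × q₁ a s₁ t₁ s₃ t₃ ≡ 𝟘 × q₂ a s₁ t₁ s₃ t₃ ≡ 𝟘
      D = quotient≡0 ≢₁₃ a₁ a₃ (trans b₁ (sym b₃))
      s = s₂ ⊕ s₃
      t = t₂ ⊕ t₃
      v = s₁ ⊕ s₂ ⊕ s₃
      w = t₁ ⊕ t₂ ⊕ t₃
      M₀ : m₀ s t 𝟘 v w ≡ 𝟘
      M₀ = trans (solve 8 (λ c a s₁ t₁ s₂ t₂ s₃ t₃ → :m₀ c (s₂ :+ s₃) (t₂ :+ t₃) :0 (s₁ :+ s₂ :+ s₃) (t₁ :+ t₂ :+ t₃)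
        := :q₀ c a s₁ t₁ s₂ t₂ :+ :q₀ c a s₁ t₁ s₃ t₃) refl c a s₁ t₁ s₂ t₂ s₃ t₃) (0⊕0 (proj₁ E) (proj₁ D))
      M₁ : m₁ s t 𝟘 v w ≡ 𝟘
      M₁ = trans (solve 8 (λ c a s₁ t₁ s₂ t₂ s₃ t₃ → :m₁ c (s₂ :+ s₃) (t₂ :+ t₃) :0 (s₁ :+ s₂ :+ s₃) (t₁ :+ t₂ :+ t₃)
        := :q₁ c a s₁ t₁ s₂ t₂ :+ :q₁ c a s₁ t₁ s₃ t₃) refl c a s₁ t₁ s₂ t₂ s₃ t₃) (0⊕0 (proj₁ (proj₂ E)) (proj₁ (proj₂ D)))
      M₂ : m₂ s t 𝟘 v w ≡ 𝟘
      M₂ = trans (solve 8 (λ c a s₁ t₁ s₂ t₂ s₃ t₃ → :m₂ c (s₂ :+ s₃) (t₂ :+ t₃) :0 (s₁ :+ s₂ :+ s₃) (t₁ :+ t₂ :+ t₃)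
        := :q₂ c a s₁ t₁ s₂ t₂ :+ :q₂ c a s₁ t₁ s₃ t₃) refl c a s₁ t₁ s₂ t₂ s₃ t₃) (0⊕0 (proj₂ (proj₂ E)) (proj₂ (proj₂ D)))
      sum≡0 : 𝟘 ≡ 𝟘 × v ≡ 𝟘 × w ≡ 𝟘
      sum≡0 = no-zero-divisors {s} {t} {𝟘} {v} {w} (λ (s≡0 , t≡0) → ≢₂₃ (x⊕y≡0⇒x≡y s≡0 , x⊕y≡0⇒x≡y t≡0)) M₀ M₁ M₂

    -- Every root-free x³ + ax + b comes from some (s , t)

    q : ℕ
    q = length elements

    EE : List (F × F)
    EE = cartesianProduct elements elements

    EE-complete : ∀ p → p ∈ EE
    EE-complete (a , b) = ∈-cartesianProduct⁺ (complete a) (complete b)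

    EE-unique : Unique EE
    EE-unique = cartesianProduct⁺ distinct distinct

    _≟₂_ : DecidableEquality (F × F)
    _≟₂_ = ≡-dec _≟_ _≟_

    Root : F × F → F → Set
    Root (a , b) r = r ⊗ r ⊗ r ⊕ a ⊗ r ⊕ b ≡ 𝟘

    root? : ∀ p r → Dec (Root p r)
    root? (a , b) r = (r ⊗ r ⊗ r ⊕ a ⊗ r ⊕ b) ≟ 𝟘

    roots : F × F → ℕ
    roots p = ∑ elements (λ r → ι (root? p r))

    e : F × F → F × F
    e (s , t) = e₂ s t , e₃ s t

    fibre : F × F → ℕ
    fibre p = ∑ EE (λ x → ι (p ≟₂ e x))

    two-roots⇒a : ∀ {a b x y} → x ≢ y → Root (a , b) x → Root (a , b) y → x ⊗ x ⊕ x ⊗ y ⊕ y ⊗ y ⊕ a ≡ 𝟘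
    two-roots⇒a {a} {b} {x} {y} x≢y rx ry = cancelˡ (λ x+y≡0 → x≢y (x⊕y≡0⇒x≡y x+y≡0)) (trans
      (solve 4 (λ a b x y → (x :+ y) :* (x :* x :+ x :* y :+ y :* y :+ a) :=
        (x :* x :* x :+ a :* x :+ b) :+ (y :* y :* y :+ a :* y :+ b)) refl a b x y)
      (0⊕0 rx ry))

    -- Without an x² term the roots sum to 0, so two distinct roots determine the third, which may
    -- coincide with one of them.
    Root-⊕ : ∀ {p x y} → x ≢ y → Root p x → Root p y → Root p (x ⊕ y)
    Root-⊕ {a , b} {x} {y} x≢y rx ry = trans
      (solve 4 (λ a b x y → let s = x :+ y in s :* s :* s :+ a :* s :+ b :=
        (y :* y :* y :+ a :* y :+ b) :+ x :* (x :* x :+ x :* y :+ y :* y :+ a)) refl a b x y)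
      (0⊕0 ry (x⊗0 (two-roots⇒a {a} {b} x≢y rx ry)))

    zero-and-nonzero-root : ∀ {a b x} → x ≢ 𝟘 → Root (a , b) x → Root (a , b) 𝟘 → b ≡ 𝟘 × (a , b) ≢ (𝟘 , 𝟘)
    zero-and-nonzero-root {a} {b} {x} x≢0 rx r0 = b≡0 , λ { refl → x≢0 (x⊗x≡0⇒x≡0 (cancelˡ x≢0 (trans
        (solve 1 (λ x → x :* (x :* x) := x :* x :* x :+ :0 :* x :+ :0) refl x) rx))) }
      where
      b≡0 : b ≡ 𝟘
      b≡0 = trans (solve 2 (λ a b → b := :0 :* :0 :* :0 :+ a :* :0 :+ b) refl a b) r0

    -- The third root x + y must repeat x or y, so one of the two is 0 and the other is not. These
    -- cubics have the form x(x + √a)² with a ≠ 0.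
    two-roots : ∀ a b → roots (a , b) ≡ 2 → b ≡ 𝟘 × (a , b) ≢ (𝟘 , 𝟘)
    two-roots a b n≡2 = go (filter (root? (a , b)) elements) (trans (sym (∑-ι elements _)) n≡2)
        (filter⁺ (root? (a , b)) distinct) (λ r∈ → proj₂ (∈-filter⁻ (root? (a , b)) {xs = elements} r∈))
        (λ rr → ∈-filter⁺ (root? (a , b)) (complete _) rr)
      where
      go : ∀ l → length l ≡ 2 → Unique l → (∀ {r} → r ∈ l → Root (a , b) r) → (∀ {r} → Root (a , b) r → r ∈ l) →
           b ≡ 𝟘 × (a , b) ≢ (𝟘 , 𝟘)
      go (x ∷ y ∷ []) _ ((x≢y ∷ []) ∷ _) sound compl = third (compl (Root-⊕ {a , b} x≢y rx ry))
        where
        rx : Root (a , b) x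
        rx = sound (here refl)
        ry : Root (a , b) y
        ry = sound (there (here refl))
        third : x ⊕ y ∈ x ∷ y ∷ [] → b ≡ 𝟘 × (a , b) ≢ (𝟘 , 𝟘)
        third (here x+y≡x) = zero-and-nonzero-root (λ x≡0 → x≢y (trans x≡0 (sym y≡0))) rx (subst (Root (a , b)) y≡0 ry)
          where
          y≡0 : y ≡ 𝟘
          y≡0 = trans (solve 2 (λ x y → y := (x :+ y) :+ x) refl x y) (x≡y⇒x⊕y≡0 x+y≡x)
        third (there (here x+y≡y)) = zero-and-nonzero-root (λ y≡0 → x≢y (trans x≡0 (sym y≡0))) ry (subst (Root (a , b)) x≡0 rx)
          where
          x≡0 : x ≡ 𝟘
          x≡0 = trans (solve 2 (λ x y → x := (x :+ y) :+ y) refl x y) (x≡y⇒x⊕y≡0 x+y≡y)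

    -- (n - 1)(n - 3) ≥ 0 unless n = 2.
    roots-bound : ∀ p → 3 * ι (roots p ≟ℕ 0) + ι (p ≟₂ (𝟘 , 𝟘)) + 4 * roots p ≤ 3 + roots p * roots p + ι (proj₂ p ≟ 𝟘)
    roots-bound p@(a , b) = go (roots p) refl
      where
      le : ι (p ≟₂ (𝟘 , 𝟘)) ≤ ι (b ≟ 𝟘)
      le = ι-mono (p ≟₂ (𝟘 , 𝟘)) (b ≟ 𝟘) (cong proj₂)
      comm : ∀ k x → x + k ≡ k + x
      comm k x = +-comm x k
      go : ∀ n → roots p ≡ n → 3 * ι (n ≟ℕ 0) + ι (p ≟₂ (𝟘 , 𝟘)) + 4 * n ≤ 3 + n * n + ι (b ≟ 𝟘)
      go 0 _ = ≤-trans (≤-reflexive (+-identityʳ _)) (+-monoʳ-≤ 3 le)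
      go 1 _ = ≤-trans (≤-reflexive (comm 4 _)) (+-monoʳ-≤ 4 le)
      -- The one exceptional value: 4n = 8 exceeds 3 + n² = 7 by 1, and the indicator of b = 0 pays
      -- for it.
      go 2 n≡2 rewrite ι-no (p ≟₂ (𝟘 , 𝟘)) (proj₂ (two-roots a b n≡2)) | ι-yes (b ≟ 𝟘) (proj₁ (two-roots a b n≡2)) = ≤-refl
      go 3 _ = ≤-trans (≤-reflexive (comm 12 _)) (+-monoʳ-≤ 12 le)
      go (suc (suc (suc (suc k)))) _ = ≤-trans (≤-reflexive (comm (4 * (4 + k)) _)) (≤-trans (+-monoʳ-≤ (4 * (4 + k)) le)
        (+-monoˡ-≤ (ι (b ≟ 𝟘)) (4n≤3+n² k)))

    -- By `third-root` every further preimage is the sum of the first two, so a fourth would equal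
    -- the third.
    fibre≤3 : ∀ p → fibre p ≤ 3
    fibre≤3 p = ≤-trans (≤-reflexive (∑-ι EE hit?)) (go (filter hit? EE) (filter⁺ hit? EE-unique)
        (λ x∈ → proj₂ (∈-filter⁻ hit? {xs = EE} x∈)))
      where
      hit? : ∀ x → Dec (p ≡ e x)
      hit? x = p ≟₂ e x
      ≢-coords : ∀ {x y : F × F} → x ≢ y → ¬ (proj₁ x ≡ proj₁ y × proj₂ x ≡ proj₂ y)
      ≢-coords x≢y (refl , refl) = x≢y refl
      sum-of-two : ∀ {x y z} → x ≢ y → x ≢ z → y ≢ z → p ≡ e x → p ≡ e y → p ≡ e z →
        z ≡ (proj₁ x ⊕ proj₁ y , proj₂ x ⊕ proj₂ y)
      sum-of-two {x} {y} {z} x≢y x≢z y≢z ex ey ez = cong₂ _,_ (proj₁ eqs) (proj₂ eqs)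
        where
        eqs : proj₁ z ≡ proj₁ x ⊕ proj₁ y × proj₂ z ≡ proj₂ x ⊕ proj₂ y
        eqs = third-root (≢-coords x≢y) (≢-coords x≢z) (≢-coords y≢z)
          (sym (cong proj₁ ex)) (sym (cong proj₂ ex)) (sym (cong proj₁ ey)) (sym (cong proj₂ ey)) (sym (cong proj₁ ez)) (sym (cong proj₂ ez))
      go : ∀ l → Unique l → (∀ {x} → x ∈ l → p ≡ e x) → length l ≤ 3
      go [] _ _ = z≤n
      go (_ ∷ []) _ _ = s≤s z≤n
      go (_ ∷ _ ∷ []) _ _ = s≤s (s≤s z≤n)
      go (_ ∷ _ ∷ _ ∷ []) _ _ = ≤-refl
      go (x ∷ y ∷ z ∷ w ∷ l) ((x≢y ∷ x≢z ∷ x≢w ∷ _) ∷ (y≢z ∷ y≢w ∷ _) ∷ (z≢w ∷ _) ∷ _) all =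
        contradiction (trans (sum-of-two x≢y x≢z y≢z ex ey (all (there (there (here refl)))))
                        (sym (sum-of-two x≢y x≢w y≢w ex ey (all (there (there (there (here refl)))))))) z≢w
        where
        ex = all (here refl)
        ey = all (there (here refl))

    e≡0⇒≡0 : ∀ s t → e₃ s t ≡ 𝟘 → (s , t) ≡ (𝟘 , 𝟘)
    e≡0⇒≡0 s t e₃≡0 = cong₂ _,_ (proj₁ st≡0) (proj₂ st≡0)
      where st≡0 = f-anisotropic (cancelˡ c≢0 e₃≡0)

    rootless⇒roots≡0 : ∀ p → (∀ r → ¬ Root p r) → roots p ≡ 0
    rootless⇒roots≡0 p none = n≤0⇒n≡0 (∑-ι≤length {ys = []} (root? p) distinct (λ {r} rr → contradiction rr (none r)))

    -- By `e-rootfree`, every value of `e` other than (0 , 0) is root-free.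
    fibre-rootless : ∀ p → p ≢ (𝟘 , 𝟘) → roots p ≢ 0 → fibre p ≤ 0
    fibre-rootless p p≢0 n≢0 = ∑-ι≤length {ys = []} (λ x → p ≟₂ e x) EE-unique
      λ { {s , t} refl → contradiction (rootless⇒roots≡0 (e (s , t)) (e-rootfree (f≢0 s t p≢0))) n≢0 }
      where
      f≢0 : ∀ s t → e (s , t) ≢ (𝟘 , 𝟘) → f s t ≢ 𝟘
      f≢0 s t e≢0 f≡0 = e≢0 (trans (cong e (e≡0⇒≡0 s t (x⊗0 f≡0)))
        (cong₂ _,_ (solve 1 (λ c → :e₂ c :0 :0 := :0) refl c) (solve 1 (λ c → :e₃ c :0 :0 := :0) refl c)))

    -- A root-free pair has at most three preimages, (0 , 0) at most one, and other pairs none. A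
    -- missed root-free pair `p₀` has none either, and the 3 thereby saved is the excess that the
    -- final count refutes.
    fibre-bound : ∀ p₀ → (∀ r → ¬ Root p₀ r) → (∀ x → p₀ ≢ e x) → ∀ p →
      fibre p + 3 * ι (p ≟₂ p₀) ≤ 3 * ι (roots p ≟ℕ 0) + ι (p ≟₂ (𝟘 , 𝟘))
    fibre-bound p₀ none unhit p = go (p ≟₂ p₀) (p ≟₂ (𝟘 , 𝟘)) (roots p ≟ℕ 0)
      where
      fibre≤1 : p ≡ (𝟘 , 𝟘) → fibre p ≤ 1
      fibre≤1 p≡0 = ∑-ι≤length {ys = (𝟘 , 𝟘) ∷ []} (λ x → p ≟₂ e x) EE-unique
        λ { {s , t} p≡e → here (e≡0⇒≡0 s t (trans (sym (cong proj₂ p≡e)) (cong proj₂ p≡0))) }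
      go : (d₁ : Dec (p ≡ p₀)) (d₂ : Dec (p ≡ (𝟘 , 𝟘))) (d₃ : Dec (roots p ≡ 0)) → fibre p + 3 * ι d₁ ≤ 3 * ι d₃ + ι d₂
      go (yes refl) d₂ (no n≢0) = contradiction (rootless⇒roots≡0 p none) n≢0
      go (yes refl) d₂ (yes _) = ≤-trans (+-monoˡ-≤ 3 (∑-ι≤length {ys = []} (λ x → p ≟₂ e x) EE-unique
        (λ {x} h → contradiction h (unhit x)))) (m≤m+n 3 _)
      go (no _) d₂ (yes _) = ≤-trans (≤-reflexive (+-identityʳ _)) (≤-trans (fibre≤3 p) (m≤m+n 3 _))
      go (no _) (yes p≡0) (no _) = ≤-trans (≤-reflexive (+-identityʳ _)) (fibre≤1 p≡0)
      go (no _) (no p≢0) (no n≢0) = ≤-trans (≤-reflexive (+-identityʳ _)) (fibre-rootless p p≢0 n≢0)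

    ∑EE-const : ∀ k → ∑ EE (λ _ → k) ≡ q * q * k
    ∑EE-const k = trans (∑-const EE k) (cong (_* k) (length-cartesianProduct elements elements))

    ∑-fibre : ∑ EE fibre ≡ q * q
    ∑-fibre = trans (∑-swap EE EE (λ p x → ι (p ≟₂ e x))) (trans
      (∑-cong EE (λ x → ∑-ι-one (λ p → p ≟₂ e x) EE-unique (EE-complete (e x)) refl (λ p≡ → p≡)))
      (trans (∑EE-const 1) (*-identityʳ (q * q))))

    Root⇒b≡ : ∀ {a b r} → Root (a , b) r → b ≡ r ⊗ r ⊗ r ⊕ a ⊗ r
    Root⇒b≡ {a} {b} {r} h = sym (x⊕y≡0⇒x≡y h)

    ∑-Root : ∀ r → ∑ EE (λ p → ι (root? p r)) ≡ q
    ∑-Root r = trans (∑-cartesianProduct elements elements _) (trans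
      (∑-cong elements λ a → ∑-ι-one (λ b → root? (a , b) r) distinct (complete (r ⊗ r ⊗ r ⊕ a ⊗ r))
        (x⊕x≡0 _) (Root⇒b≡ {a} {_} {r}))
      (trans (∑-const elements 1) (*-identityʳ q)))

    ∑-roots : ∑ EE roots ≡ q * q
    ∑-roots = trans (∑-swap EE elements (λ p r → ι (root? p r))) (trans (∑-cong elements ∑-Root) (∑-const elements q))

    common : F → F → ℕ
    common r s = ∑ EE (λ p → ι (root? p r) * ι (root? p s))

    -- Two distinct common roots force a = r² + rs + s² and then b; a single prescribed root leaves
    -- a free, hence q pairs. Adding the indicator to the left side avoids a subtraction on the
    -- right.
    common-eq : ∀ r s → common r s + ι (r ≟ s) ≡ 1 + q * ι (r ≟ s)
    common-eq r s = go (r ≟ s)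
      where
      go : (d : Dec (r ≡ s)) → common r s + ι d ≡ 1 + q * ι d
      go (yes refl) = trans (+-comm _ 1) (cong suc (trans
        (∑-cong EE λ p → ι-idem (root? p r)) (trans (∑-Root r) (sym (*-identityʳ q)))))
        where
        ι-idem : {P : Set} (d : Dec P) → ι d * ι d ≡ ι d
        ι-idem (yes _) = refl
        ι-idem (no _) = refl
      go (no r≢s) = trans (+-identityʳ _) (trans (trans (∑-cong EE λ p → ι-× (root? p r) (root? p s))
        (∑-ι-one (λ p → root? p r ×-dec root? p s) EE-unique (EE-complete (a₀ , b₀))
          ( x⊕x≡0 b₀
          , solve 2 (λ r s → let a = r :* r :+ r :* s :+ s :* s in
              s :* s :* s :+ a :* s :+ (r :* r :* r :+ a :* r) := :0) refl r s)
          (λ {p} (rr , rs) → uniq p rr rs))) (cong suc (sym (*-zeroʳ q))))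
        where
        a₀ = r ⊗ r ⊕ r ⊗ s ⊕ s ⊗ s
        b₀ = r ⊗ r ⊗ r ⊕ a₀ ⊗ r
        uniq : ∀ p → Root p r → Root p s → p ≡ (a₀ , b₀)
        uniq (a , b) rr rs = cong₂ _,_ a≡ (trans (Root⇒b≡ {a} {b} {r} rr) (cong (λ a → r ⊗ r ⊗ r ⊕ a ⊗ r) a≡))
          where
          a≡ : a ≡ a₀
          a≡ = sym (x⊕y≡0⇒x≡y (two-roots⇒a {a} {b} r≢s rr rs))

    -- The square of the number of roots counts ordered pairs of roots. Exchanging the sums gives 1
    -- for each of the q(q - 1) pairs r ≠ s and q for each r = s, in total 2q² - q.
    ∑-roots² : ∑ EE (λ p → roots p * roots p) + q ≡ q * q + q * q
    ∑-roots² = begin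
      ∑ EE (λ p → roots p * roots p) + q
        ≡⟨ cong₂ _+_ (trans (∑-cong EE λ p → ∑-product E E _ _) (trans (∑-swap EE E _) (∑-cong E λ r → ∑-swap EE E _))) (sym diag) ⟩
      ∑ E (λ r → ∑ E (common r)) + ∑ E (λ r → ∑ E (λ s → ι (r ≟ s)))
        ≡⟨ trans (∑-cong E λ r → ∑-+ E _ _) (∑-+ E _ _) ⟨
      ∑ E (λ r → ∑ E (λ s → common r s + ι (r ≟ s)))
        ≡⟨ ∑-cong E (λ r → ∑-cong E (common-eq r)) ⟩
      ∑ E (λ r → ∑ E (λ s → 1 + q * ι (r ≟ s)))
        ≡⟨ ∑-cong E (λ r → trans (∑-+ E _ _) (cong₂ _+_ (trans (∑-const E 1) (*-identityʳ q)) (trans (∑-*ˡ E q _) (trans (cong (q *_) (one r)) (*-identityʳ q))))) ⟩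
      ∑ E (λ _ → q + q)
        ≡⟨ trans (∑-const E (q + q)) (*-distribˡ-+ q q q) ⟩
      q * q + q * q ∎
      where
      open ≡-Reasoning
      E = elements
      one : ∀ r → ∑ E (λ s → ι (r ≟ s)) ≡ 1
      one r = ∑-ι-one (λ s → r ≟ s) distinct (complete r) refl sym
      diag : ∑ E (λ r → ∑ E (λ s → ι (r ≟ s))) ≡ q
      diag = trans (∑-cong E one) (trans (∑-const E 1) (*-identityʳ q))

    -- Were (a , b) missed, summing the pointwise bounds over all q² pairs would give q² + 3 + 4q²
    -- on the left and at most 3q² + (2q² - q) + q on the right.
    e-surjective : ∀ a b → (∀ r → r ⊗ r ⊗ r ⊕ a ⊗ r ⊕ b ≢ 𝟘) → ∃ λ s → ∃ λ t → a ≡ e₂ s t × b ≡ e₃ s t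
    e-surjective a b none = go (any? (λ x → (a , b) ≟₂ e x) EE)
      where
      open ≤-Reasoning
      p₀ = (a , b)
      go : Dec (Any (λ x → (a , b) ≡ e x) EE) → ∃ λ s → ∃ λ t → a ≡ e₂ s t × b ≡ e₃ s t
      go (yes some) = let (s , t) , _ , eq = find some in s , t , cong proj₁ eq , cong proj₂ eq
      go (no unhit) = contradiction count (m+1+n≰m (5 * (q * q)) {2})
        where
        pointwise : ∀ p → fibre p + 3 * ι (p ≟₂ p₀) + 4 * roots p ≤ 3 + roots p * roots p + ι (proj₂ p ≟ 𝟘)
        pointwise p = ≤-trans (+-monoˡ-≤ (4 * roots p) (fibre-bound p₀ none (λ x h → unhit (lose (EE-complete x) h)) p)) (roots-bound p)
        count : 5 * (q * q) + 3 ≤ 5 * (q * q)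
        count = begin
          5 * (q * q) + 3
            ≡⟨ 5n+3≡n+3+4n (q * q) ⟩
          q * q + 3 * 1 + 4 * (q * q)
            ≡⟨ cong₂ _+_ (cong₂ _+_ ∑-fibre (cong (3 *_) (∑-ι-one (_≟₂ p₀) EE-unique (EE-complete p₀) refl (λ h → h)))) (cong (4 *_) ∑-roots) ⟨
          ∑ EE fibre + 3 * ∑ EE (λ p → ι (p ≟₂ p₀)) + 4 * ∑ EE roots
            ≡⟨ trans (∑-+ EE _ _) (cong₂ _+_ (trans (∑-+ EE _ _) (cong (∑ EE fibre +_) (∑-*ˡ EE 3 _))) (∑-*ˡ EE 4 _)) ⟨
          ∑ EE (λ p → fibre p + 3 * ι (p ≟₂ p₀) + 4 * roots p)
            ≤⟨ ∑-mono EE pointwise ⟩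
          ∑ EE (λ p → 3 + roots p * roots p + ι (proj₂ p ≟ 𝟘))
            ≡⟨ trans (∑-+ EE _ _) (cong₂ _+_ (∑-+ EE _ _) b≡0) ⟩
          ∑ EE (λ _ → 3) + ∑ EE (λ p → roots p * roots p) + q
            ≡⟨ trans (+-assoc (∑ EE (λ _ → 3)) _ _) (cong₂ _+_ (∑EE-const 3) ∑-roots²) ⟩
          q * q * 3 + (q * q + q * q)
            ≡⟨ 3n+2n≡5n (q * q) ⟩
          5 * (q * q) ∎
          where
          b≡0 : ∑ EE (λ p → ι (proj₂ p ≟ 𝟘)) ≡ q
          b≡0 = trans (∑-cartesianProduct elements elements _) (trans
            (∑-cong elements λ a → ∑-ι-one (_≟ 𝟘) distinct (complete 𝟘) refl (λ h → h))
            (trans (∑-const elements 1) (*-identityʳ q)))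

    -- The representative plane

    -- The entries are chosen so that y₀y₄² + y₃y₂², with y₂ = s and y₄ = t, becomes (s + ct)t² + s
    -- · s² = `f s t`.
    canonical : F → F → F → V6 𝔽
    canonical u s t = s ⊕ c ⊗ t ∷ u ∷ s ∷ s ∷ t ∷ 𝟘 ∷ []

    :canonical : ∀ {n} (c u s t : Polynomial n) → Fin 6 → Polynomial n
    :canonical c u s t = lookup (s :+ c :* t ∷ u ∷ s ∷ s ∷ t ∷ :0 ∷ [])

    combination-canonical : ∀ u s t → let b₁ = 𝟙 ∷ 𝟘 ∷ 𝟙 ∷ 𝟙 ∷ 𝟘 ∷ 𝟘 ∷ [] ; b₂ = c ∷ 𝟘 ∷ 𝟘 ∷ 𝟘 ∷ 𝟙 ∷ 𝟘 ∷ [] in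
      u ∙ P +ᵛ (s ∙ b₁ +ᵛ t ∙ b₂) ≡ canonical u s t
    combination-canonical u s t = vec6≡
      (solve 4 (λ c u s t → u :* :0 :+ (s :* :1 :+ t :* c) := s :+ c :* t) refl c u s t)
      (solve 3 (λ u s t → u :* :1 :+ (s :* :0 :+ t :* :0) := u) refl u s t)
      (solve 3 (λ u s t → u :* :0 :+ (s :* :1 :+ t :* :0) := s) refl u s t)
      (solve 3 (λ u s t → u :* :0 :+ (s :* :1 :+ t :* :0) := s) refl u s t)
      (solve 3 (λ u s t → u :* :0 :+ (s :* :0 :+ t :* :1) := t) refl u s t)
      (solve 3 (λ u s t → u :* :0 :+ (s :* :0 :+ t :* :0) := :0) refl u s t)

    W₁₈ : Plane 𝔽
    W₁₈ = record
      { b₀ = P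
      ; b₁ = 𝟙 ∷ 𝟘 ∷ 𝟙 ∷ 𝟙 ∷ 𝟘 ∷ 𝟘 ∷ []
      ; b₂ = c ∷ 𝟘 ∷ 𝟘 ∷ 𝟘 ∷ 𝟙 ∷ 𝟘 ∷ []
      ; independent = λ u s t e → let _ , u≡0 , s≡0 , _ , t≡0 , _ = ∷⁶-injective (trans (sym (combination-canonical u s t)) e) in u≡0 , s≡0 , t≡0
      }

    W₁₈-Good : Good W₁₈
    W₁₈-Good = P , (𝟙 ∷ 𝟘 ∷ 𝟘 ∷ [] , sym (trans (combination-canonical 𝟙 𝟘 𝟘) canon₀))
      , (λ e → 𝟘≢𝟙 (sym (proj₁ (proj₂ (∷⁶-injective e))))) , (refl , refl , refl)
      , λ { y (u ∷ s ∷ t ∷ [] , y≡) d → u , trans y≡ (trans (combination-canonical u s t) (multiple u s t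
            (f-anisotropic (trans (sym (trans (cong detᵥ (trans y≡ (combination-canonical u s t))) (det-canonical u s t))) d)))) }
      where
      canon₀ : ∀ {u} → canonical u 𝟘 𝟘 ≡ (𝟘 ∷ u ∷ 𝟘 ∷ 𝟘 ∷ 𝟘 ∷ 𝟘 ∷ [])
      canon₀ = vec6≡ (solve 1 (λ c → :0 :+ c :* :0 := :0) refl c) refl refl refl refl refl
      det-canonical : ∀ u s t → detᵥ (canonical u s t) ≡ f s t
      det-canonical u s t = solve 4 (λ c u s t → :det (:toMat (:canonical c u s t)) := :f c s t) refl c u s t
      multiple : ∀ u s t → s ≡ 𝟘 × t ≡ 𝟘 → canonical u s t ≡ u ∙ P
      multiple u s t (refl , refl) = trans canon₀ (P-multiple u)

    spanned : (a l b d u s t : F) → V6 𝔽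
    spanned a l b d u s t = a ⊗ s ⊕ b ⊗ t ∷ u ∷ s ∷ l ⊗ s ⊕ d ⊗ t ∷ t ∷ 𝟘 ∷ []

    -- The plane spanned by P, (a, 0, 1, l, 0, 0) and (b, 0, 0, d, 1, 0), where
    -- l s³ + d s²t + a st² + b t³ = l ((s + Dt)³ + e₂ (s + Dt)t² + e₃ t³) with e₂, e₃ evaluated at (S , T).
    module _ (W : Plane 𝔽) (l D S T : F) (l≢0 : l ≢ 𝟘) (φ≢0 : f S T ≢ 𝟘)
      (member : ∀ u s t → spanned (l ⊗ (D ⊗ D ⊕ e₂ S T)) l (l ⊗ (D ⊗ D ⊗ D ⊕ e₂ S T ⊗ D ⊕ e₃ S T)) (l ⊗ D) u s t ∈ᵂ W) where
      private
        -- On (y₂ , y₄) the matrix acts by its upper left block, which is l times the matrix of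
        -- `möbius` for (S , T) followed by the shift s ↦ s + Dt. With this factor, the square of
        -- det A = l²φ equals l · l³ · φ², the scaling of the form given by `möbius`.
        A : Mat 𝔽
        A = matrix (l ⊗ (S ⊗ S ⊕ T ⊗ T ⊕ D ⊗ T)) (l ⊗ (c ⊗ T ⊗ T ⊕ D ⊗ S)) 𝟘 (l ⊗ T) (l ⊗ S) 𝟘 𝟘 𝟘 𝟙

        :A : ∀ {n} (c l D S T : Polynomial n) → PMat n
        :A c l D S T = :matrix (l :* (S :* S :+ T :* T :+ D :* T)) (l :* (c :* T :* T :+ D :* S)) :0 (l :* T) (l :* S) :0 :0 :0 :1

        det-A : det 𝔽 A ≡ l ⊗ l ⊗ f S T
        det-A = solve 5 (λ c l D S T → :det (:A c l D S T) := l :* l :* :f c S T) refl c l D S T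

        into : ∀ u s t → act 𝔽 A (canonical u s t) ∈ᵂ W
        into u s t = subst (_∈ᵂ W) (sym (vec6≡
            (solve 8 (λ c l D S T u s t → :act (:A c l D S T) (:canonical c u s t) 0F :=
                l :* (D :* D :+ :e₂ c S T) :* :act (:A c l D S T) (:canonical c u s t) 2F
                  :+ l :* (D :* D :* D :+ :e₂ c S T :* D :+ :e₃ c S T) :* :act (:A c l D S T) (:canonical c u s t) 4F)
              refl c l D S T u s t)
            refl refl
            (solve 8 (λ c l D S T u s t → :act (:A c l D S T) (:canonical c u s t) 3F :=
                l :* :act (:A c l D S T) (:canonical c u s t) 2F :+ l :* D :* :act (:A c l D S T) (:canonical c u s t) 4F)
              refl c l D S T u s t)
            refl
            (solve 8 (λ c l D S T u s t → :act (:A c l D S T) (:canonical c u s t) 5F := :0) refl c l D S T u s t)))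
          (member (lookup y 1F) (lookup y 2F) (lookup y 4F))
          where
          y = act 𝔽 A (canonical u s t)

      KEquiv-explicit : KEquiv 𝔽 W₁₈ W
      KEquiv-explicit = KEquiv-into W₁₈ W A (λ e → ⊗-nonzero (⊗-nonzero l≢0 l≢0) φ≢0 (trans (sym det-A) e))
        λ { y (u ∷ s ∷ t ∷ [] , y≡) → subst (λ y → act 𝔽 A y ∈ᵂ W) (sym (trans y≡ (combination-canonical u s t))) (into u s t) }

    -- Reduction of a plane through `P` to the representative

    module _ (W : Plane 𝔽) (P∈W : P ∈ᵂ W) (singular : ∀ y → y ∈ᵂ W → detᵥ y ≡ 𝟘 → ∃ λ k → y ≡ k ∙ P) where
      private
        -- det (y + tP) = det y + t² y₅, and every element is a square.
        y₅≡0 : ∀ {y₀ y₁ y₂ y₃ y₄ y₅} → (y₀ ∷ y₁ ∷ y₂ ∷ y₃ ∷ y₄ ∷ y₅ ∷ []) ∈ᵂ W → y₅ ≡ 𝟘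
        y₅≡0 {y₀} {y₁} {y₂} {y₃} {y₄} {y₅} y∈ = decidable-stable (y₅ ≟ 𝟘) λ y₅≢0 →
          let i = y₅ ⁻¹[ y₅≢0 ]
              r , r² = √ (detᵥ y ⊗ i)
              k , eq = singular (y +ᵛ r ∙ P) (∈W-+ W y∈ (∈W-∙ W r P∈W)) (trans (det-shift r) (x≡y⇒x⊕y≡0 (sym (trans (cong (_⊗ y₅) r²)
                (trans (solve 3 (λ d i y → d :* i :* y := d :* (y :* i)) refl (detᵥ y) i y₅) (trans (cong (detᵥ y ⊗_) (inverseʳ y₅≢0)) (R.*-identityʳ _)))))))
              _ , _ , _ , _ , _ , e₅ = ∷⁶-injective eq
          in y₅≢0 (trans (solve 2 (λ y r → y := y :+ r :* :0) refl y₅ r) (trans e₅ (R.zeroʳ k)))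
          where
          y = y₀ ∷ y₁ ∷ y₂ ∷ y₃ ∷ y₄ ∷ y₅ ∷ []
          det-shift : ∀ r → detᵥ (y +ᵛ r ∙ P) ≡ detᵥ y ⊕ r ⊗ r ⊗ y₅
          det-shift r = solve 7 (λ y₀ y₁ y₂ y₃ y₄ y₅ r →
            :det (:toMat (lookup (y₀ :+ r :* :0 ∷ y₁ :+ r :* :1 ∷ y₂ :+ r :* :0 ∷ y₃ :+ r :* :0 ∷ y₄ :+ r :* :0 ∷ y₅ :+ r :* :0 ∷ [])))
              := :det (:toMat (lookup (y₀ ∷ y₁ ∷ y₂ ∷ y₃ ∷ y₄ ∷ y₅ ∷ []))) :+ r :* r :* y₅) refl y₀ y₁ y₂ y₃ y₄ y₅ r

        π : V6 𝔽 → Vec F 3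
        π (_ ∷ y₁ ∷ y₂ ∷ _ ∷ y₄ ∷ _ ∷ []) = y₁ ∷ y₂ ∷ y₄ ∷ []

        π-+ : ∀ y z → π (y +ᵛ z) ≡ π y +ᵛ π z
        π-+ (_ ∷ _ ∷ _ ∷ _ ∷ _ ∷ _ ∷ []) (_ ∷ _ ∷ _ ∷ _ ∷ _ ∷ _ ∷ []) = refl

        -- What remains is diag(y₀ , y₃ , 0), which is singular and so a multiple of `P`, hence
        -- zero. Thus y₁, y₂, y₄ are coordinates on W, and vectors of W with prescribed values of
        -- them exist.
        π≡0⇒≡0 : ∀ y → y ∈ᵂ W → π y ≡ 0ᵥ → y ≡ 0ᵥ
        π≡0⇒≡0 (y₀ ∷ _ ∷ _ ∷ y₃ ∷ _ ∷ y₅ ∷ []) y∈ refl =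
          let k , eq = singular _ y∈ (trans (cong (λ y₅ → detᵥ (y₀ ∷ 𝟘 ∷ 𝟘 ∷ y₃ ∷ 𝟘 ∷ y₅ ∷ [])) (y₅≡0 y∈))
                (solve 2 (λ y₀ y₃ → :det (:toMat (lookup (y₀ ∷ :0 ∷ :0 ∷ y₃ ∷ :0 ∷ :0 ∷ []))) := :0) refl y₀ y₃))
              e₀ , e₁ , _ , e₃ , _ = ∷⁶-injective eq
          in vec6≡ (trans e₀ (R.zeroʳ k)) refl refl (trans e₃ (R.zeroʳ k)) refl (y₅≡0 y∈)

        g : Vec F 3 → Vec F 3
        g x = π (pt 𝔽 W x)

        g-injective : ∀ {x x′} → g x ≡ g x′ → x ≡ x′
        g-injective {x} {x′} e = +ᵛ≡0⇒≡ x x′ (pt≡0⇒≡0 W (x +ᵛ x′) (π≡0⇒≡0 _ (x +ᵛ x′ , refl)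
          (trans (cong π (pt-+ W x x′)) (trans (π-+ (pt 𝔽 W x) (pt 𝔽 W x′)) (trans (cong (_+ᵛ g x′) e) (+ᵛ-self (g x′)))))))

        lift : ∀ v → ∃ λ y → y ∈ᵂ W × π y ≡ v
        lift v = let x , gx≡v = injective⇒surjective₃ g-injective v in pt 𝔽 W x , (x , refl) , gx≡v

        lift′ : ∀ y₁ y₂ y₄ → ∃ λ y₀ → ∃ λ y₃ → (y₀ ∷ y₁ ∷ y₂ ∷ y₃ ∷ y₄ ∷ 𝟘 ∷ []) ∈ᵂ W
        lift′ y₁ y₂ y₄ = go (lift (y₁ ∷ y₂ ∷ y₄ ∷ []))
          where
          go : (∃ λ y → y ∈ᵂ W × π y ≡ (y₁ ∷ y₂ ∷ y₄ ∷ [])) → ∃ λ y₀ → ∃ λ y₃ → (y₀ ∷ y₁ ∷ y₂ ∷ y₃ ∷ y₄ ∷ 𝟘 ∷ []) ∈ᵂ W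
          go ((y₀ ∷ _ ∷ _ ∷ y₃ ∷ _ ∷ _ ∷ []) , y∈ , refl) = y₀ , y₃ , subst (λ y₅ → (y₀ ∷ y₁ ∷ y₂ ∷ y₃ ∷ y₄ ∷ y₅ ∷ []) ∈ᵂ W) (y₅≡0 y∈) y∈

        module _ {a l b d : F} (M₁∈ : (a ∷ 𝟘 ∷ 𝟙 ∷ l ∷ 𝟘 ∷ 𝟘 ∷ []) ∈ᵂ W) (M₂∈ : (b ∷ 𝟘 ∷ 𝟘 ∷ d ∷ 𝟙 ∷ 𝟘 ∷ []) ∈ᵂ W) where

          span : ∀ u s t → spanned a l b d u s t ∈ᵂ W
          span u s t = subst (_∈ᵂ W) (vec6≡
              (solve 5 (λ a b u s t → u :* :0 :+ (s :* a :+ t :* b) := a :* s :+ b :* t) refl a b u s t)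
              (solve 3 (λ u s t → u :* :1 :+ (s :* :0 :+ t :* :0) := u) refl u s t)
              (solve 3 (λ u s t → u :* :0 :+ (s :* :1 :+ t :* :0) := s) refl u s t)
              (solve 5 (λ a b u s t → u :* :0 :+ (s :* a :+ t :* b) := a :* s :+ b :* t) refl l d u s t)
              (solve 3 (λ u s t → u :* :0 :+ (s :* :0 :+ t :* :1) := t) refl u s t)
              (solve 3 (λ u s t → u :* :0 :+ (s :* :0 :+ t :* :0) := :0) refl u s t))
            (∈W-+ W (∈W-∙ W u P∈W) (∈W-+ W (∈W-∙ W s M₁∈) (∈W-∙ W t M₂∈)))

          -- The form is the determinant of the spanned vector with u = 0. A zero makes this vector
          -- a multiple of `P`, whose coordinates y₂ and y₄ vanish.
          anisotropic : ∀ s t → (a ⊗ s ⊕ b ⊗ t) ⊗ t ⊗ t ⊕ (l ⊗ s ⊕ d ⊗ t) ⊗ s ⊗ s ≡ 𝟘 → s ≡ 𝟘 × t ≡ 𝟘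
          anisotropic s t e =
            let k , eq = singular _ (span 𝟘 s t) (trans
                  (solve 4 (λ x y s t → :det (:toMat (lookup (x ∷ :0 ∷ s ∷ y ∷ t ∷ :0 ∷ []))) := x :* t :* t :+ y :* s :* s)
                    refl (a ⊗ s ⊕ b ⊗ t) (l ⊗ s ⊕ d ⊗ t) s t) e)
                _ , _ , e₂ , _ , e₄ , _ = ∷⁶-injective eq
            in trans e₂ (R.zeroʳ k) , trans e₄ (R.zeroʳ k)

          l≢0 : l ≢ 𝟘
          l≢0 l≡0 = 𝟘≢𝟙 (sym (proj₁ (anisotropic 𝟙 𝟘 (trans
            (solve 4 (λ a b l d → (a :* :1 :+ b :* :0) :* :0 :* :0 :+ (l :* :1 :+ d :* :0) :* :1 :* :1 := l) refl a b l d) l≡0))))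

          -- Dividing the form by l and substituting s = r + Dt removes the quadratic term, since 3D
          -- = D in characteristic 2; a′ and b′ are the coefficients of the resulting r³ + a′rt² +
          -- b′t³.
          i D a′ b′ : F
          i = l ⁻¹[ l≢0 ]
          D = d ⊗ i
          a′ = a ⊗ i ⊕ D ⊗ D
          b′ = b ⊗ i ⊕ D ⊗ D ⊗ D ⊕ a′ ⊗ D

          cancel : ∀ x → l ⊗ (x ⊗ i) ≡ x
          cancel x = trans (solve 3 (λ l x i → l :* (x :* i) := x :* (l :* i)) refl l x i) (trans (cong (x ⊗_) (inverseʳ l≢0)) (R.*-identityʳ x))

          a≡ : l ⊗ (D ⊗ D ⊕ a′) ≡ a
          a≡ = trans (cong (l ⊗_) (solve 2 (λ x D → D :* D :+ (x :+ D :* D) := x) refl (a ⊗ i) D)) (cancel a)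

          b≡ : l ⊗ (D ⊗ D ⊗ D ⊕ a′ ⊗ D ⊕ b′) ≡ b
          b≡ = trans (cong (l ⊗_) (solve 3 (λ x D z → D :* D :* D :+ z :* D :+ (x :+ D :* D :* D :+ z :* D) := x) refl (b ⊗ i) D a′)) (cancel b)

          -- A root r gives the zero (r + D , 1) of the form.
          rootfree : ∀ r → r ⊗ r ⊗ r ⊕ a′ ⊗ r ⊕ b′ ≢ 𝟘
          rootfree r root = 𝟘≢𝟙 (sym (proj₂ (anisotropic (r ⊕ D) 𝟙 (trans
            (cong₂ (λ a b → (a ⊗ (r ⊕ D) ⊕ b ⊗ 𝟙) ⊗ 𝟙 ⊗ 𝟙 ⊕ (l ⊗ (r ⊕ D) ⊕ d ⊗ 𝟙) ⊗ (r ⊕ D) ⊗ (r ⊕ D)) (sym a≡) (sym b≡)) (trans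
            (cong (λ d → (l ⊗ (D ⊗ D ⊕ a′) ⊗ (r ⊕ D) ⊕ l ⊗ (D ⊗ D ⊗ D ⊕ a′ ⊗ D ⊕ b′) ⊗ 𝟙) ⊗ 𝟙 ⊗ 𝟙 ⊕ (l ⊗ (r ⊕ D) ⊕ d ⊗ 𝟙) ⊗ (r ⊕ D) ⊗ (r ⊕ D)) (sym (cancel d))) (trans
            (solve 5 (λ l D a b r → (l :* (D :* D :+ a) :* (r :+ D) :+ l :* (D :* D :* D :+ a :* D :+ b) :* :1) :* :1 :* :1
                :+ (l :* (r :+ D) :+ l :* D :* :1) :* (r :+ D) :* (r :+ D) := l :* (r :* r :* r :+ a :* r :+ b)) refl l D a′ b′ r)
            (x⊗0 root)))))))

          KEquiv-P : KEquiv 𝔽 W₁₈ W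
          KEquiv-P = go (e-surjective a′ b′ rootfree)
            where
            go : (∃ λ S → ∃ λ T → a′ ≡ e₂ S T × b′ ≡ e₃ S T) → KEquiv 𝔽 W₁₈ W
            go (S , T , a′≡ , b′≡) = KEquiv-explicit W l D S T l≢0 φ≢0 λ u s t → subst (_∈ᵂ W)
                (vec6≡ (cong₂ (λ a b → a ⊗ s ⊕ b ⊗ t)
                         (trans (sym a≡) (cong (λ a′ → l ⊗ (D ⊗ D ⊕ a′)) a′≡))
                         (trans (sym b≡) (cong₂ (λ a′ b′ → l ⊗ (D ⊗ D ⊗ D ⊕ a′ ⊗ D ⊕ b′)) a′≡ b′≡)))
                  refl refl (cong (λ d → l ⊗ s ⊕ d ⊗ t) (sym (cancel d))) refl refl)
                (span u s t)
              where
              φ≢0 : f S T ≢ 𝟘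
              -- If φ vanished, so would b′ = cφ, and 0 would be a root.
              φ≢0 φ≡0 = rootfree 𝟘 (trans (solve 2 (λ a b → :0 :* :0 :* :0 :+ a :* :0 :+ b := b) refl a′ b′) (trans b′≡ (x⊗0 φ≡0)))

      KEquiv-through-P : KEquiv 𝔽 W₁₈ W
      KEquiv-through-P = let a , l , M₁∈ = lift′ 𝟘 𝟙 𝟘 ; b , d , M₂∈ = lift′ 𝟘 𝟘 𝟙 in KEquiv-P M₁∈ M₂∈

    Good⇒KEquiv : ∀ W → Good W → KEquiv 𝔽 W₁₈ W
    Good⇒KEquiv W (y₀ , y₀∈ , y₀≢0 , nuc , singular) = go (nucleus-transitive y₀ nuc y₀≢0)
      where
      go : (∃ λ A → det 𝔽 A ≢ 𝟘 × act 𝔽 A P ≡ y₀) → KEquiv 𝔽 W₁₈ W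
      go (A , d , AP≡y₀) = KEquiv-trans {W₁₈} {W′} {W} (KEquiv-through-P W′ (subst (_∈ᵂ W′) A′y₀≡P (into y₀ y₀∈)) singular′) (KEquiv-sym {W} {W′} equiv)
        where
        A′ = inv A d
        W′ = image A′ (det-inv A d) W
        equiv : KEquiv 𝔽 W W′
        equiv = KEquiv-image A′ (det-inv A d) W
        into = proj₁ (proj₂ (proj₂ equiv))
        A′y₀≡P : act 𝔽 A′ y₀ ≡ P
        A′y₀≡P = trans (cong (act 𝔽 A′) (sym AP≡y₀)) (act-invˡ A d P)
        singular′ : ∀ y → y ∈ᵂ W′ → detᵥ y ≡ 𝟘 → ∃ λ k → y ≡ k ∙ P
        singular′ y y∈ e = let _ , _ , _ , _ , uniq = Good-KEquiv {W} {W′} equiv (y₀ , y₀∈ , y₀≢0 , nuc , singular)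
                               k , y≡ = uniq y y∈ e in k , trans y≡ (cong (k ∙_) A′y₀≡P)

    -- Hyperplanes

    h : Vec F 3 → V6 𝔽
    h (α ∷ β ∷ γ ∷ []) = α ∷ 𝟘 ∷ α ⊕ β ∷ β ∷ c ⊗ α ∷ γ ∷ []

    :h : ∀ {n} (c α β γ : Polynomial n) → Fin 6 → Polynomial n
    :h c α β γ = lookup (α ∷ :0 ∷ α :+ β ∷ β ∷ c :* α ∷ γ ∷ [])

    h-∙ : ∀ k v → h (k ∙ v) ≡ k ∙ h v
    h-∙ k (α ∷ β ∷ γ ∷ []) = vec6≡ refl (sym (R.zeroʳ k)) (sym (R.distribˡ k α β)) refl
      (solve 3 (λ c k α → c :* (k :* α) := k :* (c :* α)) refl c k α) refl

    h-injective : ∀ {v w} → h v ≡ h w → v ≡ w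
    h-injective {_ ∷ _ ∷ _ ∷ []} {_ ∷ _ ∷ _ ∷ []} e = let α , _ , _ , β , _ , γ = ∷⁶-injective e in vec3≡ α β γ

    h-contains : ∀ v → ContainsPlane 𝔽 (h v) W₁₈
    h-contains (α ∷ β ∷ γ ∷ []) = p₀ , p₁ , p₂
      where
      p₀ = solve 4 (λ c α β γ → :dot (:h c α β γ) (lookup (:0 ∷ :1 ∷ :0 ∷ :0 ∷ :0 ∷ :0 ∷ [])) := :0) refl c α β γ
      p₁ = solve 4 (λ c α β γ → :dot (:h c α β γ) (lookup (:1 ∷ :0 ∷ :1 ∷ :1 ∷ :0 ∷ :0 ∷ [])) := :0) refl c α β γ
      p₂ = solve 4 (λ c α β γ → :dot (:h c α β γ) (lookup (c ∷ :0 ∷ :0 ∷ :0 ∷ :1 ∷ :0 ∷ [])) := :0) refl c α β γ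

    contains⇒h : ∀ a → ContainsPlane 𝔽 a W₁₈ → ∃ λ v → a ≡ h v
    contains⇒h (a₀ ∷ a₁ ∷ a₂ ∷ a₃ ∷ a₄ ∷ a₅ ∷ []) (d₀ , d₁ , d₂) = a₀ ∷ a₃ ∷ a₅ ∷ [] , vec6≡ refl a₁≡ a₂≡ refl a₄≡ refl
      where
      a₁≡ : a₁ ≡ 𝟘
      a₁≡ = trans (solve 6 (λ a₀ a₁ a₂ a₃ a₄ a₅ → a₁ := :dot (lookup (a₀ ∷ a₁ ∷ a₂ ∷ a₃ ∷ a₄ ∷ a₅ ∷ [])) (lookup (:0 ∷ :1 ∷ :0 ∷ :0 ∷ :0 ∷ :0 ∷ []))) refl a₀ a₁ a₂ a₃ a₄ a₅) d₀
      a₂≡ : a₂ ≡ a₀ ⊕ a₃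
      a₂≡ = x⊕y≡0⇒x≡y (trans (solve 6 (λ a₀ a₁ a₂ a₃ a₄ a₅ → a₂ :+ (a₀ :+ a₃) := :dot (lookup (a₀ ∷ a₁ ∷ a₂ ∷ a₃ ∷ a₄ ∷ a₅ ∷ [])) (lookup (:1 ∷ :0 ∷ :1 ∷ :1 ∷ :0 ∷ :0 ∷ []))) refl a₀ a₁ a₂ a₃ a₄ a₅) d₁)
      a₄≡ : a₄ ≡ c ⊗ a₀
      a₄≡ = x⊕y≡0⇒x≡y (trans (solve 7 (λ c a₀ a₁ a₂ a₃ a₄ a₅ → a₄ :+ c :* a₀ := :dot (lookup (a₀ ∷ a₁ ∷ a₂ ∷ a₃ ∷ a₄ ∷ a₅ ∷ [])) (lookup (c ∷ :0 ∷ :0 ∷ :0 ∷ :1 ∷ :0 ∷ []))) refl c a₀ a₁ a₂ a₃ a₄ a₅) d₂)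

    Double Conic : Vec F 3 → Set
    Double (α ∷ β ∷ γ ∷ []) = (α ≡ 𝟘 × β ≡ 𝟘) × γ ≢ 𝟘
    Conic (α ∷ β ∷ γ ∷ []) = ¬ (α ≡ 𝟘 × β ≡ 𝟘)

    Double⊎Conic : ∀ v → v ≢ 0ᵥ → Double v ⊎ Conic v
    Double⊎Conic (α ∷ β ∷ γ ∷ []) v≢0 with (α ≟ 𝟘) ×-dec (β ≟ 𝟘)
    ... | yes (refl , refl) = inj₁ ((refl , refl) , λ { refl → v≢0 refl })
    ... | no ¬0 = inj₂ ¬0

    Double⇒H₁ : ∀ v → Double v → H₁ 𝔽 (h v)
    Double⇒H₁ (_ ∷ _ ∷ γ ∷ []) ((refl , refl) , γ≢0) = B , (λ e → 𝟘≢𝟙 (sym (trans (sym det-B) e))) , γ , γ≢0 , λ { (x₀ ∷ x₁ ∷ x₂ ∷ []) →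
        solve 5 (λ c γ x₀ x₁ x₂ → let x = lookup (x₀ ∷ x₁ ∷ x₂ ∷ []) in
          :conic (:h c :0 :0 γ) x := γ :* (:matVec :B x 0F :* :matVec :B x 0F)) refl c γ x₀ x₁ x₂ }
      where
      -- The conic is γx₂², so interchanging x₀ and x₂ brings it to the standard double line.
      B = matrix 𝟘 𝟘 𝟙 𝟘 𝟙 𝟘 𝟙 𝟘 𝟘
      :B : ∀ {n} → PMat n
      :B = :matrix :0 :0 :1 :0 :1 :0 :1 :0 :0
      det-B : det 𝔽 B ≡ 𝟙
      det-B = solve 0 (:det :B := :1) refl

    -- With α = a², β = b², γ = g², the conic is (ax₀ + bx₁ + gx₂)² + ((α + β)x₀ + cαx₁)x₂.
    Conic⇒H₃ : ∀ v → Conic v → H₃ 𝔽 (h v)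
    Conic⇒H₃ (α ∷ β ∷ γ ∷ []) ¬0 = go (√ α) (√ β) (√ γ)
      where
      go : (∃ λ a → a ⊗ a ≡ α) → (∃ λ b → b ⊗ b ≡ β) → (∃ λ g → g ⊗ g ≡ γ) → H₃ 𝔽 (h (α ∷ β ∷ γ ∷ []))
      go (a , refl) (b , refl) (g , refl) = B , det-B≢0 , 𝟙 , (λ e → 𝟘≢𝟙 (sym e)) , λ { (x₀ ∷ x₁ ∷ x₂ ∷ []) →
          solve 7 (λ c a b g x₀ x₁ x₂ → let x = lookup (x₀ ∷ x₁ ∷ x₂ ∷ []) ; y = :matVec (:B c a b g) x in
            :conic (:h c (a :* a) (b :* b) (g :* g)) x := :1 :* (y 0F :* y 2F :+ y 1F :* y 1F)) refl c a b g x₀ x₁ x₂ }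
        where
        B = matrix (a ⊗ a ⊕ b ⊗ b) (c ⊗ (a ⊗ a)) 𝟘 a b g 𝟘 𝟘 𝟙
        :B : ∀ {n} (c a b g : Polynomial n) → PMat n
        :B c a b g = :matrix (a :* a :+ b :* b) (c :* (a :* a)) :0 a b g :0 :0 :1
        det-B : det 𝔽 B ≡ f b a
        det-B = solve 4 (λ c a b g → :det (:B c a b g) := :f c b a) refl c a b g
        det-B≢0 : det 𝔽 B ≢ 𝟘
        det-B≢0 e = let b≡0 , a≡0 = f-anisotropic (trans (sym det-B) e) in ¬0 (x⊗0 a≡0 , x⊗0 b≡0)

    -- Hyperplanes through an arbitrary plane of the orbit

    module _ (W : Plane 𝔽) (A A′ : Mat 𝔽) (d′ : det 𝔽 A′ ≢ 𝟘)
      (A′A≡id : ∀ y → act 𝔽 A′ (act 𝔽 A y) ≡ y) (AA′≡id : ∀ y → act 𝔽 A (act 𝔽 A′ y) ≡ y)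
      (into : ∀ y → y ∈ᵂ W₁₈ → act 𝔽 A y ∈ᵂ W) (onto : ∀ y′ → y′ ∈ᵂ W → ∃ λ y → y ∈ᵂ W₁₈ × act 𝔽 A y ≡ y′) where
      private
        -- W is the image of `W₁₈` under A, so the hyperplanes through W are those through `W₁₈`
        -- pulled back along the inverse action.
        L : Vec F 3 → V6 𝔽
        L v = dual A′ (h v)

        L-∙ : ∀ k v → L (k ∙ v) ≡ k ∙ L v
        L-∙ k v = trans (cong (dual A′) (h-∙ k v)) (dual-*ᵥ A′ k (h v))

        L-injective : ∀ {v w} → L v ≡ L w → v ≡ w
        L-injective {v} {w} e = h-injective (trans (sym (cancel v)) (trans (cong (dual A) e) (cancel w)))
          where
          cancel : ∀ v → dual A (L v) ≡ h v
          cancel v = dual-cancel A′ A A′A≡id (h v)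

        L-contains : ∀ v → ContainsPlane 𝔽 (L v) W
        L-contains v = ⇒ContainsPlane W {L v} λ y′ y′∈ → let y , y∈ , Ay≡y′ = onto y′ y′∈ in
          trans (dot-dual A′ (h v) y′) (trans (cong (dot 𝔽 (h v)) (trans (cong (act 𝔽 A′) (sym Ay≡y′)) (A′A≡id y)))
            (ContainsPlane⇒ W₁₈ {h v} (h-contains v) y y∈))

        contains⇒L : ∀ {a} → ContainsPlane 𝔽 a W → ∃ λ v → a ≡ L v
        contains⇒L {a} W⊆a = let v , e = contains⇒h (dual A a) (⇒ContainsPlane W₁₈ {dual A a} λ y y∈ →
                                   trans (dot-dual A a y) (ContainsPlane⇒ W {a} W⊆a (act 𝔽 A y) (into y y∈)))
                             in v , trans (sym (dual-cancel A A′ AA′≡id a)) (cong (dual A′) e)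

        L≢0⇒ : ∀ {v} → L v ≢ 0ᵥ → v ≢ 0ᵥ
        L≢0⇒ {v} Lv≢0 refl = Lv≢0 (trans (cong L (sym (𝟘∙ 0ᵥ))) (trans (L-∙ 𝟘 0ᵥ) (𝟘∙ (L 0ᵥ))))

        L-H₁ : ∀ v → Double v → H₁ 𝔽 (L v)
        L-H₁ v dv = InOrbitOf-dual {doubleLine 𝔽} {h v} A′ d′ (Double⇒H₁ v dv)

        L-H₃ : ∀ v → Conic v → H₃ 𝔽 (L v)
        L-H₃ v cv = InOrbitOf-dual {nonSingular 𝔽} {h v} A′ d′ (Conic⇒H₃ v cv)

        classify : ∀ a → N a → ContainsPlane 𝔽 a W → ∃ λ v → a ≡ L v × (Double v ⊎ Conic v)
        classify a na W⊆a = let v , a≡ = contains⇒L {a} W⊆a in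
          v , a≡ , Double⊎Conic v (L≢0⇒ (λ e → N⇒≢0 na (trans a≡ e)))

        H₁⊎H₃ : ∀ a → N a → ContainsPlane 𝔽 a W → H₁ 𝔽 a ⊎ H₃ 𝔽 a
        H₁⊎H₃ a na W⊆a = go (classify a na W⊆a)
          where
          go : (∃ λ v → a ≡ L v × (Double v ⊎ Conic v)) → H₁ 𝔽 a ⊎ H₃ 𝔽 a
          go (v , a≡ , inj₁ dv) = inj₁ (subst (H₁ 𝔽) (sym a≡) (L-H₁ v dv))
          go (v , a≡ , inj₂ cv) = inj₂ (subst (H₃ 𝔽) (sym a≡) (L-H₃ v cv))

        -- Every hyperplane through W lies in `H₁` or `H₃`; a representative that is not additive
        -- excludes the former, and one with a vertex excludes the latter.
        none : ∀ {rep} → Singular rep → ¬ Additive rep → ∀ a → N a → ¬ (ContainsPlane 𝔽 a W × InOrbitOf 𝔽 rep (conic 𝔽 a))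
        none {rep} sing ¬add a na (W⊆a , o) = go (H₁⊎H₃ a na W⊆a)
          where
          go : ¬ (H₁ 𝔽 a ⊎ H₃ 𝔽 a)
          go (inj₁ h₁) = ¬H₁ {rep} {a} ¬add o h₁
          go (inj₂ h₃) = ¬H₃ {rep} {a} sing o h₃

        Double-∙ : ∀ {k v} → k ≢ 𝟘 → Double v → Double (k ∙ v)
        Double-∙ {k} {α ∷ β ∷ γ ∷ []} k≢0 ((α≡0 , β≡0) , γ≢0) = (x⊗0 α≡0 , x⊗0 β≡0) , ⊗-nonzero k≢0 γ≢0

        Conic-∙ : ∀ {k v} → k ≢ 𝟘 → Conic v → Conic (k ∙ v)
        Conic-∙ {k} {α ∷ β ∷ γ ∷ []} k≢0 ¬0 (α≡0 , β≡0) = ¬0 (cancelˡ k≢0 α≡0 , cancelˡ k≢0 β≡0)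

        N-e³ : N e³
        N-e³ = inj₂ (refl , inj₂ (refl , inj₁ refl))

        N-Double : ∀ v → N v → Double v → v ≡ e³
        N-Double (_ ∷ _ ∷ _ ∷ []) (inj₁ refl) ((1≡0 , _) , _) = contradiction (sym 1≡0) 𝟘≢𝟙
        N-Double (_ ∷ _ ∷ _ ∷ []) (inj₂ (_ , inj₁ refl)) ((_ , 1≡0) , _) = contradiction (sym 1≡0) 𝟘≢𝟙
        N-Double (_ ∷ _ ∷ _ ∷ []) (inj₂ (refl , inj₂ (refl , inj₁ refl))) _ = refl

        Double-count : HasCount 𝔽 Double 1
        Double-count = HasCount-one N-e³ ((refl , refl) , λ e → 𝟘≢𝟙 (sym e)) N-Double

        Conic-count : HasCount 𝔽 Conic order²
        Conic-count = HasCount-cong (λ v nv → mk⇔ (≢e³⇒Conic v nv) (λ { cv refl → cv (refl , refl) })) (HasCount-others N-e³)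
          where
          ≢e³⇒Conic : ∀ v → N v → v ≢ e³ → Conic v
          ≢e³⇒Conic v nv v≢e³ with Double⊎Conic v (N⇒≢0 nv)
          ... | inj₁ dv = contradiction (N-Double v nv dv) v≢e³
          ... | inj₂ cv = cv

        count₁ : HasCount 𝔽 (λ a → ContainsPlane 𝔽 a W × H₁ 𝔽 a) 1
        count₁ = HasCount-map {L = L} L-∙ L-injective {P = Double} {Q = λ a → ContainsPlane 𝔽 a W × H₁ 𝔽 a} (λ {k} {v} → Double-∙ {k} {v})
          (λ {k} {a} k≢0 (W⊆a , h₁) → ContainsPlane-∙ W {k} {a} W⊆a , InOrbitOf-∙ {doubleLine 𝔽} {k} {a} k≢0 h₁)
          (λ v dv → L-contains v , L-H₁ v dv)
          (λ a na (W⊆a , h₁) → back a h₁ (classify a na W⊆a)) Double-count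
          where
          back : ∀ a → H₁ 𝔽 a → (∃ λ v → a ≡ L v × (Double v ⊎ Conic v)) → ∃ λ v → a ≡ L v × Double v
          back a h₁ (v , a≡ , inj₁ dv) = v , a≡ , dv
          back a h₁ (v , a≡ , inj₂ cv) = contradiction (subst (H₃ 𝔽) (sym a≡) (L-H₃ v cv)) (¬H₃ {doubleLine 𝔽} {a} doubleLine-Singular h₁)

        count₃ : HasCount 𝔽 (λ a → ContainsPlane 𝔽 a W × H₃ 𝔽 a) order²
        count₃ = HasCount-map {L = L} L-∙ L-injective {P = Conic} {Q = λ a → ContainsPlane 𝔽 a W × H₃ 𝔽 a} (λ {k} {v} → Conic-∙ {k} {v})
          (λ {k} {a} k≢0 (W⊆a , h₃) → ContainsPlane-∙ W {k} {a} W⊆a , InOrbitOf-∙ {nonSingular 𝔽} {k} {a} k≢0 h₃)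
          (λ v cv → L-contains v , L-H₃ v cv)
          (λ a na (W⊆a , h₃) → back a h₃ (classify a na W⊆a)) Conic-count
          where
          back : ∀ a → H₃ 𝔽 a → (∃ λ v → a ≡ L v × (Double v ⊎ Conic v)) → ∃ λ v → a ≡ L v × Conic v
          back a h₃ (v , a≡ , inj₁ dv) = contradiction h₃ (¬H₃ {doubleLine 𝔽} {a} doubleLine-Singular (subst (H₁ 𝔽) (sym a≡) (L-H₁ v dv)))
          back a h₃ (v , a≡ , inj₂ cv) = v , a≡ , cv

      HypDist₁₈ : HypDist 𝔽 W 1 0 0 order²
      HypDist₁₈ = count₁ , HasCount-none (none {realPair 𝔽} realPair-Singular realPair-¬Additive)
        , HasCount-none (λ { a na (W⊆a , l , _ , o) → none {imagPair 𝔽 l} (imagPair-Singular l) (imagPair-¬Additive l) a na (W⊆a , o) })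
        , count₃

    KEquiv⇒HypDist : ∀ W → KEquiv 𝔽 W₁₈ W → HypDist 𝔽 W 1 0 0 order²
    KEquiv⇒HypDist W (A , d , into , onto) = HypDist₁₈ W A (inv A d) (det-inv A d) (act-invˡ A d) (act-invʳ A d) into onto

theorem3p9 : (𝔽 : FiniteField) → 2 ∣ order 𝔽 → 4 ≤ order 𝔽 →
    (∃ λ (W : Plane 𝔽) →
    PointDist 𝔽 W 0 1 0 (order 𝔽 * order 𝔽 + order 𝔽))
    × (∀ W W' → PointDist 𝔽 W 0 1 0 (order 𝔽 * order 𝔽 + order 𝔽)
    → PointDist 𝔽 W' 0 1 0 (order 𝔽 * order 𝔽 + order 𝔽)
    → KEquiv 𝔽 W W')
    × (∀ W W' → PointDist 𝔽 W 0 1 0 (order 𝔽 * order 𝔽 + order 𝔽)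
    → KEquiv 𝔽 W W'
    → PointDist 𝔽 W' 0 1 0 (order 𝔽 * order 𝔽 + order 𝔽))
    × (∀ W → PointDist 𝔽 W 0 1 0 (order 𝔽 * order 𝔽 + order 𝔽)
    → HypDist 𝔽 W 1 0 0 (order 𝔽 * order 𝔽 + order 𝔽))
theorem3p9 𝔽 even _ =
    (W₁₈ , Good⇒PointDist W₁₈ W₁₈-Good)
  , (λ W W' dist dist' → KEquiv-trans {W} {W₁₈} {W'} (KEquiv-sym {W₁₈} {W} (from-W₁₈ W dist)) (from-W₁₈ W' dist'))
  , (λ W W' dist W~W' → Good⇒PointDist W' (Good-KEquiv {W} {W'} W~W' (PointDist⇒Good W dist)))
  , (λ W dist → KEquiv⇒HypDist W (from-W₁₈ W dist))
  where
  1+1≡0 = even-order⇒1+1≡0 𝔽 even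
  open CharacteristicTwo 𝔽 1+1≡0
  open Canonical (proj₁ rootfree-parameter) (proj₂ rootfree-parameter)
  from-W₁₈ : ∀ W → PointDist₁₈ W → KEquiv 𝔽 W₁₈ W
  from-W₁₈ W dist = Good⇒KEquiv W (PointDist⇒Good W dist)
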